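{- For $11\leq n\leq 12$, $$\gamma^{LD}(\mathbb{F}^n)\geq \frac{2^{n+1}}{n+1+2(n-1)/(3(n-4))},$$ and for $n\geq 13$, $$\gamma^{LD}(\mathbb{F}^n)\geq \frac{2^{n+1}}{n+2+2/(n^2-5n)-4/(3n)}.$$
   Context: $\mathbb{F}^n$ is the binary Hamming space (binary words of length $n$, adjacent when they differ in exactly one coordinate). For a code $C\subseteq\mathbb{F}^n$ (nonempty set) and a word $\mathbf{u}$, $I(\mathbf{u})=C\cap N[\mathbf{u}]$, where $N[\mathbf{u}]$ is $\mathbf{u}$ together with all words at Hamming distance $1$ from $\mathbf{u}$. $C$ is locating-dominating if $I(\mathbf{u})\neq\emptyset$ for all words $\mathbf{u}$ and $I(\mathbf{u})\neq I(\mathbf{v})$ for all distinct words $\mathbf{u},\mathbf{v}\notin C$. $\gamma^{LD}(\mathbb{F}^n)$ denotes the minimum cardinality of a locating-dominating code in $\mathbb{F}^n$. -}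

module Defs where

open import Data.Nat using (ℕ; zero; suc; _+_; _*_; _∸_; _^_; _≤_)
open import Data.Bool using (Bool; true; false; _xor_)
open import Data.Vec using (Vec; []; _∷_)
open import Data.List using (List; length)
open import Data.List.Membership.Propositional using (_∈_; _∉_)
open import Data.List.Relation.Unary.Unique.Propositional using (Unique)
open import Data.Product using (Σ; ∃; _×_; _,_)
open import Function.Bundles using (_⇔_)
open import Relation.Binary.PropositionalEquality using (_≡_; _≢_)
open import Relation.Nullary using (¬_)

Word : ℕ → Set
Word n = Vec Bool n

dist : ∀ {n} → Word n → Word n → ℕ
dist []       []       = 0
dist (x ∷ xs) (y ∷ ys) = (if-diff x y) + dist xs ys
  where
  if-diff : Bool → Bool → ℕ
  if-diff a b with a xor b
  ... | true  = 1
  ... | false = 0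

record Code (n : ℕ) : Set where
  constructor code
  field
    words  : List (Word n)
    unique : Unique words
open Code public

∣_∣ᶜ : ∀ {n} → Code n → ℕ
∣ C ∣ᶜ = length (words C)

_∈I[_]_ : ∀ {n} → Word n → Code n → Word n → Set
c ∈I[ C ] u = (c ∈ words C) × (dist c u ≤ 1)

SameI : ∀ {n} → Code n → Word n → Word n → Set
SameI C u v = ∀ c → (c ∈I[ C ] u) ⇔ (c ∈I[ C ] v)

record LocatingDominating {n : ℕ} (C : Code n) : Set where
  field
    dominating : ∀ (u : Word n) → ∃ λ c → c ∈I[ C ] u
    locating   : ∀ (u v : Word n) → u ∉ words C → v ∉ words C → u ≢ v → ¬ SameI C u v

-- γ^LD(𝔽ⁿ) ≥ p / q  (q > 0)  ⇔  every LD code C satisfies q·|C| ≥ p.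
γLD-≥-frac : (n p q : ℕ) → Set
γLD-≥-frac n p q = ∀ (C : Code n) → LocatingDominating C → p ≤ q * ∣ C ∣ᶜ

{-# OPTIONS --safe #-}
module Submission where

-- Every word x spreads a unit charge evenly over I(x); the share of a codeword is the charge it
-- receives, so the claim is that the average share is at most T = (n + 2)/2 − X for a small X.
-- Around a codeword c, join the directions i and j when c ⊕ i ⊕ j is a codeword. Location allows
-- at most one vertex with |I(c ⊕ i)| = 1 and no two adjacent ones with |I| = 2, so the savings made
-- by the vertices with |I| ≥ 3 bring the share below T, unless c is isolated and the graph is a star
-- plus one isolated vertex. The centre u of the star then has n − 1 codeword neighbours, and the
-- word u ⊕ z in the missing direction z must be dominated through some codeword u ⊕ i ⊕ z, which
-- makes u ⊕ i poor enough to pay for the stars around u, together with the codeword u ⊕ i ⊕ z if all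
-- other neighbours of u are stars. The payments are routed through hubs, the non-codewords with at
-- least n − 2 codeword neighbours; a codeword with two hubs has a very small share.

open import Defs
open import Data.Nat using (ℕ; zero; suc; _+_; _*_; _∸_; _^_; _≤_; z≤n; s≤s; _≤?_; pred; _!)
import Data.Nat as ℕ
open import Data.Nat.Properties
open import Data.Nat.DivMod using (_/_; /-monoʳ-≤; m*[n/m]≡n)
open import Data.Nat.Divisibility using (∣-trans; m∣m*n; m≤n⇒m!∣n!)
open import Data.Nat.Tactic.RingSolver using (solve-∀)
open import Data.Bool using (Bool; true; false; not)
import Data.Bool.Properties as Bool
open import Data.Empty using (⊥; ⊥-elim)
open import Data.Fin using (Fin; zero; suc)
import Data.Fin.Properties as Fin
open import Data.List using (List; []; _∷_; length)
open import Data.List.Membership.Propositional using (_∈_; _∉_)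
import Data.List.Membership.DecPropositional as DecMembership
open import Data.Product using (∃; _×_; _,_; proj₁; proj₂)
open import Data.Sum using (_⊎_; inj₁; inj₂)
open import Data.Vec using ([]; _∷_; tail)
open import Data.Vec.Properties using (≡-dec)
open import Function using (_∘_)
open import Function.Bundles using (mk⇔)
open import Relation.Binary.PropositionalEquality using (_≡_; _≢_; refl; sym; trans; cong; cong₂; subst)
open import Relation.Nullary using (¬_; Dec; yes; no; contradiction)
open import Relation.Nullary.Decidable using (_×-dec_; _→-dec_; ¬?; ⌊_⌋)
open import Algebra.Properties.Semiring.Sum +-*-semiring using (sum; sum-cong-≗; ∑-distrib-+; *-distribˡ-sum; *-distribʳ-sum)

-- A star exceeds the target by at most `X` plus 1/(n - 1). As n - 1 times 1/(n - 1) is one full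
-- charge, the n - 1 codewords around a centre exceed it by at most one full charge plus (n - 1)`X`.
-- The poor neighbour saves just the full charge. The rest is at most `4 * s`, two thirds of a
-- charge, and any further deviation from stars makes it good; only if there is none must the
-- further codeword bear (n - 1)`X` on top of its own `X`. Its graph has n - 2 vertices left for
-- savings, and the demand n`X` on them determines `X` for n ≥ 13. For n = 11 and 12 the limit
-- reached is that of an isolated codeword with two heavy vertices in place of a star. The
-- difficulty: if a neighbour of the further codeword sees n - 2 codewords, it may be the only heavy
-- vertex, and its savings may fall short of n`X`. The deficit is then spread over all codewords
-- around that neighbour. This is why hubs begin at n - 2 although centres see n - 1.

-- Linear arithmetic by a certificate: a ≤ b follows from L ≤ R once
-- b − a = (R − L) + d is a semiring identity (with no subtraction).
linear : ∀ {a b L R} d → L ≤ R → a + R + d ≡ b + L → a ≤ b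
linear {a} {b} {L} {R} d L≤R eq = +-cancelʳ-≤ R a b (begin
  a + R      ≤⟨ m≤m+n (a + R) d ⟩
  a + R + d  ≡⟨ eq ⟩
  b + L      ≤⟨ +-monoʳ-≤ b L≤R ⟩
  b + R      ∎)
  where open ≤-Reasoning

⟦_⟧ : Bool → ℕ
⟦ true  ⟧ = 1
⟦ false ⟧ = 0

⟦_⟧≤1 : ∀ b → ⟦ b ⟧ ≤ 1
⟦ true  ⟧≤1 = ≤-refl
⟦ false ⟧≤1 = z≤n

≢true⇒≡false : ∀ {b} → b ≢ true → b ≡ false
≢true⇒≡false {true}  b≢ = contradiction refl b≢
≢true⇒≡false {false} b≢ = refl

true≢false : ∀ {b} → b ≡ true → b ≡ false → ⊥
true≢false refl ()

decide-fin : ∀ {n} {P Q : Fin n → Set} → (∀ i → P i ⊎ Q i) → (∀ i → P i) ⊎ ∃ Q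
decide-fin {zero}  f = inj₁ λ ()
decide-fin {suc n} f with f zero | decide-fin (f ∘ suc)
... | inj₂ q | _            = inj₂ (zero , q)
... | inj₁ p | inj₂ (i , q) = inj₂ (suc i , q)
... | inj₁ p | inj₁ ps      = inj₁ λ { zero → p ; (suc i) → ps i }

-- Sums over Fin n

sum-mono : ∀ {n} {f g : Fin n → ℕ} → (∀ i → f i ≤ g i) → sum f ≤ sum g
sum-mono {zero}  f≤g = z≤n
sum-mono {suc n} f≤g = +-mono-≤ (f≤g zero) (sum-mono (f≤g ∘ suc))

sum-const : ∀ n c → sum {n} (λ _ → c) ≡ n * c
sum-const zero    c = refl
sum-const (suc n) c = cong (c +_) (sum-const n c)

sum-pos : ∀ {n} (f : Fin n → ℕ) → 1 ≤ sum f → ∃ λ i → 1 ≤ f i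
sum-pos {suc n} f 1≤ with f zero in eq
... | suc m = zero , subst (1 ≤_) (sym eq) (s≤s z≤n)
... | zero  with sum-pos (f ∘ suc) 1≤
...   | i , 1≤fi = suc i , 1≤fi

at : ∀ {n} → Fin n → ℕ → Fin n → ℕ
at zero    x zero    = x
at zero    x (suc i) = 0
at (suc j) x zero    = 0
at (suc j) x (suc i) = at j x i

at-same : ∀ {n} (j : Fin n) x → at j x j ≡ x
at-same zero    x = refl
at-same (suc j) x = at-same j x

at-other : ∀ {n} {j i : Fin n} x → i ≢ j → at j x i ≡ 0
at-other {j = zero}  {zero}  x i≢j = contradiction refl i≢j
at-other {j = zero}  {suc i} x i≢j = refl
at-other {j = suc j} {zero}  x i≢j = refl
at-other {j = suc j} {suc i} x i≢j = at-other x (i≢j ∘ cong suc)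

sum-at : ∀ {n} (j : Fin n) x → sum (at j x) ≡ x
sum-at {suc n} zero x = trans (cong (x +_) (trans (sum-const n 0) (*-zeroʳ n))) (+-identityʳ x)
sum-at (suc j) x = sum-at j x

sum-+-at : ∀ {n} (f : Fin n → ℕ) j x → sum (λ i → f i + at j x i) ≡ sum f + x
sum-+-at f j x = trans (∑-distrib-+ f (at j x)) (cong (sum f +_) (sum-at j x))

+-at-≤ : ∀ {n} {f B : Fin n → ℕ} h {x} → (∀ i → f i ≤ B i) → f h + x ≤ B h →
         ∀ i → f i + at h x i ≤ B i
+-at-≤ {f = f} {B} h {x} f≤B fh i with i Fin.≟ h
... | yes refl = subst (λ y → f i + y ≤ B i) (sym (at-same i x)) fh
... | no  i≢h  = subst (λ y → f i + y ≤ B i) (sym (at-other x i≢h))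
                   (subst (_≤ B i) (sym (+-identityʳ (f i))) (f≤B i))

+-at-other : ∀ {n} {f : Fin n → ℕ} {h i x y b} → i ≢ h → f i + y ≤ b → (f i + at h x i) + y ≤ b
+-at-other {f = f} {i = i} {x = x} {y} {b} i≢h le =
  subst (λ v → v + y ≤ b) (sym (trans (cong (f i +_) (at-other x i≢h)) (+-identityʳ (f i)))) le

sum-save₁ : ∀ {n} {f B : Fin n → ℕ} {h x} → (∀ i → f i ≤ B i) → f h + x ≤ B h → sum f + x ≤ sum B
sum-save₁ {f = f} {B} {h} {x} f≤B fh =
  subst (_≤ sum B) (sum-+-at f h x) (sum-mono (+-at-≤ h f≤B fh))

sum-save₂ : ∀ {n} {f B : Fin n → ℕ} {h i x y} → (∀ i → f i ≤ B i) → h ≢ i →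
            f h + x ≤ B h → f i + y ≤ B i → sum f + x + y ≤ sum B
sum-save₂ {f = f} {B} {h} {i} {x} {y} f≤B h≢i fh fi =
  subst (λ v → v + y ≤ sum B) (sum-+-at f h x)
    (sum-save₁ {h = i} (+-at-≤ h f≤B fh) (+-at-other {f = f} (h≢i ∘ sym) fi))

sum-save₃ : ∀ {n} {f B : Fin n → ℕ} {h i j x y z} → (∀ i → f i ≤ B i) → h ≢ i → h ≢ j → i ≢ j →
            f h + x ≤ B h → f i + y ≤ B i → f j + z ≤ B j → sum f + x + y + z ≤ sum B
sum-save₃ {f = f} {B} {h} {i} {j} {x} {y} {z} f≤B h≢i h≢j i≢j fh fi fj =
  subst (λ v → v + y + z ≤ sum B) (sum-+-at f h x)
    (sum-save₂ {h = i} {j} (+-at-≤ h f≤B fh) i≢j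
      (+-at-other {f = f} (h≢i ∘ sym) fi) (+-at-other {f = f} (h≢j ∘ sym) fj))

sum-save₄ : ∀ {n} {f B : Fin n → ℕ} {h i j k x y z t} → (∀ i → f i ≤ B i) →
            h ≢ i → h ≢ j → h ≢ k → i ≢ j → i ≢ k → j ≢ k →
            f h + x ≤ B h → f i + y ≤ B i → f j + z ≤ B j → f k + t ≤ B k →
            sum f + x + y + z + t ≤ sum B
sum-save₄ {f = f} {B} {h} {i} {j} {k} {x} {y} {z} {t} f≤B h≢i h≢j h≢k i≢j i≢k j≢k fh fi fj fk =
  subst (λ v → v + y + z + t ≤ sum B) (sum-+-at f h x)
    (sum-save₃ {h = i} {j} {k} (+-at-≤ h f≤B fh) i≢j i≢k j≢k
      (+-at-other {f = f} (h≢i ∘ sym) fi) (+-at-other {f = f} (h≢j ∘ sym) fj)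
      (+-at-other {f = f} (h≢k ∘ sym) fk))

count : ∀ {n} → (Fin n → Bool) → ℕ
count b = sum (λ i → ⟦ b i ⟧)

private
  0≤⟦_⟧ : ∀ {n} (b : Fin n → Bool) i → 0 ≤ ⟦ b i ⟧
  0≤⟦ b ⟧ i = z≤n

  true⇒1≤ : ∀ {b} → b ≡ true → 1 ≤ ⟦ b ⟧
  true⇒1≤ refl = ≤-refl

  false⇒+1≤ : ∀ {b} → b ≡ false → ⟦ b ⟧ + 1 ≤ 1
  false⇒+1≤ refl = ≤-refl

  sum-0 : ∀ n → sum {n} (λ _ → 0) ≡ 0
  sum-0 n = trans (sum-const n 0) (*-zeroʳ n)

count-≥1 : ∀ {n} {b : Fin n → Bool} {i} → b i ≡ true → 1 ≤ count b
count-≥1 {n} {b} {i} bi =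
  subst (λ v → v + 1 ≤ count b) (sum-0 n) (sum-save₁ {h = i} (0≤⟦ b ⟧) (true⇒1≤ bi))

count-≥2 : ∀ {n} {b : Fin n → Bool} {i j} → i ≢ j → b i ≡ true → b j ≡ true → 2 ≤ count b
count-≥2 {n} {b} {i} {j} i≢j bi bj =
  subst (λ v → v + 1 + 1 ≤ count b) (sum-0 n)
    (sum-save₂ {h = i} {j} (0≤⟦ b ⟧) i≢j (true⇒1≤ bi) (true⇒1≤ bj))

count-≥3 : ∀ {n} {b : Fin n → Bool} {i j k} → i ≢ j → i ≢ k → j ≢ k →
           b i ≡ true → b j ≡ true → b k ≡ true → 3 ≤ count b
count-≥3 {n} {b} {i} {j} {k} i≢j i≢k j≢k bi bj bk =
  subst (λ v → v + 1 + 1 + 1 ≤ count b) (sum-0 n)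
    (sum-save₃ {h = i} {j} {k} (0≤⟦ b ⟧) i≢j i≢k j≢k (true⇒1≤ bi) (true⇒1≤ bj) (true⇒1≤ bk))

private
  sum-1 : ∀ n → sum {n} (λ _ → 1) ≡ n
  sum-1 n = trans (sum-const n 1) (*-identityʳ n)

count-≤ : ∀ {n} (b : Fin n → Bool) → count b ≤ n
count-≤ {n} b = subst (count b ≤_) (sum-1 n) (sum-mono (λ i → ⟦ b i ⟧≤1))

count-miss₁ : ∀ {n} {b : Fin n → Bool} {i} → b i ≡ false → count b + 1 ≤ n
count-miss₁ {n} {b} {i} bi =
  subst (count b + 1 ≤_) (sum-1 n) (sum-save₁ {h = i} (λ j → ⟦ b j ⟧≤1) (false⇒+1≤ bi))

count-miss₂ : ∀ {n} {b : Fin n → Bool} {i j} → i ≢ j → b i ≡ false → b j ≡ false → count b + 2 ≤ n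
count-miss₂ {n} {b} {i} {j} i≢j bi bj =
  subst (_≤ n) (+-assoc (count b) 1 1)
    (subst (count b + 1 + 1 ≤_) (sum-1 n)
      (sum-save₂ {h = i} {j} (λ j → ⟦ b j ⟧≤1) i≢j (false⇒+1≤ bi) (false⇒+1≤ bj)))

count-miss₃ : ∀ {n} {b : Fin n → Bool} {i j k} → i ≢ j → i ≢ k → j ≢ k →
              b i ≡ false → b j ≡ false → b k ≡ false → count b + 3 ≤ n
count-miss₃ {n} {b} {i} {j} {k} i≢j i≢k j≢k bi bj bk =
  subst (_≤ n) (trans (+-assoc (count b + 1) 1 1) (+-assoc (count b) 1 2))
    (subst (count b + 1 + 1 + 1 ≤_) (sum-1 n)
      (sum-save₃ {h = i} {j} {k} (λ j → ⟦ b j ⟧≤1) i≢j i≢k j≢k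
        (false⇒+1≤ bi) (false⇒+1≤ bj) (false⇒+1≤ bk)))

count-all-but₁ : ∀ {n} {b : Fin n → Bool} z → (∀ i → i ≢ z → b i ≡ true) → n ≤ count b + 1
count-all-but₁ {n} {b} z all =
  subst (_≤ count b + 1) (sum-1 n) (subst (sum {n} (λ _ → 1) ≤_) (sum-+-at (λ i → ⟦ b i ⟧) z 1) (sum-mono ptw))
  where
  ptw : ∀ i → 1 ≤ ⟦ b i ⟧ + at z 1 i
  ptw i with i Fin.≟ z
  ... | yes refl = subst (λ v → 1 ≤ ⟦ b i ⟧ + v) (sym (at-same i 1)) (m≤n+m 1 ⟦ b i ⟧)
  ... | no i≢z   = ≤-trans (true⇒1≤ (all i i≢z)) (m≤m+n _ _)

count-all-but₂ : ∀ {n} {b : Fin n → Bool} y z → (∀ i → i ≢ y → i ≢ z → b i ≡ true) → n ≤ count b + 2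
count-all-but₂ {n} {b} y z all =
  subst (_≤ count b + 2) (sum-1 n)
    (subst (sum {n} (λ _ → 1) ≤_)
      (trans (sum-+-at (λ i → ⟦ b i ⟧ + at y 1 i) z 1)
        (trans (cong (_+ 1) (sum-+-at (λ i → ⟦ b i ⟧) y 1)) (+-assoc (count b) 1 1)))
      (sum-mono ptw))
  where
  ptw : ∀ i → 1 ≤ ⟦ b i ⟧ + at y 1 i + at z 1 i
  ptw i with i Fin.≟ z | i Fin.≟ y
  ... | yes refl | _ = subst (λ v → 1 ≤ ⟦ b i ⟧ + at y 1 i + v) (sym (at-same i 1)) (m≤n+m 1 _)
  ... | no _ | yes refl =
    ≤-trans (subst (λ v → 1 ≤ ⟦ b i ⟧ + v) (sym (at-same i 1)) (m≤n+m 1 ⟦ b i ⟧)) (m≤m+n _ _)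
  ... | no i≢z | no i≢y = ≤-trans (≤-trans (true⇒1≤ (all i i≢y i≢z)) (m≤m+n _ _)) (m≤m+n _ _)

count-witness : ∀ {n} {b : Fin n → Bool} → 1 ≤ count b → ∃ λ i → b i ≡ true
count-witness {b = b} 1≤ with sum-pos (λ i → ⟦ b i ⟧) 1≤
... | i , 1≤bi = i , lemma 1≤bi
  where
  lemma : ∀ {b} → 1 ≤ ⟦ b ⟧ → b ≡ true
  lemma {true} _ = refl

count-witness₂ : ∀ {n} {b : Fin n → Bool} i → 2 ≤ count b → ∃ λ j → j ≢ i × b j ≡ true
count-witness₂ {n} {b} i 2≤ with decide-fin test
  where
  test : ∀ j → (j ≢ i → b j ≡ false) ⊎ (j ≢ i × b j ≡ true)
  test j with j Fin.≟ i | b j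
  ... | yes j≡i | _     = inj₁ (λ j≢i → contradiction j≡i j≢i)
  ... | no  j≢i | true  = inj₂ (j≢i , refl)
  ... | no  _   | false = inj₁ (λ _ → refl)
... | inj₂ w = w
... | inj₁ none = contradiction (≤-trans 2≤ small) (λ { (s≤s ()) })
  where
  ptw : ∀ j → ⟦ b j ⟧ ≤ at i 1 j
  ptw j with j Fin.≟ i
  ... | yes refl = subst (⟦ b j ⟧ ≤_) (sym (at-same j 1)) ⟦ b j ⟧≤1
  ... | no j≢i rewrite none j j≢i = z≤n
  small : count b ≤ 1
  small = subst (count b ≤_) (sum-at i 1) (sum-mono ptw)

-- Sums over all words

sumW : ∀ {n} → (Word n → ℕ) → ℕ
sumW {zero}  f = f []
sumW {suc n} f = sumW (f ∘ (false ∷_)) + sumW (f ∘ (true ∷_))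

sumW-mono : ∀ {n} {f g : Word n → ℕ} → (∀ x → f x ≤ g x) → sumW f ≤ sumW g
sumW-mono {zero}  f≤g = f≤g []
sumW-mono {suc n} f≤g = +-mono-≤ (sumW-mono (f≤g ∘ (false ∷_))) (sumW-mono (f≤g ∘ (true ∷_)))

sumW-cong : ∀ {n} {f g : Word n → ℕ} → (∀ x → f x ≡ g x) → sumW f ≡ sumW g
sumW-cong {zero}  f≡g = f≡g []
sumW-cong {suc n} f≡g = cong₂ _+_ (sumW-cong (f≡g ∘ (false ∷_))) (sumW-cong (f≡g ∘ (true ∷_)))

private
  interchange : ∀ a b c d → (a + b) + (c + d) ≡ (a + c) + (b + d)
  interchange = solve-∀

sumW-+ : ∀ {n} (f g : Word n → ℕ) → sumW (λ x → f x + g x) ≡ sumW f + sumW g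
sumW-+ {zero}  f g = refl
sumW-+ {suc n} f g = trans
  (cong₂ _+_ (sumW-+ (f ∘ (false ∷_)) (g ∘ (false ∷_))) (sumW-+ (f ∘ (true ∷_)) (g ∘ (true ∷_))))
  (interchange (sumW (f ∘ (false ∷_))) (sumW (g ∘ (false ∷_))) (sumW (f ∘ (true ∷_))) (sumW (g ∘ (true ∷_))))

sumW-*ʳ : ∀ {n} (f : Word n → ℕ) c → sumW (λ x → f x * c) ≡ sumW f * c
sumW-*ʳ {zero}  f c = refl
sumW-*ʳ {suc n} f c = trans (cong₂ _+_ (sumW-*ʳ (f ∘ (false ∷_)) c) (sumW-*ʳ (f ∘ (true ∷_)) c))
  (sym (*-distribʳ-+ c (sumW (f ∘ (false ∷_))) (sumW (f ∘ (true ∷_)))))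

sumW-0 : ∀ n → sumW {n} (λ _ → 0) ≡ 0
sumW-0 n = trans (sumW-*ʳ {n} (λ _ → 0) 0) (*-zeroʳ (sumW {n} (λ _ → 0)))

sumW-const : ∀ n c → sumW {n} (λ _ → c) ≡ 2 ^ n * c
sumW-const zero    c = sym (*-identityˡ c)
sumW-const (suc n) c = trans (cong₂ _+_ (sumW-const n c) (sumW-const n c)) (double (2 ^ n) c)
  where
  double : ∀ x c → x * c + x * c ≡ 2 * x * c
  double = solve-∀

sumW-sum : ∀ {n k} (f : Word n → Fin k → ℕ) →
           sumW (λ x → sum (f x)) ≡ sum (λ i → sumW (λ x → f x i))
sumW-sum {n} {zero}  f = sumW-0 n
sumW-sum {n} {suc k} f = trans (sumW-+ (λ x → f x zero) (λ x → sum (f x ∘ suc)))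
  (cong (sumW (λ x → f x zero) +_) (sumW-sum (λ x → f x ∘ suc)))

-- Flipping a coordinate in the Hamming space.

_⊕_ : ∀ {n} → Word n → Fin n → Word n
(x ∷ xs) ⊕ zero  = not x ∷ xs
(x ∷ xs) ⊕ suc i = x ∷ (xs ⊕ i)

infixl 8 _⊕_

⊕-involutive : ∀ {n} (x : Word n) i → x ⊕ i ⊕ i ≡ x
⊕-involutive (true  ∷ xs) zero    = refl
⊕-involutive (false ∷ xs) zero    = refl
⊕-involutive (x     ∷ xs) (suc i) = cong (x ∷_) (⊕-involutive xs i)

⊕-comm : ∀ {n} (x : Word n) i j → x ⊕ i ⊕ j ≡ x ⊕ j ⊕ i
⊕-comm (x ∷ xs) zero    zero    = refl
⊕-comm (x ∷ xs) zero    (suc j) = refl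
⊕-comm (x ∷ xs) (suc i) zero    = refl
⊕-comm (x ∷ xs) (suc i) (suc j) = cong (x ∷_) (⊕-comm xs i j)

⊕-≢ : ∀ {n} (x : Word n) {i j} → i ≢ j → x ⊕ i ≢ x ⊕ j
⊕-≢ (x     ∷ xs) {zero}  {zero}  i≢j eq = i≢j refl
⊕-≢ (true  ∷ xs) {zero}  {suc j} i≢j ()
⊕-≢ (false ∷ xs) {zero}  {suc j} i≢j ()
⊕-≢ (true  ∷ xs) {suc i} {zero}  i≢j ()
⊕-≢ (false ∷ xs) {suc i} {zero}  i≢j ()
⊕-≢ (x     ∷ xs) {suc i} {suc j} i≢j eq = ⊕-≢ xs (i≢j ∘ cong suc) (cong tail eq)

sumW-⊕ : ∀ {n} (f : Word n → ℕ) i → sumW (λ x → f (x ⊕ i)) ≡ sumW f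
sumW-⊕ f zero    = +-comm (sumW (f ∘ (true ∷_))) (sumW (f ∘ (false ∷_)))
sumW-⊕ f (suc i) = cong₂ _+_ (sumW-⊕ (f ∘ (false ∷_)) i) (sumW-⊕ (f ∘ (true ∷_)) i)

sumW-singleton : ∀ {n} (y : Word n) (f : Word n → ℕ) → f y ≤ 1 → (∀ x → x ≢ y → f x ≡ 0) → sumW f ≤ 1
sumW-singleton {zero}  []          f fy f0 = fy
sumW-singleton {suc n} (true ∷ y)  f fy f0 =
  +-mono-≤ (≤-reflexive (trans (sumW-cong (λ x → f0 (false ∷ x) λ ())) (sumW-0 n)))
           (sumW-singleton y (f ∘ (true ∷_)) fy (λ x x≢y → f0 (true ∷ x) (x≢y ∘ cong tail)))
sumW-singleton {suc n} (false ∷ y) f fy f0 = subst (sumW (f ∘ (false ∷_)) + sumW (f ∘ (true ∷_)) ≤_) (+-identityʳ 1)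
  (+-mono-≤ (sumW-singleton y (f ∘ (false ∷_)) fy (λ x x≢y → f0 (false ∷ x) (x≢y ∘ cong tail)))
            (≤-reflexive (trans (sumW-cong (λ x → f0 (true ∷ x) λ ())) (sumW-0 n))))

-- Scaled reciprocals and their inequalities.

-- w k stands for 1/k, in units of 1/(6 s).
record Weight (n s : ℕ) : Set where
  field
    w          : ℕ → ℕ
    w-antitone : ∀ {k l} → k ≤ l → w l ≤ w k
    w-exact    : ∀ {k} → 1 ≤ k → k ≤ suc n → k * w k ≡ 6 * s

module WeightProperties {n s : ℕ} (W : Weight n s) (11≤n : 11 ≤ n) where
  open Weight W public

  private
    small : ∀ {k} → k ≤ 12 → k ≤ suc n
    small k≤12 = ≤-trans k≤12 (s≤s 11≤n)

    cancel : ∀ k {x y} → suc k * x ≡ suc k * y → x ≡ y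
    cancel k {x} {y} = *-cancelˡ-≡ x y (suc k)

  w1 : w 1 ≡ 6 * s
  w1 = trans (sym (*-identityˡ (w 1))) (w-exact (s≤s z≤n) (small (s≤s z≤n)))

  w2 : w 2 ≡ 3 * s
  w2 = cancel 1 (trans (w-exact (s≤s z≤n) (small (s≤s (s≤s z≤n)))) (lemma s))
    where
    lemma : ∀ s → 6 * s ≡ 2 * (3 * s)
    lemma = solve-∀

  w3 : w 3 ≡ 2 * s
  w3 = cancel 2 (trans (w-exact (s≤s z≤n) (small (s≤s (s≤s (s≤s z≤n))))) (lemma s))
    where
    lemma : ∀ s → 6 * s ≡ 3 * (2 * s)
    lemma = solve-∀

  w4 : 2 * w 4 ≡ 3 * s
  w4 = cancel 1 (trans (lemma (w 4)) (trans (w-exact (s≤s z≤n) (small (m≤m+n 4 8))) (lemma′ s)))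
    where
    lemma : ∀ x → 2 * (2 * x) ≡ 4 * x
    lemma = solve-∀
    lemma′ : ∀ s → 6 * s ≡ 2 * (3 * s)
    lemma′ = solve-∀

  w6 : w 6 ≡ s
  w6 = cancel 5 (w-exact (s≤s z≤n) (small (m≤m+n 6 6)))

  w12 : 2 * w 12 ≡ s
  w12 = cancel 5 (trans (lemma (w 12)) (w-exact (s≤s z≤n) (small ≤-refl)))
    where
    lemma : ∀ x → 6 * (2 * x) ≡ 12 * x
    lemma = solve-∀

  w≤6s : ∀ {k} → 1 ≤ k → w k ≤ 6 * s
  w≤6s {k} 1≤k = subst (w k ≤_) w1 (w-antitone 1≤k)

  w≤3s : ∀ {k} → 2 ≤ k → w k ≤ 3 * s
  w≤3s {k} 2≤k = subst (w k ≤_) w2 (w-antitone 2≤k)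

  w≤2s : ∀ {k} → 3 ≤ k → w k ≤ 2 * s
  w≤2s {k} 3≤k = subst (w k ≤_) w3 (w-antitone 3≤k)

  -- Convexity of 1/k: the extreme splitting of x + y is 3 + μ.
  w-convex : ∀ {x y} μ → 3 ≤ x → 3 ≤ y → 3 + μ ≤ x + y → μ ≤ suc n → w x + w y ≤ 2 * s + w μ
  w-convex {x} {y} μ 3≤x 3≤y sum≥ μ≤ with μ ≤? x
  ... | yes μ≤x = subst (_≤ 2 * s + w μ) (+-comm (w y) (w x)) (+-mono-≤ (w≤2s 3≤y) (w-antitone μ≤x))
  ... | no  μ≰x with m≤n⇒∃[o]m+o≡n 3≤x | m≤n⇒∃[o]m+o≡n (≰⇒> μ≰x)
  ...   | α , refl | β , refl = ≤-trans (+-monoʳ-≤ (w (3 + α)) (w-antitone y′≤y)) A≤B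
    where
    y′ = 4 + β

    y′≤y : y′ ≤ y
    y′≤y = +-cancelˡ-≤ (3 + α) y′ y (subst (_≤ 3 + α + y) (lemma α β) sum≥)
      where
      lemma : ∀ α β → 3 + (4 + α + β) ≡ 3 + α + (4 + β)
      lemma = solve-∀

    ex : (3 + α) * w (3 + α) ≡ 6 * s
    ex = w-exact (s≤s z≤n) (≤-trans (≤-trans (n≤1+n (3 + α)) (m≤m+n (4 + α) β)) μ≤)

    ey : y′ * w y′ ≡ 6 * s
    ey = w-exact (s≤s z≤n) (≤-trans (s≤s (s≤s (s≤s (s≤s (m≤n+m β α))))) μ≤)

    eμ : (4 + α + β) * w (4 + α + β) ≡ 6 * s
    eμ = w-exact (s≤s z≤n) μ≤

    -- The denominators of 1/x + 1/y′ and of 1/3 + 1/μ have the same sum 7 + α + β, so only their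
    -- products matter: (3 + α)(4 + β) exceeds 3(4 + α + β) by α(1 + β).
    A≤B : w (3 + α) + w y′ ≤ 2 * s + w (4 + α + β)
    A≤B = *-cancelˡ-≤ ((3 + α) * y′) (begin
      (3 + α) * y′ * (w (3 + α) + w y′)                         ≡⟨ e₁ (3 + α) y′ (w (3 + α)) (w y′) ⟩
      y′ * ((3 + α) * w (3 + α)) + (3 + α) * (y′ * w y′)        ≡⟨ cong₂ (λ u v → y′ * u + (3 + α) * v) ex ey ⟩
      y′ * (6 * s) + (3 + α) * (6 * s)                          ≡⟨ e₂ α β s ⟩
      3 * (4 + α + β) * (2 * s) + 3 * (6 * s)                   ≡⟨ cong (λ v → 3 * (4 + α + β) * (2 * s) + 3 * v) eμ ⟨
      3 * (4 + α + β) * (2 * s) + 3 * ((4 + α + β) * w (4 + α + β)) ≡⟨ e₃ (4 + α + β) s (w (4 + α + β)) ⟩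
      3 * (4 + α + β) * (2 * s + w (4 + α + β))                 ≤⟨ *-monoˡ-≤ (2 * s + w (4 + α + β)) (subst (3 * (4 + α + β) ≤_) (e₄ α β) (m≤m+n (3 * (4 + α + β)) (α * (1 + β)))) ⟩
      (3 + α) * y′ * (2 * s + w (4 + α + β))                    ∎)
      where
      open ≤-Reasoning
      e₁ : ∀ x y u v → x * y * (u + v) ≡ y * (x * u) + x * (y * v)
      e₁ = solve-∀
      e₂ : ∀ α β s → (4 + β) * (6 * s) + (3 + α) * (6 * s) ≡ 3 * (4 + α + β) * (2 * s) + 3 * (6 * s)
      e₂ = solve-∀
      e₃ : ∀ m s v → 3 * m * (2 * s) + 3 * (m * v) ≡ 3 * m * (2 * s + v)
      e₃ = solve-∀
      e₄ : ∀ α β → 3 * (4 + α + β) + α * (1 + β) ≡ (3 + α) * (4 + β)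
      e₄ = solve-∀

  -- Larger sizes lower the weights, smaller sizes force a small `μ` and hence a small `Y`. A size
  -- of 6 or more brings the weights to `5 * s`, against `Y ≤ 4 * s`. If all are at most 5 and one
  -- is at least 4, then `μ ≤ 12` and `w μ` is at least half of `s`; this value of `w 12` is
  -- available because 12 ≤ n + 1. If all are 3, then `μ ≤ 6` and `w μ` is at least `s`.
  w-three : ∀ {x y z} μ Y → 3 ≤ x → 3 ≤ y → 3 ≤ z → 3 + μ ≤ x + y + z → Y + w μ ≤ 4 * s →
            w x + w y + w z + Y ≤ 9 * s
  w-three {x} {y} {z} μ Y 3≤x 3≤y 3≤z sum≥ Y≤ = go (6 ≤? x) (6 ≤? y) (6 ≤? z)
    where
    X₀ = w≤2s 3≤x
    Y₀ = w≤2s 3≤y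
    Z₀ = w≤2s 3≤z

    Y≤4s : Y ≤ 4 * s
    Y≤4s = ≤-trans (m≤m+n Y (w μ)) Y≤

    big : w x + w y + w z ≤ 5 * s → w x + w y + w z + Y ≤ 9 * s
    big le = subst (w x + w y + w z + Y ≤_) (lemma s) (+-mono-≤ le Y≤4s)
      where
      lemma : ∀ s → 5 * s + 4 * s ≡ 9 * s
      lemma = solve-∀

    six : ∀ {k} → 6 ≤ k → w k ≤ s
    six {k} 6≤k = subst (w k ≤_) w6 (w-antitone 6≤k)

    four : ∀ {k} → 4 ≤ k → 2 * w k ≤ 3 * s
    four {k} 4≤k = subst (2 * w k ≤_) w4 (*-monoʳ-≤ 2 (w-antitone 4≤k))

    medium : μ ≤ 12 → 2 * (w x + w y + w z) ≤ 11 * s → w x + w y + w z + Y ≤ 9 * s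
    medium μ≤12 le = *-cancelˡ-≤ 2 (linear 0
      (+-mono-≤ le (+-mono-≤ (*-monoʳ-≤ 2 Y≤) (≤-trans (≤-reflexive (sym w12)) (*-monoʳ-≤ 2 (w-antitone μ≤12)))))
      (lemma s (w x + w y + w z) Y (w μ)))
      where
      lemma : ∀ s A Y v → 2 * (A + Y) + (11 * s + (2 * (4 * s) + 2 * v)) + 0 ≡ 2 * (9 * s) + (2 * A + (2 * (Y + v) + s))
      lemma = solve-∀

    bound : ∀ {m} b → ¬ suc b ≤ m → m ≤ b
    bound b ≰ = ≤-pred (≰⇒> ≰)

    go : Dec (6 ≤ x) → Dec (6 ≤ y) → Dec (6 ≤ z) → w x + w y + w z + Y ≤ 9 * s
    go (yes p) _ _ = big (subst (w x + w y + w z ≤_) (lemma s) (+-mono-≤ (+-mono-≤ (six p) Y₀) Z₀))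
      where
      lemma : ∀ s → s + 2 * s + 2 * s ≡ 5 * s
      lemma = solve-∀
    go _ (yes p) _ = big (subst (w x + w y + w z ≤_) (lemma s) (+-mono-≤ (+-mono-≤ X₀ (six p)) Z₀))
      where
      lemma : ∀ s → 2 * s + s + 2 * s ≡ 5 * s
      lemma = solve-∀
    go _ _ (yes p) = big (subst (w x + w y + w z ≤_) (lemma s) (+-mono-≤ (+-mono-≤ X₀ Y₀) (six p)))
      where
      lemma : ∀ s → 2 * s + 2 * s + s ≡ 5 * s
      lemma = solve-∀
    go (no p) (no q) (no r) = go′ (4 ≤? x) (4 ≤? y) (4 ≤? z)
      where
      μ≤12 : μ ≤ 12
      μ≤12 = +-cancelˡ-≤ 3 μ 12 (≤-trans sum≥ (+-mono-≤ (+-mono-≤ (bound 5 p) (bound 5 q)) (bound 5 r)))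

      go′ : Dec (4 ≤ x) → Dec (4 ≤ y) → Dec (4 ≤ z) → w x + w y + w z + Y ≤ 9 * s
      go′ (yes p) _ _ = medium μ≤12 (linear 0 (+-mono-≤ (four p) (*-monoʳ-≤ 2 (+-mono-≤ Y₀ Z₀))) (lemma s (w x) (w y) (w z)))
        where
        lemma : ∀ s x y z → 2 * (x + y + z) + (3 * s + 2 * (2 * s + 2 * s)) + 0 ≡ 11 * s + (2 * x + 2 * (y + z))
        lemma = solve-∀
      go′ _ (yes p) _ = medium μ≤12 (linear 0 (+-mono-≤ (four p) (*-monoʳ-≤ 2 (+-mono-≤ X₀ Z₀))) (lemma s (w x) (w y) (w z)))
        where
        lemma : ∀ s x y z → 2 * (x + y + z) + (3 * s + 2 * (2 * s + 2 * s)) + 0 ≡ 11 * s + (2 * y + 2 * (x + z))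
        lemma = solve-∀
      go′ _ _ (yes p) = medium μ≤12 (linear 0 (+-mono-≤ (four p) (*-monoʳ-≤ 2 (+-mono-≤ X₀ Y₀))) (lemma s (w x) (w y) (w z)))
        where
        lemma : ∀ s x y z → 2 * (x + y + z) + (3 * s + 2 * (2 * s + 2 * s)) + 0 ≡ 11 * s + (2 * z + 2 * (x + y))
        lemma = solve-∀
      go′ (no p) (no q) (no r) = linear 0
        (+-mono-≤ (+-mono-≤ (+-mono-≤ X₀ Y₀) Z₀) (+-mono-≤ Y≤ (≤-trans (≤-reflexive (sym w6)) (w-antitone μ≤6))))
        (lemma s (w x) (w y) (w z) Y (w μ))
        where
        μ≤6 : μ ≤ 6
        μ≤6 = +-cancelˡ-≤ 3 μ 6 (≤-trans sum≥ (+-mono-≤ (+-mono-≤ (bound 3 p) (bound 3 q)) (bound 3 r)))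
        lemma : ∀ s x y z Y v → x + y + z + Y + (2 * s + 2 * s + 2 * s + (4 * s + v)) + 0 ≡ 9 * s + (x + y + z + (Y + v + s))
        lemma = solve-∀

-- The graph around a codeword: private neighbours and heavy vertices.

-- The neighbourhood of a codeword c: a i records whether c ⊕ i is a codeword,
-- b i j whether c ⊕ i ⊕ j is, so that k i = |I(c ⊕ i)|.
module Neighbourhood {n s : ℕ} (W : Weight n s) (11≤n : 11 ≤ n)
  (a : Fin n → Bool) (b : Fin n → Fin n → Bool)
  (b-refl : ∀ i → b i i ≡ true) (b-sym : ∀ i j → b i j ≡ b j i) where

  open WeightProperties W 11≤n

  k : Fin n → ℕ
  k i = ⟦ a i ⟧ + count (b i)

  count≤k : ∀ i → count (b i) ≤ k i
  count≤k i = m≤n+m (count (b i)) ⟦ a i ⟧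

  1≤k : ∀ i → 1 ≤ k i
  1≤k i = ≤-trans (count-≥1 {i = i} (b-refl i)) (count≤k i)

  a⇒2≤k : ∀ {i} → a i ≡ true → 2 ≤ k i
  a⇒2≤k {i} ai rewrite ai = s≤s (count-≥1 {i = i} (b-refl i))

  b⇒2≤k : ∀ {i j} → i ≢ j → b i j ≡ true → 2 ≤ k i
  b⇒2≤k {i} i≢j bij = ≤-trans (count-≥2 i≢j (b-refl i) bij) (count≤k i)

  ab⇒3≤k : ∀ {i j} → i ≢ j → a i ≡ true → b i j ≡ true → 3 ≤ k i
  ab⇒3≤k {i} i≢j ai bij rewrite ai = s≤s (count-≥2 i≢j (b-refl i) bij)

  bb⇒3≤k : ∀ {i j l} → i ≢ j → i ≢ l → j ≢ l → b i j ≡ true → b i l ≡ true → 3 ≤ k i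
  bb⇒3≤k {i} i≢j i≢l j≢l bij bil = ≤-trans (count-≥3 i≢j i≢l j≢l (b-refl i) bij bil) (count≤k i)

  k≡1⇒¬a : ∀ {i} → k i ≡ 1 → a i ≡ false
  k≡1⇒¬a {i} ki = ≢true⇒≡false λ ai → contradiction (subst (2 ≤_) ki (a⇒2≤k ai)) (λ { (s≤s ()) })

  k≡1⇒¬b : ∀ {i j} → k i ≡ 1 → i ≢ j → b i j ≡ false
  k≡1⇒¬b {i} ki i≢j = ≢true⇒≡false λ bij → contradiction (subst (2 ≤_) ki (b⇒2≤k i≢j bij)) (λ { (s≤s ()) })

  k≡2⇒b : ∀ {i} → a i ≡ false → k i ≡ 2 → ∃ λ j → j ≢ i × b i j ≡ true
  k≡2⇒b {i} ai ki rewrite ai = count-witness₂ i (≤-reflexive (sym ki))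

  ¬a⇒k≡count : ∀ {i} → a i ≡ false → k i ≡ count (b i)
  ¬a⇒k≡count ai rewrite ai = refl

  share : ℕ
  share = w (suc (count a)) + sum (λ i → w (k i))

  self≤6s : w (suc (count a)) ≤ 6 * s
  self≤6s = w≤6s (s≤s z≤n)

  self≤3s : ∀ {i} → a i ≡ true → w (suc (count a)) ≤ 3 * s
  self≤3s {i} ai = w≤3s (s≤s (count-≥1 {b = a} {i} ai))

  halves : Fin n → ℕ
  halves _ = 3 * s

  -- The allowance of half a charge per neighbour, doubled at `z`, the one neighbour that may have
  -- `c` as its only codeword.
  halves⁺ : Fin n → Fin n → ℕ
  halves⁺ z i = 3 * s + at z (3 * s) i

  sum-halves : sum halves ≡ n * (3 * s)
  sum-halves = sum-const n (3 * s)

  sum-halves⁺ : ∀ z → sum (halves⁺ z) ≡ n * (3 * s) + 3 * s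
  sum-halves⁺ z = trans (sum-+-at halves z (3 * s)) (cong (_+ 3 * s) sum-halves)

  w≤halves⁺ : ∀ z → (∀ i → i ≢ z → 2 ≤ k i) → ∀ i → w (k i) ≤ halves⁺ z i
  w≤halves⁺ z 2≤k i with i Fin.≟ z
  ... | no i≢z   = ≤-trans (w≤3s (2≤k i i≢z)) (m≤m+n _ _)
  ... | yes refl = ≤-trans (w≤6s (1≤k i)) (≤-reflexive (trans (lemma s) (cong (3 * s +_) (sym (at-same i (3 * s))))))
    where
    lemma : ∀ s → 6 * s ≡ 3 * s + 3 * s
    lemma = solve-∀

  save-s : ∀ {i} → 3 ≤ k i → w (k i) + s ≤ 3 * s
  save-s {i} 3≤ki = subst (w (k i) + s ≤_) (lemma s) (+-monoˡ-≤ s (w≤2s 3≤ki))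
    where
    lemma : ∀ s → 2 * s + s ≡ 3 * s
    lemma = solve-∀

  saving : Fin n → ℕ
  saving i = 3 * s ∸ w (k i)

  w+saving : ∀ {i} → 2 ≤ k i → w (k i) + saving i ≡ 3 * s
  w+saving 2≤ki = m+[n∸m]≡n (w≤3s 2≤ki)

  save⁺ : ∀ z {i x} → w (k i) + x ≤ 3 * s → w (k i) + x ≤ halves⁺ z i
  save⁺ z le = ≤-trans le (m≤m+n _ _)

  module _ (separated₁ : ∀ {i j} → i ≢ j → a i ≡ false → a j ≡ false → k i ≡ 1 → k j ≢ 1) where

    others : ∀ {z} → k z ≡ 1 → ∀ i → i ≢ z → 2 ≤ k i
    others {z} kz i i≢z with 2 ≤? k i
    ... | yes 2≤ = 2≤
    ... | no  2≰ = contradiction ki (separated₁ (i≢z ∘ sym) (k≡1⇒¬a kz) (k≡1⇒¬a ki) kz)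
      where
      ki : k i ≡ 1
      ki = ≤-antisym (≤-pred (≰⇒> 2≰)) (1≤k i)

    private-neighbour : (∃ λ z → k z ≡ 1 × (∀ i → i ≢ z → 2 ≤ k i)) ⊎ (∀ i → 2 ≤ k i)
    private-neighbour with decide-fin test
      where
      test : ∀ i → 2 ≤ k i ⊎ k i ≡ 1
      test i with 2 ≤? k i
      ... | yes 2≤ = inj₁ 2≤
      ... | no  2≰ = inj₂ (≤-antisym (≤-pred (≰⇒> 2≰)) (1≤k i))
    ... | inj₁ all = inj₂ all
    ... | inj₂ (z , kz) = inj₁ (z , kz , others kz)

    sum-w≤ : sum (λ i → w (k i)) ≤ n * (3 * s) + 3 * s
    sum-w≤ with private-neighbour
    ... | inj₁ (z , kz , 2≤k) = subst (sum (λ i → w (k i)) ≤_) (sum-halves⁺ z) (sum-mono (w≤halves⁺ z 2≤k))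
    ... | inj₂ 2≤k = ≤-trans (subst (sum (λ i → w (k i)) ≤_) sum-halves (sum-mono (λ i → w≤3s (2≤k i)))) (m≤m+n _ _)

    sum-w-save : ∀ {h x} → w (k h) + x ≤ 3 * s → sum (λ i → w (k i)) + x ≤ n * (3 * s) + 3 * s
    sum-w-save {h} save with private-neighbour
    ... | inj₁ (z , kz , 2≤k) =
      ≤-trans (sum-save₁ {h = h} (w≤halves⁺ z 2≤k) (save⁺ z save)) (≤-reflexive (sum-halves⁺ z))
    ... | inj₂ 2≤k = ≤-trans (≤-trans (sum-save₁ {B = halves} {h = h} (λ i → w≤3s (2≤k i)) save)
      (≤-reflexive sum-halves)) (m≤m+n _ _)

  -- The outcome with a single heavy vertex. However large its degree, it saves at most `3 * s`,
  -- which may be too little, so this shape is singled out.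
  Dominated : (Fin n → Bool) → Fin n → Set
  Dominated o h = o h ≡ true × 3 ≤ k h × (∀ i → o i ≡ true → b h i ≡ true) × (∀ i → o i ≡ true → i ≢ h → k i ≡ 2)

  module _ (separated₂ : ∀ {i j} → i ≢ j → a i ≡ false → a j ≡ false → b i j ≡ true → k i ≡ 2 → k j ≢ 2) where

    heavy-neighbour : ∀ {i j} → i ≢ j → a i ≡ false → a j ≡ false → b i j ≡ true → k i ≡ 2 → 3 ≤ k j
    heavy-neighbour {i} {j} i≢j ai aj bij ki with 3 ≤? k j
    ... | yes 3≤ = 3≤
    ... | no  3≰ = contradiction
      (≤-antisym (≤-pred (≰⇒> 3≰)) (b⇒2≤k (i≢j ∘ sym) (trans (b-sym j i) bij)))
      (separated₂ i≢j ai aj bij ki)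

    -- A set o of vertices closed under adjacency: every vertex of o has k ≥ 3
    -- or is adjacent to such a heavy vertex, so few heavy vertices must have large degrees.
    module _ (z : Fin n) (2≤k : ∀ i → i ≢ z → 2 ≤ k i)
             (o : Fin n → Bool) (o⇒≢z : ∀ {i} → o i ≡ true → i ≢ z) (o⇒¬a : ∀ {i} → o i ≡ true → a i ≡ false)
             (o-closed : ∀ {i j} → o i ≡ true → b i j ≡ true → o j ≡ true) where

      covered : ∀ {i} → o i ≡ true → ∃ λ j → o j ≡ true × 3 ≤ k j × b j i ≡ true
      covered {i} oi with 3 ≤? k i
      ... | yes 3≤ = i , oi , 3≤ , b-refl i
      ... | no  3≰ = j , oj , heavy-neighbour (j≢i ∘ sym) (o⇒¬a oi) (o⇒¬a oj) bij ki , trans (b-sym j i) bij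
        where
        ki : k i ≡ 2
        ki = ≤-antisym (≤-pred (≰⇒> 3≰)) (2≤k i (o⇒≢z oi))
        nb = k≡2⇒b (o⇒¬a oi) ki
        j = proj₁ nb
        j≢i = proj₁ (proj₂ nb)
        bij = proj₂ (proj₂ nb)
        oj = o-closed oi bij

      private
        F : Fin n → ℕ
        F i = w (k i)

        F≤ : ∀ i → F i ≤ halves⁺ z i
        F≤ = w≤halves⁺ z 2≤k

        sav : ∀ {i} → 3 ≤ k i → F i + saving i ≤ halves⁺ z i
        sav 3≤ = save⁺ z (≤-reflexive (w+saving (≤-trans (n≤1+n 2) 3≤)))

        w+sav : ∀ {i} → 3 ≤ k i → F i + saving i ≡ 3 * s
        w+sav 3≤ = w+saving (≤-trans (n≤1+n 2) 3≤)

        pick : (P : Fin n → Set) → (∀ i → Dec (P i)) →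
               (∀ i → o i ≡ true → 3 ≤ k i → P i) ⊎ ∃ λ i → o i ≡ true × 3 ≤ k i × ¬ P i
        pick P P? = decide-fin test
          where
          test : ∀ i → (o i ≡ true → 3 ≤ k i → P i) ⊎ (o i ≡ true × 3 ≤ k i × ¬ P i)
          test i with o i | 3 ≤? k i | P? i
          ... | false | _      | _     = inj₁ λ ()
          ... | true  | no 3≰  | _     = inj₁ (λ _ 3≤ → contradiction 3≤ 3≰)
          ... | true  | yes _  | yes p = inj₁ (λ _ _ → p)
          ... | true  | yes 3≤ | no ¬p = inj₂ (refl , 3≤ , ¬p)

        ⟦⟧-mono : ∀ {c x} → (c ≡ true → 1 ≤ x) → ⟦ c ⟧ ≤ x
        ⟦⟧-mono {true}  f = f refl
        ⟦⟧-mono {false} f = z≤n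

        t⇒1≤ : ∀ {c} → c ≡ true → 1 ≤ ⟦ c ⟧
        t⇒1≤ refl = ≤-refl

      -- The closed neighbourhoods of the heavy vertices cover `o`. With two or three of them the
      -- sizes therefore add up to at least `3 + μ`; for two, the worst split is 3 and `μ`, which
      -- saves `6 * s` less `2 * s + w μ`, hence at least `Y`. Four heavy vertices save `s` each,
      -- which is already `4 * s`.
      heavy-savings : ∀ μ Y → 3 + μ ≤ count o → μ ≤ suc n → Y + w μ ≤ 4 * s →
                      ∃ (Dominated o) ⊎ sum (λ i → w (k i)) + Y ≤ n * (3 * s) + 3 * s
      heavy-savings μ Y μ≤o μ≤n Y≤ with covered (proj₂ (count-witness {b = o} (≤-trans (s≤s z≤n) μ≤o)))
      ... | h₁ , o₁ , k₁ , _ with pick (_≡ h₁) (Fin._≟ h₁)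
      ... | inj₁ only = inj₁ (h₁ , o₁ , k₁ , adj , light)
        where
        adj : ∀ i → o i ≡ true → b h₁ i ≡ true
        adj i oi with covered oi
        ... | j , oj , kj , bji = subst (λ j → b j i ≡ true) (only j oj kj) bji
        light : ∀ i → o i ≡ true → i ≢ h₁ → k i ≡ 2
        light i oi i≢h with 3 ≤? k i
        ... | yes 3≤ = contradiction (only i oi 3≤) i≢h
        ... | no  3≰ = ≤-antisym (≤-pred (≰⇒> 3≰)) (2≤k i (o⇒≢z oi))
      ... | inj₂ (h₂ , o₂ , k₂ , 2≢1) with pick (λ i → i ≡ h₁ ⊎ i ≡ h₂) (λ i → dec⊎ (i Fin.≟ h₁) (i Fin.≟ h₂))
        where
        dec⊎ : ∀ {A B : Set} → Dec A → Dec B → Dec (A ⊎ B)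
        dec⊎ (yes p) _ = yes (inj₁ p)
        dec⊎ (no ¬p) (yes q) = yes (inj₂ q)
        dec⊎ (no ¬p) (no ¬q) = no λ { (inj₁ p) → ¬p p ; (inj₂ q) → ¬q q }
      ... | inj₁ only = inj₂ (linear 0 (+-mono-≤ saved (+-mono-≤ (w-convex μ k₁ k₂ k-sum μ≤n) Y≤)) eq)
        where
        ptw : ∀ i → ⟦ o i ⟧ ≤ ⟦ b h₁ i ⟧ + ⟦ b h₂ i ⟧
        ptw i = ⟦⟧-mono λ oi → case (covered oi)
          where
          case : (∃ λ j → o j ≡ true × 3 ≤ k j × b j i ≡ true) → 1 ≤ ⟦ b h₁ i ⟧ + ⟦ b h₂ i ⟧
          case (j , oj , kj , bji) with only j oj kj
          ... | inj₁ refl = ≤-trans (t⇒1≤ bji) (m≤m+n _ _)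
          ... | inj₂ refl = ≤-trans (t⇒1≤ bji) (m≤n+m _ _)
        k-sum : 3 + μ ≤ k h₁ + k h₂
        k-sum = ≤-trans μ≤o (≤-trans (sum-mono ptw) (≤-trans
          (≤-reflexive (∑-distrib-+ (λ i → ⟦ b h₁ i ⟧) (λ i → ⟦ b h₂ i ⟧)))
          (+-mono-≤ (count≤k h₁) (count≤k h₂))))
        saved : sum F + saving h₁ + saving h₂ ≤ n * (3 * s) + 3 * s
        saved = ≤-trans (sum-save₂ F≤ (2≢1 ∘ sym) (sav k₁) (sav k₂)) (≤-reflexive (sum-halves⁺ z))
        lemma : ∀ f x y u v B Y t c → f + Y + (B + (2 * c + t + 4 * c)) + 0 + (u + x + (v + y)) ≡
                                      B + (f + x + y + (u + v + (Y + t))) + (3 * c + 3 * c)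
        lemma = solve-∀
        eq : sum F + Y + (n * (3 * s) + 3 * s + (2 * s + w μ + 4 * s)) + 0 ≡
             n * (3 * s) + 3 * s + (sum F + saving h₁ + saving h₂ + (F h₁ + F h₂ + (Y + w μ)))
        eq = +-cancelʳ-≡ (3 * s + 3 * s) _ _ (trans
          (cong (sum F + Y + (n * (3 * s) + 3 * s + (2 * s + w μ + 4 * s)) + 0 +_) (sym (cong₂ _+_ (w+sav k₁) (w+sav k₂))))
          (lemma (sum F) (saving h₁) (saving h₂) (F h₁) (F h₂) (n * (3 * s) + 3 * s) Y (w μ) s))
      ... | inj₂ (h₃ , o₃ , k₃ , 3≢) with pick (λ i → i ≡ h₁ ⊎ i ≡ h₂ ⊎ i ≡ h₃) dec₃
        where
        dec₃ : ∀ i → Dec (i ≡ h₁ ⊎ i ≡ h₂ ⊎ i ≡ h₃)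
        dec₃ i with i Fin.≟ h₁ | i Fin.≟ h₂ | i Fin.≟ h₃
        ... | yes p | _ | _ = yes (inj₁ p)
        ... | no _ | yes p | _ = yes (inj₂ (inj₁ p))
        ... | no _ | no _ | yes p = yes (inj₂ (inj₂ p))
        ... | no p | no q | no r = no λ { (inj₁ x) → p x ; (inj₂ (inj₁ x)) → q x ; (inj₂ (inj₂ x)) → r x }
      ... | inj₁ only = inj₂ (linear 0 (+-mono-≤ saved (w-three μ Y k₁ k₂ k₃ k-sum Y≤)) eq)
        where
        ptw : ∀ i → ⟦ o i ⟧ ≤ ⟦ b h₁ i ⟧ + ⟦ b h₂ i ⟧ + ⟦ b h₃ i ⟧
        ptw i = ⟦⟧-mono λ oi → case (covered oi)
          where
          case : (∃ λ j → o j ≡ true × 3 ≤ k j × b j i ≡ true) → 1 ≤ ⟦ b h₁ i ⟧ + ⟦ b h₂ i ⟧ + ⟦ b h₃ i ⟧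
          case (j , oj , kj , bji) with only j oj kj
          ... | inj₁ refl = ≤-trans (≤-trans (t⇒1≤ bji) (m≤m+n _ _)) (m≤m+n _ _)
          ... | inj₂ (inj₁ refl) = ≤-trans (≤-trans (t⇒1≤ bji) (m≤n+m _ ⟦ b h₁ i ⟧)) (m≤m+n _ _)
          ... | inj₂ (inj₂ refl) = ≤-trans (t⇒1≤ bji) (m≤n+m _ _)
        k-sum : 3 + μ ≤ k h₁ + k h₂ + k h₃
        k-sum = ≤-trans μ≤o (≤-trans (sum-mono ptw) (≤-trans
          (≤-reflexive (trans (∑-distrib-+ (λ i → ⟦ b h₁ i ⟧ + ⟦ b h₂ i ⟧) (λ i → ⟦ b h₃ i ⟧))
            (cong (_+ count (b h₃)) (∑-distrib-+ (λ i → ⟦ b h₁ i ⟧) (λ i → ⟦ b h₂ i ⟧)))))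
          (+-mono-≤ (+-mono-≤ (count≤k h₁) (count≤k h₂)) (count≤k h₃))))
        saved : sum F + saving h₁ + saving h₂ + saving h₃ ≤ n * (3 * s) + 3 * s
        saved = ≤-trans
          (sum-save₃ F≤ (2≢1 ∘ sym) (3≢ ∘ inj₁ ∘ sym) (3≢ ∘ inj₂ ∘ sym) (sav k₁) (sav k₂) (sav k₃))
          (≤-reflexive (sum-halves⁺ z))
        lemma : ∀ f x y z u v t B Y c → f + Y + (B + 9 * c) + 0 + (u + x + (v + y) + (t + z)) ≡
                                        B + (f + x + y + z + (u + v + t + Y)) + (3 * c + 3 * c + 3 * c)
        lemma = solve-∀
        eq : sum F + Y + (n * (3 * s) + 3 * s + 9 * s) + 0 ≡
             n * (3 * s) + 3 * s + (sum F + saving h₁ + saving h₂ + saving h₃ + (F h₁ + F h₂ + F h₃ + Y))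
        eq = +-cancelʳ-≡ (3 * s + 3 * s + 3 * s) _ _ (trans
          (cong (sum F + Y + (n * (3 * s) + 3 * s + 9 * s) + 0 +_) (sym (cong₂ _+_ (cong₂ _+_ (w+sav k₁) (w+sav k₂)) (w+sav k₃))))
          (lemma (sum F) (saving h₁) (saving h₂) (saving h₃) (F h₁) (F h₂) (F h₃) (n * (3 * s) + 3 * s) Y s))
      ... | inj₂ (h₄ , o₄ , k₄ , 4≢) = inj₂ (linear 0 (+-mono-≤ saved (≤-trans (m≤m+n Y (w μ)) Y≤)) (lemma (sum F) s Y (n * (3 * s) + 3 * s)))
        where
        saved : sum F + s + s + s + s ≤ n * (3 * s) + 3 * s
        saved = ≤-trans
          (sum-save₄ F≤ (2≢1 ∘ sym) (3≢ ∘ inj₁ ∘ sym) (4≢ ∘ inj₁ ∘ sym) (3≢ ∘ inj₂ ∘ sym)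
            (4≢ ∘ inj₂ ∘ inj₁ ∘ sym) (4≢ ∘ inj₂ ∘ inj₂ ∘ sym)
            (save⁺ z (save-s k₁)) (save⁺ z (save-s k₂)) (save⁺ z (save-s k₃)) (save⁺ z (save-s k₄)))
          (≤-reflexive (sum-halves⁺ z))
        lemma : ∀ f s Y B → f + Y + (B + 4 * s) + 0 ≡ B + (f + s + s + s + s + Y)
        lemma = solve-∀

-- Choosing and counting directions.

fresh₃ : ∀ {n} → 4 ≤ n → (x y z : Fin n) → ∃ λ i → i ≢ x × i ≢ y × i ≢ z
fresh₃ {n} 4≤n x y z with decide-fin test
  where
  test : ∀ i → (1 ≤ at x 1 i + at y 1 i + at z 1 i) ⊎ (i ≢ x × i ≢ y × i ≢ z)
  test i with i Fin.≟ x | i Fin.≟ y | i Fin.≟ z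
  ... | yes refl | _ | _ = inj₁ (≤-trans (≤-trans (≤-reflexive (sym (at-same i 1))) (m≤m+n _ _)) (m≤m+n _ _))
  ... | no _ | yes refl | _ = inj₁ (≤-trans (≤-trans (≤-reflexive (sym (at-same i 1))) (m≤n+m _ (at x 1 i))) (m≤m+n _ _))
  ... | no _ | no _ | yes refl = inj₁ (≤-trans (≤-reflexive (sym (at-same i 1))) (m≤n+m _ _))
  ... | no p | no q | no r = inj₂ (p , q , r)
... | inj₂ found = found
... | inj₁ all = contradiction (≤-trans 4≤n (begin
  n                                          ≡⟨ *-identityʳ n ⟨
  n * 1                                      ≡⟨ sum-const n 1 ⟨
  sum {n} (λ _ → 1)                          ≤⟨ sum-mono all ⟩
  sum (λ i → at x 1 i + at y 1 i + at z 1 i) ≡⟨ sum-+-at (λ i → at x 1 i + at y 1 i) z 1 ⟩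
  sum (λ i → at x 1 i + at y 1 i) + 1        ≡⟨ cong (_+ 1) (sum-+-at (at x 1) y 1) ⟩
  sum (at x 1) + 1 + 1                       ≡⟨ cong (λ v → v + 1 + 1) (sum-at x 1) ⟩
  3                                          ∎)) (λ { (s≤s (s≤s (s≤s ()))) })
  where open ≤-Reasoning

-- Taken with `x` and `y` equal when only one vertex is left out.
avoid : ∀ {n} → Fin n → Fin n → Fin n → Bool
avoid x y i with i Fin.≟ x | i Fin.≟ y
... | no _ | no _ = true
... | _    | _    = false

avoid-intro : ∀ {n} {x y i : Fin n} → i ≢ x → i ≢ y → avoid x y i ≡ true
avoid-intro {x = x} {y} {i} p q with i Fin.≟ x | i Fin.≟ y
... | no _  | no _  = refl
... | yes r | _     = contradiction r p
... | no _  | yes r = contradiction r q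

avoid-elim : ∀ {n} {x y i : Fin n} → avoid x y i ≡ true → i ≢ x × i ≢ y
avoid-elim {x = x} {y} {i} e with i Fin.≟ x | i Fin.≟ y
... | no p | no q = p , q

any-true : ∀ {n} (c : Fin n → Bool) → (∀ i → c i ≡ false) ⊎ ∃ λ i → c i ≡ true
any-true c = decide-fin test
  where
  test : ∀ i → c i ≡ false ⊎ c i ≡ true
  test i with c i
  ... | false = inj₁ refl
  ... | true  = inj₂ refl

count-none : ∀ {n} {c : Fin n → Bool} → (∀ i → c i ≡ false) → count c ≡ 0
count-none {n} {c} none = trans (sum-cong-≗ (λ i → cong ⟦_⟧ (none i))) (trans (sum-const n 0) (*-zeroʳ n))

count-mono : ∀ {n} {c d : Fin n → Bool} → (∀ i → c i ≡ true → d i ≡ true) → count c ≤ count d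
count-mono {c = c} {d} c⇒d = sum-mono ptw
  where
  ptw : ∀ i → ⟦ c i ⟧ ≤ ⟦ d i ⟧
  ptw i with c i | c⇒d i
  ... | false | _ = z≤n
  ... | true  | f rewrite f refl = ≤-refl

-- Bounds on the share for each shape of the graph.

-- X is the amount by which the target average share lies below (n + 2)/2.
record Discount {n s : ℕ} (W : Weight n s) (m X : ℕ) : Set where
  open Weight W
  field
    n≡    : n ≡ 11 + m
    4X≤s  : 4 * X ≤ s
    -- `7 + m` is n - 4 and `6 + m` is n - 5: two heavy vertices covering n - 1 vertices have at
    -- worst sizes 3 and n - 4, and covering n - 2 vertices at worst 3 and n - 5. The second case
    -- serves the further codeword, which has to save `n * X`.
    X≤    : X + w (7 + m) ≤ s
    nX≤   : n * X + w (6 + m) ≤ 4 * s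

module ShareBounds {n s : ℕ} (W : Weight n s) {m X : ℕ} (disc : Discount W m X) (11≤n : 11 ≤ n)
  (a : Fin n → Bool) (b : Fin n → Fin n → Bool)
  (b-refl : ∀ i → b i i ≡ true) (b-sym : ∀ i j → b i j ≡ b j i) where

  open Discount disc
  open WeightProperties W 11≤n
  open Neighbourhood W 11≤n a b b-refl b-sym

  private
    N : ℕ
    N = n * (3 * s)

    f : Fin n → ℕ
    f i = w (k i)

    4≤n : 4 ≤ n
    4≤n = ≤-trans (m≤m+n 4 7) 11≤n

    X≤s : X ≤ s
    X≤s = ≤-trans (m≤n*m X 4) 4X≤s

    k≡2 : ∀ {i} → 2 ≤ k i → ¬ (3 ≤ k i) → k i ≡ 2
    k≡2 2≤ 3≰ = ≤-antisym (≤-pred (≰⇒> 3≰)) 2≤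

  IsStar : Fin n → Fin n → Set
  IsStar h z = h ≢ z × (∀ i → a i ≡ false) × (∀ i → i ≢ z → b h i ≡ true) × b h z ≡ false ×
               (∀ i j → i ≢ j → i ≢ h → j ≢ h → b i j ≡ false)

  w+complement : ∀ {x} → 2 ≤ x → w x + (3 * s ∸ w x) ≡ 3 * s
  w+complement 2≤x = m+[n∸m]≡n (w≤3s 2≤x)

  module _ (separated₁ : ∀ {i j} → i ≢ j → a i ≡ false → a j ≡ false → k i ≡ 1 → k j ≢ 1)
           (separated₂ : ∀ {i j} → i ≢ j → a i ≡ false → a j ≡ false → b i j ≡ true → k i ≡ 2 → k j ≢ 2) where

    private
      all-but-one : ∃ λ z → ∀ i → i ≢ z → 2 ≤ k i
      all-but-one with private-neighbour separated₁
      ... | inj₁ (z , _ , 2≤k) = z , 2≤k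
      ... | inj₂ 2≤k = proj₁ (count-witness {n} {λ _ → true} pos) , λ i _ → 2≤k i
        where
        pos : 1 ≤ count {n} (λ _ → true)
        pos = subst (1 ≤_) (sym (trans (sum-const n 1) (*-identityʳ n))) (≤-trans (s≤s z≤n) 11≤n)

    -- The codeword neighbour halves the charge that `c` gives to itself, which pays for a private
    -- neighbour, so a saving of `s` anywhere suffices. Were all vertices light, some `i` other than
    -- `j` and the private neighbour would either be a second codeword, making `I(c)` of size 3, or
    -- have a partner that location forces to be heavy.
    share-nonisolated : ∀ {j} → a j ≡ true → share + X ≤ N + 6 * s
    share-nonisolated {j} aj with decide-fin test
      where
      test : ∀ i → (¬ 3 ≤ k i) ⊎ (3 ≤ k i)
      test i with 3 ≤? k i
      ... | yes p = inj₂ p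
      ... | no ¬p = inj₁ ¬p
    ... | inj₂ (h , 3≤kh) = linear 0
      (+-mono-≤ (+-mono-≤ (self≤3s aj) (sum-w-save separated₁ {h} (save-s 3≤kh))) X≤s)
      (lemma (w (suc (count a))) (sum f) s X N)
      where
      lemma : ∀ c f s X N → c + f + X + (3 * s + (N + 3 * s) + s) + 0 ≡ N + 6 * s + (c + (f + s) + X)
      lemma = solve-∀
    ... | inj₁ light with all-but-one
    ...   | z , 2≤k with fresh₃ 4≤n j z z
    ...     | i , i≢j , i≢z , _ with a i in ai
    ...       | true = linear 0
      (+-mono-≤ (+-mono-≤ (w≤2s (s≤s (count-≥2 {b = a} i≢j ai aj))) (sum-w≤ separated₁)) X≤s)
      (lemma (w (suc (count a))) (sum f) s X N)
      where
      lemma : ∀ c f s X N → c + f + X + (2 * s + (N + 3 * s) + s) + 0 ≡ N + 6 * s + (c + f + X)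
      lemma = solve-∀
    ...       | false = contradiction heavy (light l)
      where
      ki : k i ≡ 2
      ki = k≡2 (2≤k i i≢z) (light i)
      nb = k≡2⇒b ai ki
      l = proj₁ nb
      l≢i = proj₁ (proj₂ nb)
      bil = proj₂ (proj₂ nb)
      heavy : 3 ≤ k l
      heavy with a l in al
      ... | true  = subst (λ c → 3 ≤ ⟦ c ⟧ + count (b l)) al (ab⇒3≤k l≢i al (trans (b-sym l i) bil))
      ... | false = subst (λ c → 3 ≤ ⟦ c ⟧ + count (b l)) al (heavy-neighbour separated₂ (l≢i ∘ sym) ai al bil ki)

    share-or-star : (∃ λ h → ∃ (IsStar h)) ⊎ share + X ≤ N + 6 * s
    share-or-star with any-true a
    ... | inj₂ (j , aj) = inj₂ (share-nonisolated aj)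
    ... | inj₁ iso with private-neighbour separated₁
    ...   | inj₂ 2≤k = inj₂ (linear 0 (+-mono-≤ (+-mono-≤ self≤6s saved) X≤s) (lemma (w (suc (count a))) (sum f) s X N))
      where
      i = proj₁ (count-witness {n} {λ _ → true} (subst (1 ≤_) (sym (trans (sum-const n 1) (*-identityʳ n))) (≤-trans (s≤s z≤n) 11≤n)))
      heavy : ∃ λ h → 3 ≤ k h
      heavy with 3 ≤? k i
      ... | yes 3≤ = i , 3≤
      ... | no 3≰ with k≡2⇒b (iso i) (k≡2 (2≤k i) 3≰)
      ...   | l , l≢i , bil = l , heavy-neighbour separated₂ (l≢i ∘ sym) (iso i) (iso l) bil (k≡2 (2≤k i) 3≰)
      saved : sum f + s ≤ N
      saved = ≤-trans (sum-save₁ {B = halves} {h = proj₁ heavy} (λ i → w≤3s (2≤k i)) (save-s (proj₂ heavy))) (≤-reflexive sum-halves)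
      lemma : ∀ c f s X N → c + f + X + (6 * s + N + s) + 0 ≡ N + 6 * s + (c + (f + s) + X)
      lemma = solve-∀
    -- Both `c` and `z` take a full charge from themselves for `c`, so the other n - 1 vertices must
    -- save `3 * s + X`.
    ...   | inj₁ (z , kz , 2≤k) = conclude (heavy-savings separated₂ z 2≤k (avoid z z) (proj₁ ∘ avoid-elim) (λ {i} _ → iso i)
                                  closed (7 + m) (3 * s + X) enough μ≤ fits)
      where
      closed : ∀ {i j} → avoid z z i ≡ true → b i j ≡ true → avoid z z j ≡ true
      closed {i} {j} oi bij = avoid-intro j≢z j≢z
        where
        j≢z : j ≢ z
        j≢z refl = true≢false (trans (b-sym j i) bij) (k≡1⇒¬b kz (proj₁ (avoid-elim oi) ∘ sym))
      μ≤ : 7 + m ≤ suc n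
      μ≤ = subst (λ v → 7 + m ≤ suc v) (sym n≡) (m≤n+m (7 + m) 5)
      enough : 3 + (7 + m) ≤ count (avoid z z)
      enough = +-cancelʳ-≤ 1 (10 + m) (count (avoid z z))
        (≤-trans (≤-reflexive (trans (+-comm (10 + m) 1) (sym n≡))) (count-all-but₁ z (λ i i≢z → avoid-intro i≢z i≢z)))
      fits : 3 * s + X + w (7 + m) ≤ 4 * s
      fits = linear 0 X≤ (lemma s X (w (7 + m)))
        where
        lemma : ∀ s X v → 3 * s + X + v + s + 0 ≡ 4 * s + (X + v)
        lemma = solve-∀
      conclude : ∃ (Dominated (avoid z z)) ⊎ sum f + (3 * s + X) ≤ N + 3 * s →
                 (∃ λ h → ∃ (IsStar h)) ⊎ share + X ≤ N + 6 * s
      conclude (inj₂ saved) = inj₂ (linear 0 (+-mono-≤ self≤6s saved) (lemma (w (suc (count a))) (sum f) s X N))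
        where
        lemma : ∀ c f s X N → c + f + X + (6 * s + (N + 3 * s)) + 0 ≡ N + 6 * s + (c + (f + (3 * s + X)))
        lemma = solve-∀
      conclude (inj₁ (h , oh , 3≤kh , adj , light)) = inj₁ (h , z , h≢z , iso , leaf , bhz , rest)
        where
        h≢z : h ≢ z
        h≢z = proj₁ (avoid-elim oh)
        bhz : b h z ≡ false
        bhz = trans (b-sym h z) (k≡1⇒¬b kz (h≢z ∘ sym))
        leaf : ∀ i → i ≢ z → b h i ≡ true
        leaf i i≢z = adj i (avoid-intro i≢z i≢z)
        rest : ∀ i j → i ≢ j → i ≢ h → j ≢ h → b i j ≡ false
        rest i j i≢j i≢h j≢h with i Fin.≟ z
        ... | yes refl = k≡1⇒¬b kz i≢j
        ... | no  i≢z  = ≢true⇒≡false λ bij → contradiction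
          (subst (3 ≤_) (light i (avoid-intro i≢z i≢z) i≢h) (bb⇒3≤k i≢h i≢j (j≢h ∘ sym) (trans (b-sym i h) (leaf i i≢z)) bij))
          λ { (s≤s (s≤s ())) }

    -- The private neighbour `z` and the isolated vertex `y` leave a closed set of n - 2 vertices. A
    -- vertex dominating that set would see at least n - 2 codewords, which the last hypothesis
    -- excludes.
    share-pendant : ∀ {y z} → k z ≡ 1 → a y ≡ true → (∀ i → i ≢ y → a i ≡ false) → (∀ i → i ≢ y → b y i ≡ false) →
                    (∀ i → a i ≡ false → ¬ 9 + m ≤ k i) → share + n * X ≤ N + 6 * s
    share-pendant {y} {z} kz ay only row nohub =
      conclude (heavy-savings separated₂ z (others separated₁ kz) (avoid y z) (proj₂ ∘ avoid-elim) (λ {i} oi → only i (proj₁ (avoid-elim oi)))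
                  closed (6 + m) (n * X) enough μ≤ nX≤)
      where
      closed : ∀ {i j} → avoid y z i ≡ true → b i j ≡ true → avoid y z j ≡ true
      closed {i} {j} oi bij = avoid-intro j≢y j≢z
        where
        j≢z : j ≢ z
        j≢z refl = true≢false (trans (b-sym j i) bij) (k≡1⇒¬b kz (proj₂ (avoid-elim oi) ∘ sym))
        j≢y : j ≢ y
        j≢y refl = true≢false (trans (b-sym j i) bij) (row i (proj₁ (avoid-elim oi)))
      μ≤ : 6 + m ≤ suc n
      μ≤ = subst (λ v → 6 + m ≤ suc v) (sym n≡) (m≤n+m (6 + m) 6)
      enough : 3 + (6 + m) ≤ count (avoid y z)
      enough = +-cancelʳ-≤ 2 (9 + m) (count (avoid y z))
        (≤-trans (≤-reflexive (trans (+-comm (9 + m) 2) (sym n≡))) (count-all-but₂ y z (λ i i≢y i≢z → avoid-intro i≢y i≢z)))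
      conclude : ∃ (Dominated (avoid y z)) ⊎ sum f + n * X ≤ N + 3 * s → share + n * X ≤ N + 6 * s
      conclude (inj₂ saved) = linear 0 (+-mono-≤ (self≤3s ay) saved) (lemma (w (suc (count a))) (sum f) s (n * X) N)
        where
        lemma : ∀ c f s X N → c + f + X + (3 * s + (N + 3 * s)) + 0 ≡ N + 6 * s + (c + (f + X))
        lemma = solve-∀
      conclude (inj₁ (h , oh , _ , adj , _)) =
        contradiction (≤-trans enough (≤-trans (count-mono adj) (count≤k h))) (nohub h (only h (proj₁ (avoid-elim oh))))

    share-hub-nonisolated : ∀ {h j} → a j ≡ true → k h ≡ 9 + m → share + 3 * s ≤ N + 6 * s + w (9 + m)
    share-hub-nonisolated {h} {j} aj kh = linear 0
      (+-mono-≤ (+-mono-≤ (self≤3s aj) (sum-w-save separated₁ {h} (≤-reflexive (w+complement 2≤kh)))) (≤-reflexive (sym wh)))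
      (lemma (w (suc (count a))) (sum f) s (3 * s ∸ w (k h)) (w (9 + m)) N)
      where
      2≤kh : 2 ≤ k h
      2≤kh = subst (2 ≤_) (sym kh) (s≤s (s≤s z≤n))
      wh : w (9 + m) + (3 * s ∸ w (k h)) ≡ 3 * s
      wh = trans (cong (λ v → w v + (3 * s ∸ w (k h))) (sym kh)) (w+complement 2≤kh)
      lemma : ∀ c f s x q N → c + f + 3 * s + (3 * s + (N + 3 * s) + (q + x)) + 0 ≡ N + 6 * s + q + (c + (f + x) + 3 * s)
      lemma = solve-∀

    -- In the hard case `c` is isolated and has a private neighbour `z`. Seeing only n - 2
    -- codewords, `h` misses some vertex besides `z`; that vertex or its partner is a second heavy
    -- vertex, which saves another `s`.
    share-hub : ∀ {h} → k h ≡ 9 + m → share + s ≤ N + 6 * s + w (9 + m)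
    share-hub {h} kh with any-true a
    ... | inj₂ (j , aj) = ≤-trans (+-monoʳ-≤ share (m≤n*m s 3)) (share-hub-nonisolated aj kh)
    ... | inj₁ iso with private-neighbour separated₁
    ...   | inj₂ 2≤k = linear (2 * s)
      (+-mono-≤ (+-mono-≤ self≤6s (≤-trans (sum-save₁ {B = halves} {h = h} (λ i → w≤3s (2≤k i)) (≤-reflexive (w+complement (2≤k h)))) (≤-reflexive sum-halves))) (≤-reflexive (sym wh)))
      (lemma (w (suc (count a))) (sum f) s (3 * s ∸ w (k h)) (w (9 + m)) N)
      where
      wh : w (9 + m) + (3 * s ∸ w (k h)) ≡ 3 * s
      wh = trans (cong (λ v → w v + (3 * s ∸ w (k h))) (sym kh)) (w+complement (2≤k h))
      lemma : ∀ c f s x q N → c + f + s + (6 * s + N + (q + x)) + 2 * s ≡ N + 6 * s + q + (c + (f + x) + 3 * s)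
      lemma = solve-∀
    ...   | inj₁ (z , kz , 2≤k) = linear 0
      (+-mono-≤ (+-mono-≤ self≤6s saved) (≤-reflexive (sym wh)))
      (lemma (w (suc (count a))) (sum f) s (3 * s ∸ w (k h)) (w (9 + m)) N)
      where
      2≤kh : 2 ≤ k h
      2≤kh = subst (2 ≤_) (sym kh) (s≤s (s≤s z≤n))
      wh : w (9 + m) + (3 * s ∸ w (k h)) ≡ 3 * s
      wh = trans (cong (λ v → w v + (3 * s ∸ w (k h))) (sym kh)) (w+complement 2≤kh)
      lemma : ∀ c f s x q N → c + f + s + (6 * s + (N + 3 * s) + (q + x)) + 0 ≡ N + 6 * s + q + (c + (f + x + s) + 3 * s)
      lemma = solve-∀
      missed : ∃ λ i → i ≢ z × b h i ≡ false
      missed with decide-fin test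
        where
        test : ∀ i → (i ≢ z → b h i ≡ true) ⊎ (i ≢ z × b h i ≡ false)
        test i with i Fin.≟ z | b h i
        ... | yes p | _     = inj₁ (contradiction p)
        ... | no _  | true  = inj₁ (λ _ → refl)
        ... | no p  | false = inj₂ (p , refl)
      ... | inj₂ found = found
      ... | inj₁ all = contradiction
        (≤-trans (≤-reflexive (sym n≡)) (≤-trans (count-all-but₁ z all) (+-monoˡ-≤ 1 (≤-trans (count≤k h) (≤-reflexive kh)))))
        (subst (λ v → ¬ 11 + m ≤ v) (+-comm 1 (9 + m)) 1+n≰n)
      other : ∃ λ i → h ≢ i × 3 ≤ k i
      other with missed
      ... | i , i≢z , bhi with 3 ≤? k i
      ...   | yes 3≤ = i , (λ { refl → true≢false (b-refl h) bhi }) , 3≤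
      ...   | no  3≰ with k≡2⇒b (iso i) (k≡2 (2≤k i i≢z) 3≰)
      ...     | l , l≢i , bil = l , (λ { refl → true≢false (trans (b-sym h i) bil) bhi }) ,
                                heavy-neighbour separated₂ (l≢i ∘ sym) (iso i) (iso l) bil (k≡2 (2≤k i i≢z) 3≰)
      saved : sum f + (3 * s ∸ w (k h)) + s ≤ N + 3 * s
      saved = ≤-trans (sum-save₂ {h = h} {proj₁ other} (w≤halves⁺ z 2≤k) (proj₁ (proj₂ other))
        (save⁺ z (≤-reflexive (w+complement 2≤kh))) (save⁺ z (save-s (proj₂ (proj₂ other)))))
        (≤-reflexive (sum-halves⁺ z))

    -- Each vertex receives its allowance plus `s`, against `s` for each adjacency to `x` or `y` and
    -- `g` for being a hub: a vertex adjacent to both is a hub or has weight at most `2 * s`, and a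
    -- hub has weight at most `2 * s` less `g`. There are at least 2(n - 2) adjacencies, so n - 4
    -- units `s` are saved. Three of them cover the full charge of `c` to itself, and `n * X`, at
    -- most n/4 units, fits into the remaining n - 7.
    share-hubs : ∀ {g} (hub : Fin n → Bool) → g + w (9 + m) ≡ 2 * s →
                 (∀ {i} → hub i ≡ true → a i ≡ false × 9 + m ≤ k i) →
                 ∀ {x y} → x ≢ y → hub x ≡ true → hub y ≡ true →
                 share + n * X + count hub * g ≤ N + 6 * s
    share-hubs {g} hub g+q hub⇒ {x} {y} x≢y hx hy = *-cancelˡ-≤ 4 (linear (5 * s + 3 * (m * s))
        (+-mono-≤ (*-monoʳ-≤ 4 (+-mono-≤ (+-mono-≤ self≤6s total) (+-mono-≤ (*-monoˡ-≤ s (many hx)) (*-monoˡ-≤ s (many hy))))) (*-monoʳ-≤ n 4X≤s))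
        eq)
      where
      z = proj₁ all-but-one
      many : ∀ {i} → hub i ≡ true → 9 + m ≤ count (b i)
      many hi = subst (9 + m ≤_) (¬a⇒k≡count (proj₁ (hub⇒ hi))) (proj₂ (hub⇒ hi))
      ptw : ∀ i → f i + ⟦ hub i ⟧ * g + (⟦ b x i ⟧ * s + ⟦ b y i ⟧ * s) ≤ halves⁺ z i + s
      ptw i with hub i in hi
      ... | true = ≤-trans (+-mono-≤ (+-monoˡ-≤ (1 * g) (w-antitone (proj₂ (hub⇒ hi)))) (+-mono-≤ (*-monoˡ-≤ s ⟦ b x i ⟧≤1) (*-monoˡ-≤ s ⟦ b y i ⟧≤1)))
                     (≤-trans (≤-reflexive (trans (lemma₁ (w (9 + m)) g s) (trans (cong (_+ 2 * s) g+q) (lemma₂ s)))) (+-monoˡ-≤ s (m≤m+n (3 * s) _)))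
        where
        lemma₁ : ∀ q g s → q + 1 * g + (1 * s + 1 * s) ≡ g + q + 2 * s
        lemma₁ = solve-∀
        lemma₂ : ∀ s → 2 * s + 2 * s ≡ 3 * s + s
        lemma₂ = solve-∀
      ... | false with b x i in bx | b y i in by
      ...   | true | true = ≤-trans (+-monoˡ-≤ (1 * s + 1 * s) (+-monoˡ-≤ 0 (w≤2s 3≤ki)))
                              (≤-trans (≤-reflexive (lemma s)) (+-monoˡ-≤ s (m≤m+n (3 * s) _)))
        where
        lemma : ∀ s → 2 * s + 0 + (1 * s + 1 * s) ≡ 3 * s + s
        lemma = solve-∀
        3≤ki : 3 ≤ k i
        3≤ki = bb⇒3≤k (λ { refl → true≢false hx hi }) (λ { refl → true≢false hy hi }) x≢y (trans (b-sym i x) bx) (trans (b-sym i y) by)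
      ...   | true | false = ≤-trans (≤-reflexive (lemma (f i) s)) (+-monoˡ-≤ s (w≤halves⁺ z (proj₂ all-but-one) i))
        where
        lemma : ∀ f s → f + 0 + (1 * s + 0) ≡ f + s
        lemma = solve-∀
      ...   | false | true = ≤-trans (≤-reflexive (lemma (f i) s)) (+-monoˡ-≤ s (w≤halves⁺ z (proj₂ all-but-one) i))
        where
        lemma : ∀ f s → f + 0 + (0 + 1 * s) ≡ f + s
        lemma = solve-∀
      ...   | false | false = ≤-trans (≤-trans (≤-reflexive (lemma (f i))) (w≤halves⁺ z (proj₂ all-but-one) i)) (m≤m+n _ s)
        where
        lemma : ∀ f → f + 0 + (0 + 0) ≡ f
        lemma = solve-∀
      total : sum f + count hub * g + (count (b x) * s + count (b y) * s) ≤ N + 3 * s + n * s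
      total = subst (_≤ N + 3 * s + n * s) lhs (subst (sum (λ i → f i + ⟦ hub i ⟧ * g + (⟦ b x i ⟧ * s + ⟦ b y i ⟧ * s)) ≤_) rhs (sum-mono ptw))
        where
        factor : ∀ (c : Fin n → Bool) t → sum (λ i → ⟦ c i ⟧ * t) ≡ count c * t
        factor c t = sym (*-distribʳ-sum t (λ i → ⟦ c i ⟧))
        lhs : sum (λ i → f i + ⟦ hub i ⟧ * g + (⟦ b x i ⟧ * s + ⟦ b y i ⟧ * s)) ≡ sum f + count hub * g + (count (b x) * s + count (b y) * s)
        lhs = trans (∑-distrib-+ (λ i → f i + ⟦ hub i ⟧ * g) (λ i → ⟦ b x i ⟧ * s + ⟦ b y i ⟧ * s))
          (cong₂ _+_ (trans (∑-distrib-+ f (λ i → ⟦ hub i ⟧ * g)) (cong (sum f +_) (factor hub g)))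
            (trans (∑-distrib-+ (λ i → ⟦ b x i ⟧ * s) (λ i → ⟦ b y i ⟧ * s)) (cong₂ _+_ (factor (b x) s) (factor (b y) s))))
        rhs : sum (λ i → halves⁺ z i + s) ≡ N + 3 * s + n * s
        rhs = trans (∑-distrib-+ (halves⁺ z) (λ _ → s)) (cong₂ _+_ (sum-halves⁺ z) (sum-const n s))
      core : ∀ c f h cx cy s nX m N →
             4 * (c + f + nX + h) + (4 * (6 * s + (N + 3 * s + (11 + m) * s) + (cx + cy)) + (11 + m) * s) + (5 * s + 3 * (m * s)) ≡
             4 * (N + 6 * s) + (4 * (c + (f + h + (cx + cy)) + ((9 + m) * s + (9 + m) * s)) + 4 * nX)
      core = solve-∀
      eq : 4 * (share + n * X + count hub * g) + (4 * (6 * s + (N + 3 * s + n * s) + (count (b x) * s + count (b y) * s)) + n * s) + (5 * s + 3 * (m * s)) ≡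
           4 * (N + 6 * s) + (4 * (w (suc (count a)) + (sum f + count hub * g + (count (b x) * s + count (b y) * s)) + ((9 + m) * s + (9 + m) * s)) + n * (4 * X))
      eq = trans (cong (λ v → 4 * (share + n * X + count hub * g) + (4 * (6 * s + (N + 3 * s + v * s) + (count (b x) * s + count (b y) * s)) + v * s) + (5 * s + 3 * (m * s))) n≡)
        (trans (core (w (suc (count a))) (sum f) (count hub * g) (count (b x) * s) (count (b y) * s) s (n * X) m N)
          (cong (λ v → 4 * (N + 6 * s) + (4 * (w (suc (count a)) + (sum f + count hub * g + (count (b x) * s + count (b y) * s)) + ((9 + m) * s + (9 + m) * s)) + v)) (lemma n X)))
        where
        lemma : ∀ n X → 4 * (n * X) ≡ n * (4 * X)
        lemma = solve-∀

  -- The members of a word c ⊕ h all of whose neighbours but c ⊕ h ⊕ z are codewords.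
  module Member {h z : Fin n} (h≢z : h ≢ z) (leaf : ∀ i → i ≢ z → b h i ≡ true) (kh : k h ≡ 10 + m) where

    private
      p : ℕ
      p = w (10 + m)

      C : ℕ
      C = 3 * s ∸ w (k h)

      2≤k : ∀ i → i ≢ z → 2 ≤ k i
      2≤k i i≢z with i Fin.≟ h
      ... | yes refl = subst (2 ≤_) (sym kh) (s≤s (s≤s z≤n))
      ... | no  i≢h  = b⇒2≤k i≢h (trans (b-sym i h) (leaf i i≢z))

      C-ok : w (k h) + C ≤ 3 * s
      C-ok = ≤-reflexive (w+complement (2≤k h h≢z))

      p+C : 3 * s ≤ p + C
      p+C = ≤-reflexive (sym (trans (cong (λ v → w v + C) (sym kh)) (w+complement (2≤k h h≢z))))

      leaf-b : ∀ {i} → i ≢ z → b i h ≡ true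
      leaf-b {i} i≢z = trans (b-sym i h) (leaf i i≢z)

      f≤ : ∀ i → f i ≤ halves⁺ z i
      f≤ = w≤halves⁺ z 2≤k

      2≤k′ : 2 ≤ k z → ∀ i → f i ≤ halves i
      2≤k′ 2≤kz i with i Fin.≟ z
      ... | yes refl = w≤3s 2≤kz
      ... | no  i≢z  = w≤3s (2≤k i i≢z)

    -- The excess of a star: `c` and `z` cost a full charge each, `h` only `p` instead of half a
    -- charge. Each variant below deducts what one additional codeword saves.
    member-share : share ≤ N + 6 * s + p
    member-share = linear 0
      (+-mono-≤ (+-mono-≤ self≤6s (≤-trans (sum-save₁ {h = h} f≤ (save⁺ z C-ok)) (≤-reflexive (sum-halves⁺ z)))) p+C)
      (lemma (w (suc (count a))) (sum f) s C p N)
      where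
      lemma : ∀ c f s x p N → c + f + (6 * s + (N + 3 * s) + (p + x)) + 0 ≡ N + 6 * s + p + (c + (f + x) + 3 * s)
      lemma = solve-∀

    -- A codeword in direction `z` halves both full charges, that of `c` and that of `z`, for
    -- `3 * s` each.
    member-code : a z ≡ true → share + 6 * s ≤ N + 6 * s + p
    member-code az = linear 0
      (+-mono-≤ (+-mono-≤ (self≤3s az) (≤-trans (sum-save₁ {B = halves} {h = h} (2≤k′ (a⇒2≤k az)) C-ok) (≤-reflexive sum-halves))) p+C)
      (lemma (w (suc (count a))) (sum f) s C p N)
      where
      lemma : ∀ c f s x p N → c + f + 6 * s + (3 * s + N + (p + x)) + 0 ≡ N + 6 * s + p + (c + (f + x) + 3 * s)
      lemma = solve-∀

    member-leaf : ∀ {j} → j ≢ h → j ≢ z → a j ≡ true → share + 4 * s ≤ N + 6 * s + p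
    member-leaf {j} j≢h j≢z aj = linear 0
      (+-mono-≤ (+-mono-≤ (self≤3s aj) (≤-trans (sum-save₂ {h = h} {j} f≤ (j≢h ∘ sym) (save⁺ z C-ok)
        (save⁺ z (save-s (ab⇒3≤k j≢h aj (leaf-b j≢z))))) (≤-reflexive (sum-halves⁺ z)))) p+C)
      (lemma (w (suc (count a))) (sum f) s C p N)
      where
      lemma : ∀ c f s x p N → c + f + 4 * s + (3 * s + (N + 3 * s) + (p + x)) + 0 ≡ N + 6 * s + p + (c + (f + x + s) + 3 * s)
      lemma = solve-∀

    -- `z` is no longer private, which saves `3 * s`, and the leaf `j` sees a third codeword, which
    -- saves `s`.
    member-end : ∀ {j} → j ≢ h → j ≢ z → b z j ≡ true → share + 4 * s ≤ N + 6 * s + p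
    member-end {j} j≢h j≢z bzj = linear 0
      (+-mono-≤ (+-mono-≤ self≤6s (≤-trans (sum-save₂ {B = halves} {h = h} {j} (2≤k′ (b⇒2≤k (j≢z ∘ sym) bzj)) (j≢h ∘ sym) C-ok
        (save-s (bb⇒3≤k j≢h j≢z h≢z (leaf-b j≢z) (trans (b-sym j z) bzj)))) (≤-reflexive sum-halves))) p+C)
      (lemma (w (suc (count a))) (sum f) s C p N)
      where
      lemma : ∀ c f s x p N → c + f + 4 * s + (6 * s + N + (p + x)) + 0 ≡ N + 6 * s + p + (c + (f + x + s) + 3 * s)
      lemma = solve-∀

    member-pair : ∀ {i j} → i ≢ j → i ≢ h → i ≢ z → j ≢ h → j ≢ z → b i j ≡ true → share + 2 * s ≤ N + 6 * s + p
    member-pair {i} {j} i≢j i≢h i≢z j≢h j≢z bij = linear 0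
      (+-mono-≤ (+-mono-≤ self≤6s (≤-trans (sum-save₃ {h = h} {i} {j} f≤ (i≢h ∘ sym) (j≢h ∘ sym) i≢j (save⁺ z C-ok)
        (save⁺ z (save-s (bb⇒3≤k i≢h i≢j (j≢h ∘ sym) (leaf-b i≢z) bij)))
        (save⁺ z (save-s (bb⇒3≤k j≢h (i≢j ∘ sym) (i≢h ∘ sym) (leaf-b j≢z) (trans (b-sym j i) bij)))))
        (≤-reflexive (sum-halves⁺ z)))) p+C)
      (lemma (w (suc (count a))) (sum f) s C p N)
      where
      lemma : ∀ c f s x p N → c + f + 2 * s + (6 * s + (N + 3 * s) + (p + x)) + 0 ≡ N + 6 * s + p + (c + (f + x + s + s) + 3 * s)
      lemma = solve-∀

count-only₁ : ∀ {n} {c : Fin n → Bool} x → (∀ i → i ≢ x → c i ≡ false) → count c ≤ 1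
count-only₁ {n} {c} x none = subst (count c ≤_) (sum-at x 1) (sum-mono ptw)
  where
  ptw : ∀ j → ⟦ c j ⟧ ≤ at x 1 j
  ptw j with j Fin.≟ x
  ... | yes refl = subst (⟦ c j ⟧ ≤_) (sym (at-same j 1)) ⟦ c j ⟧≤1
  ... | no j≢x rewrite none j j≢x = z≤n

count-only₂ : ∀ {n} {c : Fin n → Bool} x y → (∀ i → i ≢ x → i ≢ y → c i ≡ false) → count c ≤ 2
count-only₂ {n} {c} x y none =
  subst (count c ≤_) (trans (sum-+-at (at x 1) y 1) (cong (_+ 1) (sum-at x 1))) (sum-mono ptw)
  where
  ptw : ∀ j → ⟦ c j ⟧ ≤ at x 1 j + at y 1 j
  ptw j with j Fin.≟ x | j Fin.≟ y
  ... | yes refl | _ = ≤-trans (subst (⟦ c j ⟧ ≤_) (sym (at-same j 1)) ⟦ c j ⟧≤1) (m≤m+n _ _)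
  ... | no _ | yes refl = ≤-trans (subst (⟦ c j ⟧ ≤_) (sym (at-same j 1)) ⟦ c j ⟧≤1) (m≤n+m _ _)
  ... | no j≢x | no j≢y rewrite none j j≢x j≢y = z≤n

module _ {n : ℕ} (u : Word n) where

  ⊕-return : ∀ a b → u ⊕ a ⊕ b ⊕ a ≡ u ⊕ b
  ⊕-return a b = trans (⊕-comm (u ⊕ a) b a) (cong (_⊕ b) (⊕-involutive u a))

  ⊕-return₂ : ∀ a b → u ⊕ a ⊕ b ⊕ a ⊕ b ≡ u
  ⊕-return₂ a b = trans (cong (_⊕ b) (⊕-return a b)) (⊕-involutive u b)

  ⊕-rotate : ∀ a b i → u ⊕ a ⊕ b ⊕ i ≡ u ⊕ i ⊕ a ⊕ b
  ⊕-rotate a b i = trans (⊕-comm (u ⊕ a) b i) (cong (_⊕ b) (⊕-comm u a i))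

-- Stars, centres, hubs and loaded codewords.

I-size : ∀ {n} → (Word n → Bool) → Word n → ℕ
I-size χ x = ⟦ χ x ⟧ + count (λ i → χ (x ⊕ i))

module LocatingCode {n s : ℕ} (W : Weight n s) {m X : ℕ} (disc : Discount W m X) (11≤n : 11 ≤ n) (χ : Word n → Bool) where

  open Discount disc public
  open WeightProperties W 11≤n public

  ∣I_∣ : Word n → ℕ
  ∣I x ∣ = I-size χ x

  share : Word n → ℕ
  share c = w ∣I c ∣ + sum (λ i → w ∣I c ⊕ i ∣)

  bound : ℕ
  bound = n * (3 * s) + 6 * s

  p q : ℕ
  p = w (10 + m)
  q = w (9 + m)

  -- Seen from the centre `u`, so that all codewords around `u` can be compared. Only the absent
  -- adjacencies are recorded; those through `u` belong to `Centre`.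
  Star : Word n → Fin n → Set
  Star u i = (∀ j → j ≢ i → χ (u ⊕ i ⊕ j) ≡ false) ×
             (∀ j l → j ≢ l → j ≢ i → l ≢ i → χ (u ⊕ i ⊕ j ⊕ l) ≡ false)

  Centre : Word n → Fin n → Set
  Centre u z = χ u ≡ false × χ (u ⊕ z) ≡ false × (∀ j → j ≢ z → χ (u ⊕ j) ≡ true)

  -- The configuration in which I(u) makes up for the excess of its stars only
  -- together with the further codeword u ⊕ a ⊕ b.
  Tight : Word n → Fin n → Fin n → Set
  Tight u a b = a ≢ b × Centre u b × χ (u ⊕ a ⊕ b) ≡ true × (∀ i → i ≢ a → i ≢ b → Star u i)

  -- The threshold `9 + m` is n - 2, one less than a centre has, because `share-pendant` needs the
  -- absence of such neighbours.
  Hub : Word n → Set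
  Hub u = χ u ≡ false × 9 + m ≤ ∣I u ∣

  ∣I∣-hub : ∀ {u} → χ u ≡ false → ∣I u ∣ ≡ count (λ i → χ (u ⊕ i))
  ∣I∣-hub χu rewrite χu = refl

  abstract
    private
      star? : ∀ u i → Dec (Star u i)
      star? u i = Fin.all? (λ j → ¬? (j Fin.≟ i) →-dec (χ (u ⊕ i ⊕ j) Bool.≟ false)) ×-dec
        Fin.all? (λ j → Fin.all? (λ l → ¬? (j Fin.≟ l) →-dec (¬? (j Fin.≟ i) →-dec (¬? (l Fin.≟ i) →-dec
          (χ (u ⊕ i ⊕ j ⊕ l) Bool.≟ false)))))

      centre? : ∀ u z → Dec (Centre u z)
      centre? u z = (χ u Bool.≟ false) ×-dec ((χ (u ⊕ z) Bool.≟ false) ×-dec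
        Fin.all? (λ j → ¬? (j Fin.≟ z) →-dec (χ (u ⊕ j) Bool.≟ true)))

    tight? : ∀ u a b → Dec (Tight u a b)
    tight? u a b = ¬? (a Fin.≟ b) ×-dec (centre? u b ×-dec ((χ (u ⊕ a ⊕ b) Bool.≟ true) ×-dec
      Fin.all? (λ i → ¬? (i Fin.≟ a) →-dec (¬? (i Fin.≟ b) →-dec star? u i))))

    hub? : ∀ u → Dec (Hub u)
    hub? u = (χ u Bool.≟ false) ×-dec (9 + m ≤? ∣I u ∣)

  tight : Word n → Fin n → Fin n → Bool
  tight u a b = ⌊ tight? u a b ⌋

  hub : Word n → Bool
  hub u = ⌊ hub? u ⌋

  hub⇒ : ∀ {u} → hub u ≡ true → Hub u
  hub⇒ {u} e with hub? u
  ... | yes h = h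

  ⇒hub : ∀ {u} → Hub u → hub u ≡ true
  ⇒hub {u} h with hub? u
  ... | yes _ = refl
  ... | no ¬h = contradiction h ¬h

  ⇒tight : ∀ {u a b} → Tight u a b → tight u a b ≡ true
  ⇒tight {u} {a} {b} t with tight? u a b
  ... | yes _ = refl
  ... | no ¬t = contradiction t ¬t

  τ : Word n → ℕ
  τ c = count (λ i → hub (c ⊕ i))

  -- Flipping `a` and `b` again undoes the step from `u` to `u ⊕ a ⊕ b`, so this counts the tight
  -- configurations whose further codeword is `c`.
  load : Word n → ℕ
  load c = sum (λ a → count (λ b → tight (c ⊕ a ⊕ b) a b))

  codeword-neighbours : ∀ c → χ c ≡ true →
    (∀ i → χ (c ⊕ i ⊕ i) ≡ true) × (∀ i j → χ (c ⊕ i ⊕ j) ≡ χ (c ⊕ j ⊕ i))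
  codeword-neighbours c χc = (λ i → trans (cong χ (⊕-involutive c i)) χc) , (λ i j → cong χ (⊕-comm c i j))

  module At (c : Word n) (χc : χ c ≡ true) where
    open ShareBounds W disc 11≤n (λ i → χ (c ⊕ i)) (λ i j → χ (c ⊕ i ⊕ j))
           (proj₁ (codeword-neighbours c χc)) (proj₂ (codeword-neighbours c χc)) public
    open Neighbourhood W 11≤n (λ i → χ (c ⊕ i)) (λ i j → χ (c ⊕ i ⊕ j))
           (proj₁ (codeword-neighbours c χc)) (proj₂ (codeword-neighbours c χc)) public
           using () renaming (share to local-share)

    share≡ : share c ≡ local-share
    share≡ rewrite χc = refl

  centre-size : ∀ {u z} → Centre u z → ∣I u ∣ ≡ 10 + m
  centre-size {u} {z} (χu , χz , χj) = trans (∣I∣-hub χu) (≤-antisym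
    (+-cancelʳ-≤ 1 _ (10 + m) (≤-trans (count-miss₁ {i = z} χz) (≤-reflexive (trans n≡ (+-comm 1 (10 + m))))))
    (+-cancelʳ-≤ 1 (10 + m) _ (≤-trans (≤-reflexive (trans (+-comm (10 + m) 1) (sym n≡))) (count-all-but₁ z χj))))

  centre⇒hub : ∀ {u z} → Centre u z → hub u ≡ true
  centre⇒hub ctr = ⇒hub (proj₁ ctr , ≤-trans (n≤1+n (9 + m)) (≤-reflexive (sym (centre-size ctr))))

  module AtCentre {u z} (ctr : Centre u z) {i} (i≢z : i ≢ z) where
    private
      χi : χ (u ⊕ i) ≡ true
      χi = proj₂ (proj₂ ctr) i i≢z

      module M = At (u ⊕ i) χi

      leaf : ∀ j → j ≢ z → χ (u ⊕ i ⊕ i ⊕ j) ≡ true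
      leaf j j≢z = trans (cong (λ v → χ (v ⊕ j)) (⊕-involutive u i)) (proj₂ (proj₂ ctr) j j≢z)

      size : ∣I u ⊕ i ⊕ i ∣ ≡ 10 + m
      size = trans (cong ∣I_∣ (⊕-involutive u i)) (centre-size ctr)

      module MM = M.Member {i} {z} i≢z leaf size

      bring : ∀ {x} → M.local-share + x ≤ bound + p → share (u ⊕ i) + x ≤ bound + p
      bring {x} = subst (λ v → v + x ≤ bound + p) (sym M.share≡)

    star-share : share (u ⊕ i) ≤ bound + p
    star-share = subst (_≤ bound + p) (sym M.share≡) MM.member-share

    code-share : χ (u ⊕ i ⊕ z) ≡ true → share (u ⊕ i) + 6 * s ≤ bound + p
    code-share h = bring (MM.member-code h)

    leaf-share : ∀ {j} → j ≢ i → j ≢ z → χ (u ⊕ i ⊕ j) ≡ true → share (u ⊕ i) + 4 * s ≤ bound + p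
    leaf-share j≢i j≢z h = bring (MM.member-leaf j≢i j≢z h)

    end-share : ∀ {j} → j ≢ i → j ≢ z → χ (u ⊕ i ⊕ z ⊕ j) ≡ true → share (u ⊕ i) + 4 * s ≤ bound + p
    end-share j≢i j≢z h = bring (MM.member-end j≢i j≢z h)

    pair-share : ∀ {j l} → j ≢ l → j ≢ i → j ≢ z → l ≢ i → l ≢ z → χ (u ⊕ i ⊕ j ⊕ l) ≡ true →
                 share (u ⊕ i) + 2 * s ≤ bound + p
    pair-share j≢l j≢i j≢z l≢i l≢z h = bring (MM.member-pair j≢l j≢i j≢z l≢i l≢z h)

  -- Around the further codeword `d`, direction `a` leads to a private neighbour and `b` to the only
  -- codeword neighbour, an isolated vertex of the graph. This is the situation of `share-pendant`.
  module Loaded {d a b} (t : Tight (d ⊕ a ⊕ b) a b) where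
    private
      u : Word n
      u = d ⊕ a ⊕ b

    a≢b : a ≢ b
    a≢b = proj₁ t

    ctr : Centre u b
    ctr = proj₁ (proj₂ t)

    star : ∀ i → i ≢ a → i ≢ b → Star u i
    star = proj₂ (proj₂ (proj₂ t))

    d≡ : d ≡ u ⊕ a ⊕ b
    d≡ = sym (⊕-return₂ d a b)

    χd : χ d ≡ true
    χd = trans (cong χ d≡) (proj₁ (proj₂ (proj₂ t)))

    da≡ : d ⊕ a ≡ u ⊕ b
    da≡ = trans (cong (_⊕ a) d≡) (⊕-return u a b)

    db≡ : d ⊕ b ≡ u ⊕ a
    db≡ = trans (cong (_⊕ b) d≡) (⊕-involutive (u ⊕ a) b)

    χda : χ (d ⊕ a) ≡ false
    χda = trans (cong χ da≡) (proj₁ (proj₂ ctr))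

    χdb : χ (d ⊕ b) ≡ true
    χdb = trans (cong χ db≡) (proj₂ (proj₂ ctr) a a≢b)

    only-b : ∀ i → i ≢ b → χ (d ⊕ i) ≡ false
    only-b i i≢b with i Fin.≟ a
    ... | yes refl = χda
    ... | no  i≢a  = trans (cong χ (trans (cong (_⊕ i) d≡) (⊕-rotate u a b i)))
                           (proj₂ (star i i≢a i≢b) a b a≢b (i≢a ∘ sym) (i≢b ∘ sym))

    row-a : ∀ i → i ≢ a → χ (d ⊕ a ⊕ i) ≡ false
    row-a i i≢a with i Fin.≟ b
    ... | yes refl = proj₁ ctr
    ... | no  i≢b  = trans (cong χ (trans (cong (_⊕ i) da≡) (⊕-comm u b i))) (proj₁ (star i i≢a i≢b) b (i≢b ∘ sym))

    row-b : ∀ i → i ≢ b → χ (d ⊕ b ⊕ i) ≡ false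
    row-b i i≢b with i Fin.≟ a
    ... | yes refl = trans (cong χ (⊕-comm d b i)) (proj₁ ctr)
    ... | no  i≢a  = trans (cong χ (trans (cong (_⊕ i) db≡) (⊕-comm u a i))) (proj₁ (star i i≢a i≢b) a (i≢a ∘ sym))

    size-a : ∣I d ⊕ a ∣ ≡ 1
    size-a = trans (∣I∣-hub χda) (≤-antisym (count-only₁ a row-a) (count-≥1 {i = a} (trans (cong χ (⊕-involutive d a)) χd)))

    -- Both `a` and `b` are isolated in the graph around `d`, so every hub next to `d` lacks these
    -- two directions and has exactly n - 2 codewords.
    hub-misses : ∀ {j} → hub (d ⊕ j) ≡ true →
                 j ≢ a × j ≢ b × χ (d ⊕ j ⊕ a) ≡ false × χ (d ⊕ j ⊕ b) ≡ false
    hub-misses {j} hj = j≢a , j≢b , trans (cong χ (⊕-comm d j a)) (row-a j j≢a) , trans (cong χ (⊕-comm d j b)) (row-b j j≢b)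
      where
      j≢a : j ≢ a
      j≢a refl = contradiction (subst (9 + m ≤_) size-a (proj₂ (hub⇒ hj))) (λ { (s≤s ()) })
      j≢b : j ≢ b
      j≢b refl = true≢false χdb (proj₁ (hub⇒ hj))

    hub-size : ∀ {j} → hub (d ⊕ j) ≡ true → ∣I d ⊕ j ∣ ≡ 9 + m
    hub-size {j} hj = ≤-antisym (+-cancelʳ-≤ 2 _ (9 + m) (≤-trans small (≤-reflexive (trans n≡ (+-comm 2 (9 + m)))))) (proj₂ (hub⇒ hj))
      where
      ms = hub-misses hj
      small : ∣I d ⊕ j ∣ + 2 ≤ n
      small = subst (λ v → v + 2 ≤ n) (sym (∣I∣-hub (proj₁ (hub⇒ hj))))
        (count-miss₂ a≢b (proj₁ (proj₂ (proj₂ ms))) (proj₂ (proj₂ (proj₂ ms))))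

  -- Two loaded codewords around a common hub would have the same missing directions a and b
  -- there; the star at one of them then leaves no room for the centre belonging to the other.
  loaded-unique-at-hub : ∀ {v i j a b a′ b′} → hub v ≡ true → i ≢ j →
                         Tight (v ⊕ j ⊕ a ⊕ b) a b → Tight (v ⊕ i ⊕ a′ ⊕ b′) a′ b′ → ⊥
  loaded-unique-at-hub {v} {i} {j} {a} {b} {a′} {b′} hv i≢j t t′ = clash same
    where
    module L  = Loaded {v ⊕ j} t
    module L′ = Loaded {v ⊕ i} t′
    at-hub : ∀ l → v ⊕ l ⊕ l ≡ v
    at-hub l = ⊕-involutive v l
    ms  = L.hub-misses {j} (trans (cong hub (at-hub j)) hv)
    ms′ = L′.hub-misses {i} (trans (cong hub (at-hub i)) hv)
    χ-at : ∀ l {x} → χ (v ⊕ l ⊕ l ⊕ x) ≡ false → χ (v ⊕ x) ≡ false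
    χ-at l {x} = trans (cong (λ y → χ (y ⊕ x)) (sym (at-hub l)))
    χa  = χ-at j (proj₁ (proj₂ (proj₂ ms)))
    χb  = χ-at j (proj₂ (proj₂ (proj₂ ms)))
    χa′ = χ-at i (proj₁ (proj₂ (proj₂ ms′)))
    χb′ = χ-at i (proj₂ (proj₂ (proj₂ ms′)))
    no-third : ∀ {x} → χ (v ⊕ x) ≡ false → x ≢ a → x ≢ b → ⊥
    no-third χx x≢a x≢b = contradiction
      (≤-trans (+-monoˡ-≤ 3 (subst (9 + m ≤_) (∣I∣-hub (proj₁ (hub⇒ hv))) (proj₂ (hub⇒ hv))))
        (≤-trans (count-miss₃ x≢a x≢b L.a≢b χx χa χb) (≤-reflexive n≡)))
      (subst (λ y → ¬ y ≤ 11 + m) (+-comm 3 (9 + m)) 1+n≰n)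
    same : v ⊕ i ⊕ a′ ⊕ b′ ≡ v ⊕ i ⊕ a ⊕ b
    same with a′ Fin.≟ a | a′ Fin.≟ b | b′ Fin.≟ a | b′ Fin.≟ b
    ... | no p     | no r     | _        | _        = ⊥-elim (no-third χa′ p r)
    ... | _        | _        | no p     | no r     = ⊥-elim (no-third χb′ p r)
    ... | yes refl | _        | _        | yes refl = refl
    ... | _        | yes refl | yes refl | _        = ⊕-comm (v ⊕ i) b a
    ... | yes refl | _        | yes refl | _        = contradiction refl L′.a≢b
    ... | _        | yes refl | _        | yes refl = contradiction refl L′.a≢b
    clash : v ⊕ i ⊕ a′ ⊕ b′ ≡ v ⊕ i ⊕ a ⊕ b → ⊥
    clash eq = true≢false (proj₂ (proj₂ L′.ctr) x x≢b′) (trans (cong (λ y → χ (y ⊕ x)) (trans eq move))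
      (proj₂ (L.star j (proj₁ ms) (proj₁ (proj₂ ms))) i x (x≢i ∘ sym) i≢j x≢j))
      where
      fr = fresh₃ (≤-trans (m≤m+n 4 7) 11≤n) i j b′
      x = proj₁ fr
      x≢i = proj₁ (proj₂ fr)
      x≢j = proj₁ (proj₂ (proj₂ fr))
      x≢b′ = proj₂ (proj₂ (proj₂ fr))
      move : v ⊕ i ⊕ a ⊕ b ≡ v ⊕ j ⊕ a ⊕ b ⊕ j ⊕ i
      move = sym (trans (cong (_⊕ i) (trans (⊕-rotate (v ⊕ j) a b j) (cong (λ y → y ⊕ a ⊕ b) (at-hub j)))) (⊕-rotate v a b i))

  module Located
    (located₁ : ∀ c {i j} → χ c ≡ true → i ≢ j → χ (c ⊕ i) ≡ false → χ (c ⊕ j) ≡ false →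
                ∣I c ⊕ i ∣ ≡ 1 → ∣I c ⊕ j ∣ ≢ 1)
    (located₂ : ∀ c {i j} → χ c ≡ true → i ≢ j → χ (c ⊕ i) ≡ false → χ (c ⊕ j) ≡ false →
                χ (c ⊕ i ⊕ j) ≡ true → ∣I c ⊕ i ∣ ≡ 2 → ∣I c ⊕ j ∣ ≢ 2) where

    star-or-small : ∀ c → χ c ≡ true → (∃ λ h → ∃ λ z → h ≢ z × Centre (c ⊕ h) z × Star (c ⊕ h) h) ⊎ share c + X ≤ bound
    star-or-small c χc with At.share-or-star c χc (located₁ c χc) (located₂ c χc)
    ... | inj₂ small = inj₂ (subst (λ v → v + X ≤ bound) (sym (At.share≡ c χc)) small)
    ... | inj₁ (h , z , h≢z , iso , leaf , miss , rest) =
      inj₁ (h , z , h≢z , (iso h , miss , leaf) ,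
            (λ j j≢h → trans (cong (λ v → χ (v ⊕ j)) (⊕-involutive c h)) (iso j)) ,
            (λ j l j≢l j≢h l≢h → trans (cong (λ v → χ (v ⊕ j ⊕ l)) (⊕-involutive c h)) (rest j l j≢l j≢h l≢h)))

    private
      star-hub-unique : ∀ {c h z} → Centre (c ⊕ h) z → Star (c ⊕ h) h → ∀ {i} → hub (c ⊕ i) ≡ true → i ≡ h
      star-hub-unique {c} {h} {z} ctr (_ , rest) {i} hi with i Fin.≟ h
      ... | yes i≡h = i≡h
      ... | no  i≢h = contradiction (≤-trans (proj₂ (hub⇒ hi)) (≤-trans (≤-reflexive (∣I∣-hub (proj₁ (hub⇒ hi))))
                        (count-only₂ i h none))) (λ { (s≤s (s≤s ())) })
        where
        none : ∀ j → j ≢ i → j ≢ h → χ (c ⊕ i ⊕ j) ≡ false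
        none j j≢i j≢h = trans (cong (λ v → χ (v ⊕ i ⊕ j)) (sym (⊕-involutive c h))) (rest i j (j≢i ∘ sym) i≢h j≢h)

    -- The centre of a star is a hub, and a star has no other hub since its remaining neighbours see
    -- at most two codewords. Hence a star at `u ⊕ i` has the given hub `u` as its centre.
    star-or-small-at : ∀ {u} → hub u ≡ true → ∀ i → χ (u ⊕ i) ≡ true →
                       (∃ λ z → i ≢ z × Centre u z × Star u i) ⊎ share (u ⊕ i) + X ≤ bound
    star-or-small-at {u} hu i χi with star-or-small (u ⊕ i) χi
    ... | inj₂ small = inj₂ small
    ... | inj₁ (h , z , h≢z , ctr , st) with star-hub-unique {u ⊕ i} ctr st {i} (trans (cong hub (⊕-involutive u i)) hu)
    ...   | refl = inj₁ (z , h≢z , subst (λ v → Centre v z) (⊕-involutive u i) ctr , subst (λ v → Star v i) (⊕-involutive u i) st)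

    small-no-hub : ∀ {c} → χ c ≡ true → τ c ≡ 0 → share c + X ≤ bound
    small-no-hub {c} χc τ0 with star-or-small c χc
    ... | inj₂ small = small
    ... | inj₁ (h , z , _ , ctr , _) =
      contradiction (subst (1 ≤_) τ0 (count-≥1 {i = h} (centre⇒hub ctr))) (λ ())

    loaded-no-hub : ∀ {c a b} → Tight (c ⊕ a ⊕ b) a b → τ c ≡ 0 → share c + n * X ≤ bound
    loaded-no-hub {c} {a} {b} t τ0 = subst (λ v → v + n * X ≤ bound) (sym (At.share≡ c L.χd))
      (At.share-pendant c L.χd (located₁ c L.χd) (located₂ c L.χd) {b} {a} L.size-a L.χdb L.only-b L.row-b
        (λ i χi big → contradiction (subst (1 ≤_) τ0 (count-≥1 {i = i} (⇒hub (χi , big)))) (λ ())))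
      where module L = Loaded {c} t

    loaded-hub : ∀ {c a b j} → Tight (c ⊕ a ⊕ b) a b → hub (c ⊕ j) ≡ true → share c + 3 * s ≤ bound + q
    loaded-hub {c} {a} {b} {j} t hj = subst (λ v → v + 3 * s ≤ bound + q) (sym (At.share≡ c L.χd))
      (At.share-hub-nonisolated c L.χd (located₁ c L.χd) (located₂ c L.χd) {j} {b} L.χdb (L.hub-size hj))
      where module L = Loaded {c} t

    hub-share : ∀ {c j} → χ c ≡ true → ∣I c ⊕ j ∣ ≡ 9 + m → share c + s ≤ bound + q
    hub-share {c} {j} χc size = subst (λ v → v + s ≤ bound + q) (sym (At.share≡ c χc)) (At.share-hub c χc (located₁ c χc) (located₂ c χc) {j} size)

    two-hubs : ∀ {c g} → χ c ≡ true → 2 ≤ τ c → g + q ≡ 2 * s → share c + n * X + τ c * g ≤ bound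
    two-hubs {c} {g} χc 2≤τ g+q with count-witness {b = λ i → hub (c ⊕ i)} (≤-trans (s≤s z≤n) 2≤τ)
    ... | x , hx with count-witness₂ {b = λ i → hub (c ⊕ i)} x 2≤τ
    ...   | y , y≢x , hy = subst (λ v → v + n * X + τ c * g ≤ bound) (sym (At.share≡ c χc))
      (At.share-hubs c χc (located₁ c χc) (located₂ c χc) {g} (λ i → hub (c ⊕ i)) g+q hub⇒ (y≢x ∘ sym) hx hy)

    -- Location permits one private neighbour, which fixes `a`; the only codeword neighbour fixes
    -- `b`.
    loaded-unique : ∀ {c a b a′ b′} → Tight (c ⊕ a ⊕ b) a b → Tight (c ⊕ a′ ⊕ b′) a′ b′ → a′ ≡ a × b′ ≡ b
    loaded-unique {c} {a} {b} {a′} {b′} t t′ = a≡ , b≡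
      where
      module L  = Loaded {c} t
      module L′ = Loaded {c} t′
      a≡ : a′ ≡ a
      a≡ with a′ Fin.≟ a
      ... | yes e = e
      ... | no ne = contradiction L.size-a (located₁ c L.χd ne L′.χda L.χda L′.size-a)
      b≡ : b′ ≡ b
      b≡ with b′ Fin.≟ b
      ... | yes e = e
      ... | no ne = ⊥-elim (true≢false L′.χdb (L.only-b b′ ne))

    load-cases : ∀ c → load c ≡ 0 ⊎ (load c ≤ 1 × ∃ λ a → ∃ λ b → Tight (c ⊕ a ⊕ b) a b)
    load-cases c with decide-fin (λ a → decide-fin (λ b → test a b))
      where
      test : ∀ a b → tight (c ⊕ a ⊕ b) a b ≡ false ⊎ Tight (c ⊕ a ⊕ b) a b
      test a b with tight? (c ⊕ a ⊕ b) a b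
      ... | yes t = inj₂ t
      ... | no  _ = inj₁ refl
    ... | inj₁ none = inj₁ (trans (sum-cong-≗ (λ a → count-none (none a))) (trans (sum-const n 0) (*-zeroʳ n)))
    ... | inj₂ (a , b , t) = inj₂ (subst (load c ≤_) (sum-at a 1) (sum-mono ptw) , a , b , t)
      where
      not-tight : ∀ {a′ b′} → ¬ (a′ ≡ a × b′ ≡ b) → tight (c ⊕ a′ ⊕ b′) a′ b′ ≡ false
      not-tight {a′} {b′} ne with tight? (c ⊕ a′ ⊕ b′) a′ b′
      ... | yes t′ = contradiction (loaded-unique {c} t t′) ne
      ... | no  _  = refl
      ptw : ∀ a′ → count (λ b′ → tight (c ⊕ a′ ⊕ b′) a′ b′) ≤ at a 1 a′
      ptw a′ with a′ Fin.≟ a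
      ... | yes refl = subst (count (λ b′ → tight (c ⊕ a′ ⊕ b′) a′ b′) ≤_) (sym (at-same a′ 1))
                         (count-only₁ {c = λ b′ → tight (c ⊕ a′ ⊕ b′) a′ b′} b (λ b′ b′≢b → not-tight (b′≢b ∘ proj₂)))
      ... | no  a≢   = ≤-trans (≤-reflexive (count-none {c = λ b′ → tight (c ⊕ a′ ⊕ b′) a′ b′} (λ b′ → not-tight (a≢ ∘ proj₁)))) z≤n

-- Discharging through the hubs.

sum-+₃ : ∀ {n} (f g h : Fin n → ℕ) → sum (λ i → f i + g i + h i) ≡ sum f + sum g + sum h
sum-+₃ f g h = trans (∑-distrib-+ (λ i → f i + g i) h) (cong (_+ sum h) (∑-distrib-+ f g))

sum-indicator-* : ∀ {n} (c : Fin n → Bool) t → sum (λ i → ⟦ c i ⟧ * t) ≡ count c * t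
sum-indicator-* c t = sym (*-distribʳ-sum t (λ i → ⟦ c i ⟧))

module Discharging {n s : ℕ} (W : Weight n s) {m X : ℕ} (disc : Discount W m X) (11≤n : 11 ≤ n) (χ : Word n → Bool)
  (dominated : ∀ x → 1 ≤ I-size χ x)
  (located₁ : ∀ c {i j} → χ c ≡ true → i ≢ j → χ (c ⊕ i) ≡ false → χ (c ⊕ j) ≡ false →
              I-size χ (c ⊕ i) ≡ 1 → I-size χ (c ⊕ j) ≢ 1)
  (located₂ : ∀ c {i j} → χ c ≡ true → i ≢ j → χ (c ⊕ i) ≡ false → χ (c ⊕ j) ≡ false →
              χ (c ⊕ i ⊕ j) ≡ true → I-size χ (c ⊕ i) ≡ 2 → I-size χ (c ⊕ j) ≢ 2) where

  open LocatingCode W disc 11≤n χ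
  open Located located₁ located₂

  -- `ε` bounds the excess of a star over the target `T`. As `(10 + m) * p` is the full charge
  -- `6 * s`, the n - 1 stars of a centre sum to `6 * s + δ`, and `δ` is what a saving of `6 * s`
  -- leaves open. `g` is what a hub of the least size falls short of `2 * s`.
  T g δ ε : ℕ
  T = bound ∸ X
  g = 2 * s ∸ q
  δ = (10 + m) * X
  ε = X + p

  X≤s : X ≤ s
  X≤s = ≤-trans (m≤n*m X 4) 4X≤s

  T+X : T + X ≡ bound
  T+X = m∸n+n≡m (≤-trans X≤s (≤-trans (m≤n*m s 6) (m≤n+m (6 * s) (n * (3 * s)))))

  g+q : g + q ≡ 2 * s
  g+q = m∸n+n≡m (w≤2s (s≤s (s≤s (s≤s z≤n))))

  T≥ : ∀ {x y} → x + X + y ≤ bound → x + y ≤ T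
  T≥ {x} {y} le = +-cancelʳ-≤ X (x + y) T (≤-trans (≤-trans (≤-reflexive (lemma x y X)) le) (≤-reflexive (sym T+X)))
    where
    lemma : ∀ x y X → x + y + X ≡ x + X + y
    lemma = solve-∀

  nX≡ : n * X ≡ X + δ
  nX≡ = cong (_* X) n≡

  -- Crude estimates suffice: `p` and `q` are at most `w 8`, three quarters of `s`, and `X` is at
  -- most a quarter of `s`.
  ε≤g : ε ≤ g
  ε≤g = +-cancelʳ-≤ q ε g (subst (ε + q ≤_) (sym g+q) (*-cancelˡ-≤ 8 (linear (2 * s)
    (+-mono-≤ (*-monoʳ-≤ 2 4X≤s) (+-mono-≤ (*-monoʳ-≤ 8 (w-antitone {8} {10 + m} (m≤m+n 8 (2 + m)))) (*-monoʳ-≤ 8 (w-antitone {8} {9 + m} (m≤m+n 8 (1 + m))))))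
    (trans (cong (λ v → 8 * (X + p + q) + (2 * s + (v + v)) + 2 * s) (w-exact (s≤s z≤n) (≤-trans (m≤m+n 8 4) (s≤s 11≤n)))) (lemma X p q s)))))
    where
    lemma : ∀ X p q s → 8 * (X + p + q) + (2 * s + (6 * s + 6 * s)) + 2 * s ≡ 8 * (2 * s) + (2 * (4 * X) + (8 * p + 8 * q))
    lemma = solve-∀

  charge : Word n → ℕ
  charge c = share c + δ * load c

  -- A codeword with a single hub hands its whole balance over to that hub;
  -- one with several hubs is so far below the average that it pays g to each of them.
  debit credit : Word n → ℕ
  debit c with τ c ℕ.≟ 1
  ... | yes _ = charge c
  ... | no  _ = 0
  credit c with τ c ℕ.≟ 1
  ... | yes _ = T
  ... | no  _ = g

  -- With one hub this is an identity, since everything is handed over. With several hubs, and for a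
  -- loaded codeword with none, the slack `n * X` equals `X + δ` and so absorbs a load, which is at
  -- most 1.
  codeword-balance : ∀ c → χ c ≡ true → charge c + τ c * credit c ≤ T + τ c * debit c
  codeword-balance c χc with τ c ℕ.≟ 1
  ... | yes τ1 rewrite τ1 = ≤-reflexive (lemma (charge c) T)
    where
    lemma : ∀ x y → x + 1 * y ≡ y + 1 * x
    lemma = solve-∀
  ... | no τ≢1 with 2 ≤? τ c
  ...   | yes 2≤τ = ≤-trans (subst (_≤ T) (sym (+-assoc (share c) (δ * load c) (τ c * g))) (T≥ {share c} (≤-trans (≤-trans big (≤-reflexive eq)) (two-hubs χc 2≤τ g+q)))) (m≤m+n _ _)
    where
    load≤1 : load c ≤ 1
    load≤1 with load-cases c
    ... | inj₁ e = subst (_≤ 1) (sym e) z≤n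
    ... | inj₂ (le , _) = le
    big : share c + X + (δ * load c + τ c * g) ≤ share c + X + (δ * 1 + τ c * g)
    big = +-monoʳ-≤ (share c + X) (+-monoˡ-≤ (τ c * g) (*-monoʳ-≤ δ load≤1))
    lemma : ∀ f X d t → f + X + (d * 1 + t) ≡ f + (X + d) + t
    lemma = solve-∀
    eq : share c + X + (δ * 1 + τ c * g) ≡ share c + n * X + τ c * g
    eq = trans (lemma (share c) X δ (τ c * g)) (cong (λ v → share c + v + τ c * g) (sym nX≡))
  ...   | no 2≰τ = subst (λ t → charge c + t * g ≤ T + t * 0) (sym τ0) (subst (_≤ T + 0) (sym (+-identityʳ (charge c))) (≤-trans small (m≤m+n T 0)))
    where
    τ0 : τ c ≡ 0
    τ0 = n<1⇒n≡0 (≤∧≢⇒< (≤-pred (≰⇒> 2≰τ)) τ≢1)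
    small : charge c ≤ T
    small with load-cases c
    ... | inj₁ e = T≥ {share c} (subst (λ v → share c + X + δ * v ≤ bound) (sym e)
                     (≤-trans (≤-reflexive (trans (cong (share c + X +_) (*-zeroʳ δ)) (+-identityʳ _))) (small-no-hub χc τ0)))
    ... | inj₂ (le , a , b , t) = T≥ {share c} (≤-trans (+-monoʳ-≤ (share c + X) (*-monoʳ-≤ δ le))
                     (≤-trans (≤-reflexive (trans (lemma (share c) X δ) (cong (share c +_) (sym nX≡)))) (loaded-no-hub {c} t τ0)))
      where
      lemma : ∀ f X d → f + X + d * 1 ≡ f + (X + d)
      lemma = solve-∀

  debits credits : Word n → ℕ
  debits  u = sum (λ i → ⟦ χ (u ⊕ i) ⟧ * debit (u ⊕ i))
  credits u = sum (λ i → ⟦ χ (u ⊕ i) ⟧ * credit (u ⊕ i))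

  tights : Word n → ℕ
  tights u = sum (λ a → count (λ b → tight u a b))

  private
    at-hub : ∀ {u} i → hub u ≡ true → hub (u ⊕ i ⊕ i) ≡ true
    at-hub {u} i hu = trans (cong hub (⊕-involutive u i)) hu

  debit-shared : ∀ {c} → τ c ≢ 1 → debit c ≡ 0
  debit-shared {c} τ≢1 with τ c ℕ.≟ 1
  ... | yes τ1 = contradiction τ1 τ≢1
  ... | no _   = refl

  credit-shared : ∀ {c} → τ c ≢ 1 → credit c ≡ g
  credit-shared {c} τ≢1 with τ c ℕ.≟ 1
  ... | yes τ1 = contradiction τ1 τ≢1
  ... | no _   = refl

  debit-single : ∀ {c} → τ c ≡ 1 → debit c ≡ charge c
  debit-single {c} τ1 with τ c ℕ.≟ 1
  ... | yes _  = refl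
  ... | no τ≢1 = contradiction τ1 τ≢1

  credit-single : ∀ {c} → τ c ≡ 1 → credit c ≡ T
  credit-single {c} τ1 with τ c ℕ.≟ 1
  ... | yes _  = refl
  ... | no τ≢1 = contradiction τ1 τ≢1

  shared-pays : ∀ {c} → τ c ≢ 1 → debit c + ε ≤ credit c
  shared-pays {c} τ≢1 = subst (λ v → v + ε ≤ credit c) (sym (debit-shared {c} τ≢1)) (subst (ε ≤_) (sym (credit-shared {c} τ≢1)) ε≤g)

  unloaded-debit : ∀ {c x y} → load c ≡ 0 → share c + x ≤ T + y → x ≤ g + y → debit c + x ≤ credit c + y
  unloaded-debit {c} {x} {y} l0 single shared with τ c ℕ.≟ 1
  ... | yes _ = subst (λ v → v + x ≤ T + y) (sym (trans (cong (λ v → share c + δ * v) l0) (trans (cong (share c +_) (*-zeroʳ δ)) (+-identityʳ _)))) single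
  ... | no  _ = shared

  private
    ⟦⟧*-mono : ∀ {b x y} → (b ≡ true → x ≤ y) → ⟦ b ⟧ * x ≤ ⟦ b ⟧ * y
    ⟦⟧*-mono {true}  f = *-monoʳ-≤ 1 (f refl)
    ⟦⟧*-mono {false} f = z≤n

    small⇒ : ∀ {c} → share c + X ≤ bound → share c ≤ T
    small⇒ {c} le = +-cancelʳ-≤ X (share c) T (≤-trans le (≤-reflexive (sym T+X)))

  -- The hub has exactly n - 2 codewords, and only `u ⊕ j` among them is loaded. Relative to an
  -- excess of `X + q` each saves `s`, and `u ⊕ j` even `3 * s`. As `(9 + m) * q` is `6 * s`, the
  -- demand is `(19 + 2 * m) * X + 6 * s` against savings of `(11 + m) * s`, and `4X≤s` settles it.
  loaded-hub-balance : ∀ {u j a b} → hub u ≡ true → χ (u ⊕ j) ≡ true → τ (u ⊕ j) ≡ 1 →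
                       Tight (u ⊕ j ⊕ a ⊕ b) a b → debits u ≤ credits u
  loaded-hub-balance {u} {j} {a} {b} hu χj τj t = *-cancelˡ-≤ 4 (linear (s + m * s + m * s)
      (+-mono-≤ (*-monoʳ-≤ 4 total) (*-monoʳ-≤ (19 + 2 * m) 4X≤s)) eq)
    where
    module L = Loaded {u ⊕ j} t
    size : ∣I u ∣ ≡ 9 + m
    size = trans (cong ∣I_∣ (sym (⊕-involutive u j))) (L.hub-size (at-hub j hu))
    χu : χ u ≡ false
    χu = proj₁ (hub⇒ hu)
    χᵘ : Fin n → Bool
    χᵘ i = χ (u ⊕ i)
    size′ : count χᵘ ≡ 9 + m
    size′ = trans (sym (∣I∣-hub χu)) size
    bound+q : ∀ {x y} → x + y ≤ bound + q → x + y ≤ T + (X + q)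
    bound+q {x} {y} le = ≤-trans le (≤-reflexive (trans (cong (_+ q) (sym T+X)) (+-assoc T X q)))
    load-j : load (u ⊕ j) ≤ 1
    load-j with load-cases (u ⊕ j)
    ... | inj₁ e = subst (_≤ 1) (sym e) z≤n
    ... | inj₂ (le , _) = le
    ptw : ∀ i → ⟦ χᵘ i ⟧ * debit (u ⊕ i) + ⟦ χᵘ i ⟧ * s + at j (2 * s) i ≤
                ⟦ χᵘ i ⟧ * credit (u ⊕ i) + ⟦ χᵘ i ⟧ * (X + q) + at j δ i
    ptw i with i Fin.≟ j
    ... | yes refl rewrite χj | at-same i (2 * s) | at-same i δ | debit-single {u ⊕ i} τj | credit-single {u ⊕ i} τj =
      linear 0 (+-mono-≤ (bound+q {share (u ⊕ i)} (loaded-hub {u ⊕ i} {j = i} t (at-hub i hu))) (*-monoʳ-≤ δ load-j))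
        (lemma (share (u ⊕ i)) (δ * load (u ⊕ i)) s T (X + q) δ)
      where
      lemma : ∀ f l s T x d → 1 * (f + l) + 1 * s + 2 * s + (T + x + d * 1) + 0 ≡ 1 * T + 1 * x + d + (f + 3 * s + l)
      lemma = solve-∀
    ... | no i≢j rewrite at-other {j = j} {i} (2 * s) i≢j | at-other {j = j} {i} δ i≢j with χ (u ⊕ i) in χi
    ...   | false = z≤n
    ...   | true  = ≤-trans (≤-reflexive (lemma (debit (u ⊕ i)) s)) (≤-trans
                      (unloaded-debit {u ⊕ i} l0 (bound+q {share (u ⊕ i)} (hub-share {u ⊕ i} {i} χi (trans (cong ∣I_∣ (⊕-involutive u i)) size))) s≤)
                      (≤-reflexive (lemma′ (credit (u ⊕ i)) (X + q))))
      where
      lemma : ∀ x y → 1 * x + 1 * y + 0 ≡ x + y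
      lemma = solve-∀
      lemma′ : ∀ x y → x + y ≡ 1 * x + 1 * y + 0
      lemma′ = solve-∀
      l0 : load (u ⊕ i) ≡ 0
      l0 with load-cases (u ⊕ i)
      ... | inj₁ e = e
      ... | inj₂ (_ , a′ , b′ , t′) = ⊥-elim (loaded-unique-at-hub hu i≢j t t′)
      s≤ : s ≤ g + (X + q)
      s≤ = ≤-trans (m≤n*m s 2) (≤-trans (≤-reflexive (sym g+q)) (+-monoʳ-≤ g (m≤n+m q X)))
    total : debits u + (9 + m) * s + 2 * s ≤ credits u + ((9 + m) * X + 6 * s) + δ
    total = ≤-trans (≤-reflexive (sym lhs)) (≤-trans (sum-mono ptw) (≤-reflexive rhs))
      where
      lhs : sum (λ i → ⟦ χᵘ i ⟧ * debit (u ⊕ i) + ⟦ χᵘ i ⟧ * s + at j (2 * s) i) ≡ debits u + (9 + m) * s + 2 * s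
      lhs = trans (sum-+₃ (λ i → ⟦ χᵘ i ⟧ * debit (u ⊕ i)) (λ i → ⟦ χᵘ i ⟧ * s) (at j (2 * s)))
        (cong₂ _+_ (cong (debits u +_) (trans (sum-indicator-* χᵘ s) (cong (_* s) size′))) (sum-at j (2 * s)))
      rhs : sum (λ i → ⟦ χᵘ i ⟧ * credit (u ⊕ i) + ⟦ χᵘ i ⟧ * (X + q) + at j δ i) ≡ credits u + ((9 + m) * X + 6 * s) + δ
      rhs = trans (sum-+₃ (λ i → ⟦ χᵘ i ⟧ * credit (u ⊕ i)) (λ i → ⟦ χᵘ i ⟧ * (X + q)) (at j δ))
        (cong₂ _+_ (cong (credits u +_) (trans (sum-indicator-* χᵘ (X + q)) (trans (cong (_* (X + q)) size′)
          (trans (*-distribˡ-+ (9 + m) X q) (cong ((9 + m) * X +_) (w-exact (s≤s z≤n) (≤-trans (≤-trans (m≤n+m (9 + m) 2) (≤-reflexive (sym n≡))) (n≤1+n n)))))))) (sum-at j δ))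
    eq : 4 * debits u + (4 * (credits u + ((9 + m) * X + 6 * s) + δ) + (19 + 2 * m) * s) + (s + m * s + m * s) ≡
         4 * credits u + (4 * (debits u + (9 + m) * s + 2 * s) + (19 + 2 * m) * (4 * X))
    eq = lemma (debits u) (credits u) m X s
      where
      lemma : ∀ D C m X s → 4 * D + (4 * (C + ((9 + m) * X + 6 * s) + (10 + m) * X) + (19 + 2 * m) * s) + (s + m * s + m * s) ≡
              4 * C + (4 * (D + (9 + m) * s + 2 * s) + (19 + 2 * m) * (4 * X))
      lemma = solve-∀

  starless-balance : ∀ {u} → hub u ≡ true → (∀ i → χ (u ⊕ i) ≡ true → share (u ⊕ i) + X ≤ bound) → debits u ≤ credits u
  starless-balance {u} hu small with decide-fin test
    where
    test : ∀ i → (χ (u ⊕ i) ≡ true → debit (u ⊕ i) ≤ credit (u ⊕ i)) ⊎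
                 (χ (u ⊕ i) ≡ true × τ (u ⊕ i) ≡ 1 × ∃ λ a → ∃ λ b → Tight (u ⊕ i ⊕ a ⊕ b) a b)
    test i with χ (u ⊕ i) in χi | τ (u ⊕ i) ℕ.≟ 1
    ... | false | _      = inj₁ λ ()
    ... | true | no τ≢1  = inj₁ (λ _ → z≤n)
    ... | true | yes τ1 with load-cases (u ⊕ i)
    ...   | inj₂ (_ , loaded) = inj₂ (refl , τ1 , loaded)
    ...   | inj₁ l0 = inj₁ (λ _ → ≤-trans (≤-reflexive (trans (cong (λ v → share (u ⊕ i) + δ * v) l0)
                        (trans (cong (share (u ⊕ i) +_) (*-zeroʳ δ)) (+-identityʳ _)))) (small⇒ {u ⊕ i} (small i χi)))
  ... | inj₂ (j , χj , τj , a , b , t) = loaded-hub-balance hu χj τj t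
  ... | inj₁ ok = sum-mono (λ i → ⟦⟧*-mono {χ (u ⊕ i)} (ok i))

  module StarCentre {u : Word n} {z : Fin n} (ctr : Centre u z) where
    private
      hu : hub u ≡ true
      hu = centre⇒hub ctr

      χᵘ : Fin n → Bool
      χᵘ i = χ (u ⊕ i)

      χ⇒≢z : ∀ {i} → χᵘ i ≡ true → i ≢ z
      χ⇒≢z χi refl = true≢false χi (proj₁ (proj₂ ctr))

      size : count χᵘ ≡ 10 + m
      size = trans (sym (∣I∣-hub (proj₁ ctr))) (centre-size ctr)

    -- A hub next to a loaded codeword sees n - 2 codewords, a centre n - 1.
    unloaded : ∀ i → load (u ⊕ i) ≡ 0
    unloaded i with load-cases (u ⊕ i)
    ... | inj₁ e = e
    ... | inj₂ (_ , a , b , t) = contradiction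
      (trans (sym (centre-size ctr)) (trans (cong ∣I_∣ (sym (⊕-involutive u i))) (Loaded.hub-size {u ⊕ i} t (at-hub i hu))))
      1+n≢n

    bound+p : bound + p ≡ T + ε
    bound+p = trans (cong (_+ p) (sym T+X)) (+-assoc T X p)

    debit-saves : ∀ {i x} → share (u ⊕ i) + x ≤ bound + p → x ≤ g + ε → debit (u ⊕ i) + x ≤ credit (u ⊕ i) + ε
    debit-saves {i} {x} le = unloaded-debit {u ⊕ i} (unloaded i) (≤-trans le (≤-reflexive bound+p))

    debit≤ : ∀ {i} → χᵘ i ≡ true → debit (u ⊕ i) ≤ credit (u ⊕ i) + ε
    debit≤ {i} χi = subst (_≤ credit (u ⊕ i) + ε) (+-identityʳ _)
      (debit-saves {i} (subst (_≤ bound + p) (sym (+-identityʳ _)) (AtCentre.star-share ctr (χ⇒≢z χi))) z≤n)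

    star-or-debit≤ : ∀ i → χᵘ i ≡ true → Star u i ⊎ debit (u ⊕ i) ≤ credit (u ⊕ i)
    star-or-debit≤ i χi with star-or-small-at hu i χi
    ... | inj₁ (_ , _ , _ , st) = inj₁ st
    ... | inj₂ small = inj₂ (+-cancelʳ-≤ 0 _ _
      (unloaded-debit {u ⊕ i} (unloaded i) (+-monoˡ-≤ 0 (small⇒ {u ⊕ i} small)) z≤n))

    -- If `u′ ⊕ l` is a codeword, it joins two leaves in the graph of `u ⊕ l`, which then is no
    -- star. As `u′` is a hub, at most two directions can carry an excess `ε`. The codewords among
    -- the common neighbours `u ⊕ i` and `u ⊕ j` have two hubs and pay for them.
    module Shared {i j : Fin n} (χi : χ (u ⊕ i) ≡ true) (j≢i : j ≢ i) (hj : hub (u ⊕ i ⊕ j) ≡ true) where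

      u′ : Word n
      u′ = u ⊕ i ⊕ j

      shared : ∀ {x y} → x ≢ y → hub (u ⊕ x ⊕ y) ≡ true → τ (u ⊕ x) ≢ 1
      shared {x} {y} x≢y hy τ1 = contradiction
        (subst (2 ≤_) τ1 (count-≥2 {b = λ l → hub (u ⊕ x ⊕ l)} x≢y (at-hub x hu) hy)) (λ { (s≤s ()) })

      Ptw : Fin n → ℕ → Set
      Ptw l e = ⟦ χᵘ l ⟧ * debit (u ⊕ l) + e + ⟦ χ (u′ ⊕ l) ⟧ * ε ≤ ⟦ χᵘ l ⟧ * credit (u ⊕ l) + ε

      ⟦⟧*ε≤ε : ∀ b → ⟦ b ⟧ * ε ≤ ε
      ⟦⟧*ε≤ε b = ≤-trans (*-monoˡ-≤ ε ⟦ b ⟧≤1) (≤-reflexive (*-identityˡ ε))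

      ordinary : ∀ {l} → l ≢ i → l ≢ j → Ptw l 0
      ordinary {l} l≢i l≢j with χ (u ⊕ l) in χl
      ... | false = ⟦⟧*ε≤ε (χ (u′ ⊕ l))
      ... | true with star-or-debit≤ l χl
      ...   | inj₂ le = +-mono-≤ (≤-trans (≤-reflexive (+-identityʳ _)) (*-monoʳ-≤ 1 le)) (⟦⟧*ε≤ε (χ (u′ ⊕ l)))
      ...   | inj₁ (_ , rest) rewrite trans (cong χ (⊕-rotate u i j l)) (rest i j (j≢i ∘ sym) (l≢i ∘ sym) (l≢j ∘ sym)) =
        ≤-trans (≤-reflexive (lemma (debit (u ⊕ l)))) (≤-trans (debit≤ χl) (≤-reflexive (cong (_+ ε) (sym (*-identityˡ (credit (u ⊕ l)))))))
        where
        lemma : ∀ x → 1 * x + 0 + 0 ≡ x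
        lemma = solve-∀

      finish : (e : Fin n → ℕ) → sum e ≡ ε + ε → (∀ l → Ptw l (e l)) → debits u ≤ credits u
      finish e sum-e ptw = linear 0
        (+-mono-≤ (sum-mono ptw) (*-monoˡ-≤ ε (subst (9 + m ≤_) (∣I∣-hub (proj₁ (hub⇒ hj))) (proj₂ (hub⇒ hj)))))
        (trans (cong (λ v → debits u + (v + count (λ l → χ (u′ ⊕ l)) * ε) + 0) rhs)
          (trans (lemma (debits u) (credits u) m ε (count (λ l → χ (u′ ⊕ l)) * ε)) (cong (λ v → credits u + (v + (9 + m) * ε)) (sym lhs))))
        where
        lhs : sum (λ l → ⟦ χᵘ l ⟧ * debit (u ⊕ l) + e l + ⟦ χ (u′ ⊕ l) ⟧ * ε) ≡ debits u + (ε + ε) + count (λ l → χ (u′ ⊕ l)) * ε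
        lhs = trans (sum-+₃ (λ l → ⟦ χᵘ l ⟧ * debit (u ⊕ l)) e (λ l → ⟦ χ (u′ ⊕ l) ⟧ * ε))
          (cong₂ _+_ (cong (debits u +_) sum-e) (sum-indicator-* (λ l → χ (u′ ⊕ l)) ε))
        rhs : sum (λ l → ⟦ χᵘ l ⟧ * credit (u ⊕ l) + ε) ≡ credits u + (11 + m) * ε
        rhs = trans (∑-distrib-+ (λ l → ⟦ χᵘ l ⟧ * credit (u ⊕ l)) (λ _ → ε)) (cong (credits u +_) (trans (sum-const n ε) (cong (_* ε) n≡)))
        lemma : ∀ D C m e c → D + (C + (11 + m) * e + c) + 0 ≡ C + (D + (e + e) + c + (9 + m) * e)
        lemma = solve-∀

      pays : ∀ {l} → χᵘ l ≡ true → τ (u ⊕ l) ≢ 1 → Ptw l ε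
      pays {l} χl τ≢1 rewrite χl = +-mono-≤ (≤-trans (≤-reflexive (cong (_+ ε) (*-identityˡ (debit (u ⊕ l)))))
        (≤-trans (shared-pays {u ⊕ l} τ≢1) (≤-reflexive (sym (*-identityˡ (credit (u ⊕ l))))))) (⟦⟧*ε≤ε (χ (u′ ⊕ l)))

      shared-balance : debits u ≤ credits u
      shared-balance with j Fin.≟ z
      ... | no j≢z = finish (λ l → at i ε l + at j ε l) (trans (sum-+-at (at i ε) j ε) (cong (_+ ε) (sum-at i ε))) ptw
        where
        ptw : ∀ l → Ptw l (at i ε l + at j ε l)
        ptw l with l Fin.≟ i
        ... | yes refl rewrite at-same l ε | at-other {j = j} {l} ε (j≢i ∘ sym) | +-identityʳ ε = pays {l} χi (shared (j≢i ∘ sym) hj)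
        ... | no l≢i with l Fin.≟ j
        ...   | yes refl rewrite at-same l ε | at-other {j = i} {l} ε l≢i =
          pays {l} (proj₂ (proj₂ ctr) l j≢z) (shared l≢i (trans (cong hub (⊕-comm u l i)) hj))
        ...   | no l≢j rewrite at-other {j = i} {l} ε l≢i | at-other {j = j} {l} ε l≢j = ordinary l≢i l≢j
      -- Now `u ⊕ j` is no codeword, so only `u ⊕ i` pays. But `u′ ⊕ i` is `u ⊕ z`, so `i` itself is
      -- one of the at most two directions that `u′` misses, and both units are booked there.
      ... | yes refl = finish (at i (ε + ε)) (sum-at i (ε + ε)) ptw
        where
        ptw : ∀ l → Ptw l (at i (ε + ε) l)
        ptw l with l Fin.≟ i
        ... | yes refl rewrite at-same l (ε + ε) | χi | trans (cong χ (⊕-return u l j)) (proj₁ (proj₂ ctr)) =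
          ≤-trans (≤-reflexive (lemma (debit (u ⊕ l)) ε)) (≤-trans (+-monoˡ-≤ ε (shared-pays {u ⊕ l} (shared (j≢i ∘ sym) hj)))
            (≤-reflexive (cong (_+ ε) (sym (*-identityˡ (credit (u ⊕ l)))))))
          where
          lemma : ∀ x e → 1 * x + (e + e) + 0 ≡ x + e + e
          lemma = solve-∀
        ... | no l≢i rewrite at-other {j = i} {l} (ε + ε) l≢i with l Fin.≟ j
        ...   | no l≢j = ordinary l≢i l≢j
        ...   | yes refl rewrite proj₁ (proj₂ ctr) = ⟦⟧*ε≤ε (χ (u′ ⊕ l))

    module Unshared (single : ∀ i → χ (u ⊕ i) ≡ true → τ (u ⊕ i) ≡ 1) where

      private
        F B : Fin n → ℕ
        F i = ⟦ χᵘ i ⟧ * debit (u ⊕ i)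
        B i = ⟦ χᵘ i ⟧ * credit (u ⊕ i) + ⟦ χᵘ i ⟧ * ε

        F≤B : ∀ i → F i ≤ B i
        F≤B i with χ (u ⊕ i) in χi
        ... | false = z≤n
        ... | true  = ≤-trans (*-monoʳ-≤ 1 (debit≤ χi)) (≤-reflexive (*-distribˡ-+ 1 (credit (u ⊕ i)) ε))

        saves : ∀ {i x} → i ≢ z → share (u ⊕ i) + x ≤ bound + p → F i + x ≤ B i
        saves {i} {x} i≢z le = scale χi (≤-trans (≤-reflexive (cong (_+ x) debit≡)) (≤-trans le
          (≤-reflexive (trans bound+p (cong (_+ ε) (sym (credit-single {u ⊕ i} (single i χi))))))))
          where
          χi : χ (u ⊕ i) ≡ true
          χi = proj₂ (proj₂ ctr) i i≢z
          debit≡ : debit (u ⊕ i) ≡ share (u ⊕ i)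
          debit≡ = trans (debit-single {u ⊕ i} (single i χi)) (trans (cong (λ v → share (u ⊕ i) + δ * v) (unloaded i))
            (trans (cong (share (u ⊕ i) +_) (*-zeroʳ δ)) (+-identityʳ _)))
          scale : ∀ {b d c} → b ≡ true → d + x ≤ c + ε → ⟦ b ⟧ * d + x ≤ ⟦ b ⟧ * c + ⟦ b ⟧ * ε
          scale {d = d} {c} refl le = ≤-trans (≤-reflexive (cong (_+ x) (*-identityˡ d))) (≤-trans le
            (≤-reflexive (cong₂ _+_ (sym (*-identityˡ c)) (sym (*-identityˡ ε)))))

        sum-B : sum B ≡ credits u + (δ + 6 * s)
        sum-B = trans (∑-distrib-+ (λ i → ⟦ χᵘ i ⟧ * credit (u ⊕ i)) (λ i → ⟦ χᵘ i ⟧ * ε))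
          (cong (credits u +_) (trans (sum-indicator-* χᵘ ε) (trans (cong (_* ε) size) (trans (*-distribˡ-+ (10 + m) X p)
            (cong (δ +_) (w-exact (s≤s z≤n) (≤-trans (≤-trans (n≤1+n (10 + m)) (≤-reflexive (sym n≡))) (n≤1+n n))))))))

        δ≤4s : δ ≤ 4 * s
        δ≤4s = ≤-trans (m≤n+m δ X) (≤-trans (≤-reflexive (sym nX≡)) (≤-trans (m≤m+n (n * X) (w (6 + m))) nX≤))

        enough : debits u + 6 * s + 4 * s ≤ sum B → debits u ≤ credits u
        enough le = linear 0 (+-mono-≤ (≤-trans le (≤-reflexive sum-B)) δ≤4s) (lemma (debits u) (credits u) s δ)
          where
          lemma : ∀ D C s d → D + (C + (d + 6 * s) + 4 * s) + 0 ≡ C + (D + 6 * s + 4 * s + d)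
          lemma = solve-∀

        end : ∃ λ i → i ≢ z × χ (u ⊕ i ⊕ z) ≡ true
        end with count-witness {b = λ i → χ (u ⊕ z ⊕ i)} (subst (1 ≤_) (∣I∣-hub (proj₁ (proj₂ ctr))) (dominated (u ⊕ z)))
        ... | i , χi = i , (λ { refl → true≢false (trans (cong χ (sym (⊕-involutive u i))) χi) (proj₁ ctr) }) , trans (cong χ (⊕-comm u i z)) χi

        i₁ : Fin n
        i₁ = proj₁ end

        i₁≢z : i₁ ≢ z
        i₁≢z = proj₁ (proj₂ end)

        save-i₁ : F i₁ + 6 * s ≤ B i₁
        save-i₁ = saves i₁≢z (AtCentre.code-share ctr i₁≢z (proj₂ (proj₂ end)))

        -- A member other than `i₁` that is no star yields another `4 * s`. A codeword next to it,
        -- or one joining `z` to a leaf, gives this alone. A codeword `u ⊕ l ⊕ j ⊕ k` away from `z`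
        -- saves `2 * s` at each of the members `l`, `j`, `k`, and one of `j`, `k` differs from
        -- `i₁`.
        Good Spare : Fin n → Set
        Good l = l ≢ i₁ → l ≢ z → Star u l
        Spare l = l ≢ i₁ × l ≢ z × ((share (u ⊕ l) + 4 * s ≤ bound + p) ⊎
          (share (u ⊕ l) + 2 * s ≤ bound + p × ∃ λ i → i ≢ l × i ≢ i₁ × i ≢ z × share (u ⊕ i) + 2 * s ≤ bound + p))

        good-or-spare : ∀ l → Good l ⊎ Spare l
        good-or-spare l with l Fin.≟ i₁ | l Fin.≟ z
        ... | yes e  | _     = inj₁ (λ ne _ → contradiction e ne)
        ... | no _   | yes e = inj₁ (λ _ ne → contradiction e ne)
        ... | no l≢i₁ | no l≢z with any-true (λ j → χ (u ⊕ l ⊕ j))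
        ...   | inj₂ (j , χj) with j Fin.≟ z
        ...     | yes refl = inj₂ (l≢i₁ , l≢z , inj₁ (≤-trans (+-monoʳ-≤ (share (u ⊕ l)) (*-monoˡ-≤ s (m≤m+n 4 2))) (AtCentre.code-share ctr l≢z χj)))
        ...     | no j≢z   = inj₂ (l≢i₁ , l≢z , inj₁ (AtCentre.leaf-share ctr l≢z j≢l j≢z χj))
          where
          j≢l : j ≢ l
          j≢l refl = true≢false (trans (cong χ (sym (⊕-involutive u j))) χj) (proj₁ ctr)
        good-or-spare l | no l≢i₁ | no l≢z | inj₁ iso with decide-fin (λ j → decide-fin (test j))
          where
          test : ∀ j k → (j ≢ k → j ≢ l → k ≢ l → χ (u ⊕ l ⊕ j ⊕ k) ≡ false) ⊎ (j ≢ k × j ≢ l × k ≢ l × χ (u ⊕ l ⊕ j ⊕ k) ≡ true)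
          test j k with j Fin.≟ k | j Fin.≟ l | k Fin.≟ l | χ (u ⊕ l ⊕ j ⊕ k)
          ... | yes e | _ | _ | _ = inj₁ (λ ne _ _ → contradiction e ne)
          ... | no _ | yes e | _ | _ = inj₁ (λ _ ne _ → contradiction e ne)
          ... | no _ | no _ | yes e | _ = inj₁ (λ _ _ ne → contradiction e ne)
          ... | no _ | no _ | no _ | false = inj₁ (λ _ _ _ → refl)
          ... | no p | no q | no r | true = inj₂ (p , q , r , refl)
        ... | inj₁ rest = inj₁ (λ _ _ → (λ j _ → iso j) , rest)
        ... | inj₂ (j , k , j≢k , j≢l , k≢l , χjk) with j Fin.≟ z | k Fin.≟ z
        ...   | yes refl | _ = inj₂ (l≢i₁ , l≢z , inj₁ (AtCentre.end-share ctr l≢z k≢l (j≢k ∘ sym) χjk))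
        ...   | no j≢z | yes refl = inj₂ (l≢i₁ , l≢z , inj₁ (AtCentre.end-share ctr l≢z j≢l j≢k (trans (cong χ (⊕-comm (u ⊕ l) k j)) χjk)))
        ...   | no j≢z | no k≢z = inj₂ (l≢i₁ , l≢z , inj₂ (AtCentre.pair-share ctr l≢z j≢k j≢l j≢z k≢l k≢z χjk , second))
          where
          second : ∃ λ i → i ≢ l × i ≢ i₁ × i ≢ z × share (u ⊕ i) + 2 * s ≤ bound + p
          second with j Fin.≟ i₁
          ... | no j≢i₁ = j , j≢l , j≢i₁ , j≢z , AtCentre.pair-share ctr j≢z (k≢l ∘ sym) (j≢l ∘ sym) l≢z (j≢k ∘ sym) k≢z
                  (trans (cong (λ v → χ (v ⊕ k)) (⊕-comm u j l)) χjk)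
          ... | yes refl = k , k≢l , (j≢k ∘ sym) , k≢z , AtCentre.pair-share ctr k≢z (j≢l ∘ sym) (k≢l ∘ sym) l≢z j≢k j≢z
                  (trans (cong χ (trans (⊕-comm (u ⊕ k) l j) (trans (⊕-rotate u k j l) (⊕-comm (u ⊕ l) k j)))) χjk)

      -- The excess is at most `6 * s + δ` and `i₁` saves `6 * s`. A spare member saves `4 * s`, at
      -- least `δ`; without one the configuration is tight, and `δ` is passed to the codeword
      -- `u ⊕ i₁ ⊕ z`.
      unshared-balance : debits u ≤ credits u + δ * tights u
      unshared-balance with decide-fin good-or-spare
      ... | inj₂ (l , l≢i₁ , l≢z , inj₁ le) =
        ≤-trans (enough (sum-save₂ F≤B (l≢i₁ ∘ sym) save-i₁ (saves l≢z le))) (m≤m+n _ _)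
      ... | inj₂ (l , l≢i₁ , l≢z , inj₂ (le , i , i≢l , i≢i₁ , i≢z , le′)) =
        ≤-trans (enough (≤-trans (≤-reflexive (lemma (debits u) s))
          (sum-save₃ F≤B (l≢i₁ ∘ sym) (i≢i₁ ∘ sym) (i≢l ∘ sym) save-i₁ (saves l≢z le) (saves i≢z le′)))) (m≤m+n _ _)
        where
        lemma : ∀ D s → D + 6 * s + 4 * s ≡ D + 6 * s + 2 * s + 2 * s
        lemma = solve-∀
      ... | inj₁ good = linear 0
        (+-mono-≤ (≤-trans (sum-save₁ {h = i₁} F≤B save-i₁) (≤-reflexive sum-B)) (*-monoʳ-≤ δ tights≥1))
        (lemma (debits u) (credits u) s δ (tights u))
        where
        is-tight : Tight u i₁ z
        is-tight = i₁≢z , ctr , proj₂ (proj₂ end) , good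
        tights≥1 : 1 ≤ tights u
        tights≥1 = ≤-trans (count-≥1 {b = tight u i₁} {z} (⇒tight is-tight))
          (subst (λ v → v + count (tight u i₁) ≤ tights u) (trans (sum-const n 0) (*-zeroʳ n))
            (sum-save₁ {f = λ _ → 0} {h = i₁} (λ _ → z≤n) ≤-refl))
        lemma : ∀ D C s d t → D + (C + (d + 6 * s) + d * t) + 0 ≡ C + d * t + (D + 6 * s + d * 1)
        lemma = solve-∀

    centre-balance : debits u ≤ credits u + δ * tights u
    centre-balance with decide-fin test
      where
      test : ∀ i → (χ (u ⊕ i) ≡ true → τ (u ⊕ i) ≡ 1) ⊎ (χ (u ⊕ i) ≡ true × 2 ≤ τ (u ⊕ i))
      test i with χ (u ⊕ i) | τ (u ⊕ i) ℕ.≟ 1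
      ... | false | _      = inj₁ λ ()
      ... | true  | yes τ1 = inj₁ (λ _ → τ1)
      ... | true  | no τ≢1 = inj₂ (refl , ≤∧≢⇒< (count-≥1 {b = λ l → hub (u ⊕ i ⊕ l)} {i} (at-hub i hu)) (τ≢1 ∘ sym))
    ... | inj₁ single = Unshared.unshared-balance single
    ... | inj₂ (i , χi , 2≤τ) with count-witness₂ {b = λ l → hub (u ⊕ i ⊕ l)} i 2≤τ
    ...   | j , j≢i , hj = ≤-trans (Shared.shared-balance χi j≢i hj) (m≤m+n _ _)

  hub-balance : ∀ u → hub u ≡ true → debits u ≤ credits u + δ * tights u
  hub-balance u hu with decide-fin test
    where
    test : ∀ i → (χ (u ⊕ i) ≡ true → share (u ⊕ i) + X ≤ bound) ⊎ (∃ λ z → Centre u z)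
    test i with χ (u ⊕ i) Bool.≟ true
    ... | no ¬χi = inj₁ (λ χi → contradiction χi ¬χi)
    ... | yes χi with star-or-small-at hu i χi
    ...   | inj₂ small = inj₁ (λ _ → small)
    ...   | inj₁ (z , _ , ctr , _) = inj₂ (z , ctr)
  ... | inj₁ small = ≤-trans (starless-balance hu small) (m≤m+n _ _)
  ... | inj₂ (_ , z , ctr) = StarCentre.centre-balance ctr

  -- Double counting over the whole space.

  private
    swap-neighbours : (Φ : Word n → Word n → ℕ) →
      sumW (λ c → sum (λ i → Φ c (c ⊕ i))) ≡ sumW (λ u → sum (λ i → Φ (u ⊕ i) u))
    swap-neighbours Φ = trans (sumW-sum (λ c i → Φ c (c ⊕ i))) (trans (sum-cong-≗ move) (sym (sumW-sum (λ u i → Φ (u ⊕ i) u))))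
      where
      move : ∀ i → sumW (λ c → Φ c (c ⊕ i)) ≡ sumW (λ u → Φ (u ⊕ i) u)
      move i = trans (sumW-cong (λ c → cong (λ v → Φ v (c ⊕ i)) (sym (⊕-involutive c i)))) (sumW-⊕ (λ u → Φ (u ⊕ i) u) i)

  -- After exchanging codewords and neighbours, each word hands out `∣I u ∣ * w ∣I u ∣`. This is a
  -- full charge, as `∣I u ∣` is at least 1 by domination and at most n + 1.
  total-share : sumW (λ c → ⟦ χ c ⟧ * share c) ≡ 2 ^ n * (6 * s)
  total-share = trans (sumW-cong (λ c → trans (*-distribˡ-+ ⟦ χ c ⟧ (w ∣I c ∣) (sum (λ i → w ∣I c ⊕ i ∣)))
      (cong (⟦ χ c ⟧ * w ∣I c ∣ +_) (*-distribˡ-sum ⟦ χ c ⟧ (λ i → w ∣I c ⊕ i ∣)))))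
    (trans (sumW-+ (λ c → ⟦ χ c ⟧ * w ∣I c ∣) (λ c → sum (λ i → ⟦ χ c ⟧ * w ∣I c ⊕ i ∣)))
    (trans (cong (sumW (λ c → ⟦ χ c ⟧ * w ∣I c ∣) +_) (swap-neighbours (λ c u → ⟦ χ c ⟧ * w ∣I u ∣)))
    (trans (sym (sumW-+ (λ c → ⟦ χ c ⟧ * w ∣I c ∣) (λ u → sum (λ i → ⟦ χ (u ⊕ i) ⟧ * w ∣I u ∣))))
    (trans (sumW-cong whole) (sumW-const n (6 * s))))))
    where
    whole : ∀ u → ⟦ χ u ⟧ * w ∣I u ∣ + sum (λ i → ⟦ χ (u ⊕ i) ⟧ * w ∣I u ∣) ≡ 6 * s
    whole u = trans (cong (⟦ χ u ⟧ * w ∣I u ∣ +_) (sum-indicator-* (λ i → χ (u ⊕ i)) (w ∣I u ∣)))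
      (trans (sym (*-distribʳ-+ (w ∣I u ∣) ⟦ χ u ⟧ (count (λ i → χ (u ⊕ i)))))
        (w-exact (dominated u) (+-mono-≤ ⟦ χ u ⟧≤1 (count-≤ (λ i → χ (u ⊕ i))))))

  -- Flipping `a` and `b` permutes the words, so every `δ` that a tight centre passes on is taken up
  -- by one codeword.
  total-load : sumW load ≡ sumW tights
  total-load = trans (sumW-sum (λ c a → count (λ b → tight (c ⊕ a ⊕ b) a b)))
    (trans (sum-cong-≗ (λ a → trans (sumW-sum (λ c b → ⟦ tight (c ⊕ a ⊕ b) a b ⟧))
      (trans (sum-cong-≗ (λ b → trans (sumW-⊕ (λ c → ⟦ tight (c ⊕ b) a b ⟧) a) (sumW-⊕ (λ c → ⟦ tight c a b ⟧) b)))
        (sym (sumW-sum (λ c b → ⟦ tight c a b ⟧))))))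
      (sym (sumW-sum (λ c a → count (λ b → tight c a b)))))

  private
    total-transfer : (f : Word n → ℕ) →
      sumW (λ c → ⟦ χ c ⟧ * (τ c * f c)) ≡ sumW (λ u → ⟦ hub u ⟧ * sum (λ i → ⟦ χ (u ⊕ i) ⟧ * f (u ⊕ i)))
    total-transfer f = trans (sumW-cong spread) (trans (swap-neighbours (λ c u → ⟦ hub u ⟧ * (⟦ χ c ⟧ * f c))) (sumW-cong collect))
      where
      lemma : ∀ x t y → x * (t * y) ≡ t * (x * y)
      lemma = solve-∀
      spread : ∀ c → ⟦ χ c ⟧ * (τ c * f c) ≡ sum (λ i → ⟦ hub (c ⊕ i) ⟧ * (⟦ χ c ⟧ * f c))
      spread c = trans (lemma ⟦ χ c ⟧ (τ c) (f c)) (sym (sum-indicator-* (λ i → hub (c ⊕ i)) (⟦ χ c ⟧ * f c)))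
      collect : ∀ u → sum (λ i → ⟦ hub u ⟧ * (⟦ χ (u ⊕ i) ⟧ * f (u ⊕ i))) ≡ ⟦ hub u ⟧ * sum (λ i → ⟦ χ (u ⊕ i) ⟧ * f (u ⊕ i))
      collect u = sym (*-distribˡ-sum ⟦ hub u ⟧ (λ i → ⟦ χ (u ⊕ i) ⟧ * f (u ⊕ i)))

    scaled-codeword : ∀ c → ⟦ χ c ⟧ * share c + load c * δ + ⟦ χ c ⟧ * (τ c * credit c) ≤ ⟦ χ c ⟧ * T + ⟦ χ c ⟧ * (τ c * debit c)
    scaled-codeword c with χ c Bool.≟ true
    ... | yes χc = scale χc (≤-trans (≤-reflexive (cong (λ v → share c + v + τ c * credit c) (*-comm (load c) δ))) (codeword-balance c χc))
      where
      lemma : ∀ f l t → 1 * f + l + 1 * t ≡ f + l + t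
      lemma = solve-∀
      lemma′ : ∀ f t → f + t ≡ 1 * f + 1 * t
      lemma′ = solve-∀
      scale : ∀ {b f l t T d} → b ≡ true → f + l + t ≤ T + d → ⟦ b ⟧ * f + l + ⟦ b ⟧ * t ≤ ⟦ b ⟧ * T + ⟦ b ⟧ * d
      scale {f = f} {l} {t} {T} {d} refl le = ≤-trans (≤-reflexive (lemma f l t)) (≤-trans le (≤-reflexive (lemma′ T d)))
    ... | no ¬χc = zero′ (≢true⇒≡false ¬χc) load0
      where
      load0 : load c ≡ 0
      load0 with load-cases c
      ... | inj₁ e = e
      ... | inj₂ (_ , a , b , t) = contradiction (Loaded.χd {c} t) ¬χc
      zero′ : ∀ {b f l t y} → b ≡ false → l ≡ 0 → ⟦ b ⟧ * f + l * δ + ⟦ b ⟧ * t ≤ y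
      zero′ refl refl = z≤n

    scaled-hub : ∀ u → ⟦ hub u ⟧ * debits u ≤ ⟦ hub u ⟧ * credits u + tights u * δ
    scaled-hub u with hub u in hu
    ... | false = z≤n
    ... | true  = ≤-trans (≤-reflexive (*-identityˡ (debits u))) (≤-trans (hub-balance u hu)
                    (≤-reflexive (cong₂ _+_ (sym (*-identityˡ (credits u))) (*-comm δ (tights u)))))

  -- In the sum of all balances the credits, the debits and the loads appear on both sides and
  -- cancel, leaving the shares against `T`.
  average-share : 2 ^ n * (6 * s) ≤ sumW (λ c → ⟦ χ c ⟧) * T
  average-share = subst (_≤ sumW (λ c → ⟦ χ c ⟧) * T) total-share
    (linear 0 (+-mono-≤ codewords hubs) (lemma Sh (sumW (λ c → ⟦ χ c ⟧) * T) (sumW tights * δ) Cr Db))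
    where
    Sh Cr Db : ℕ
    Sh = sumW (λ c → ⟦ χ c ⟧ * share c)
    Cr = sumW (λ u → ⟦ hub u ⟧ * credits u)
    Db = sumW (λ u → ⟦ hub u ⟧ * debits u)
    lemma : ∀ S K l C D → S + (K + D + (C + l)) + 0 ≡ K + (S + l + C + D)
    lemma = solve-∀
    hubs : Db ≤ Cr + sumW tights * δ
    hubs = ≤-trans (sumW-mono scaled-hub) (≤-reflexive (trans (sumW-+ (λ u → ⟦ hub u ⟧ * credits u) (λ u → tights u * δ))
      (cong (Cr +_) (sumW-*ʳ tights δ))))
    codewords : Sh + sumW tights * δ + Cr ≤ sumW (λ c → ⟦ χ c ⟧) * T + Db
    codewords = ≤-trans (≤-reflexive (sym lhs)) (≤-trans (sumW-mono scaled-codeword) (≤-reflexive rhs))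
      where
      lhs : sumW (λ c → ⟦ χ c ⟧ * share c + load c * δ + ⟦ χ c ⟧ * (τ c * credit c)) ≡ Sh + sumW tights * δ + Cr
      lhs = trans (sumW-+ (λ c → ⟦ χ c ⟧ * share c + load c * δ) (λ c → ⟦ χ c ⟧ * (τ c * credit c)))
        (cong₂ _+_ (trans (sumW-+ (λ c → ⟦ χ c ⟧ * share c) (λ c → load c * δ))
          (cong (Sh +_) (trans (sumW-*ʳ load δ) (cong (_* δ) total-load)))) (total-transfer credit))
      rhs : sumW (λ c → ⟦ χ c ⟧ * T + ⟦ χ c ⟧ * (τ c * debit c)) ≡ sumW (λ c → ⟦ χ c ⟧) * T + Db
      rhs = trans (sumW-+ (λ c → ⟦ χ c ⟧ * T) (λ c → ⟦ χ c ⟧ * (τ c * debit c)))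
        (cong₂ _+_ (sumW-*ʳ (λ c → ⟦ χ c ⟧) T) (total-transfer debit))

-- From lists of words and distances to characteristic functions.

dist-refl : ∀ {n} (x : Word n) → dist x x ≡ 0
dist-refl []           = refl
dist-refl (true  ∷ xs) = dist-refl xs
dist-refl (false ∷ xs) = dist-refl xs

dist-⊕ : ∀ {n} (x : Word n) i → dist (x ⊕ i) x ≡ 1
dist-⊕ (true  ∷ xs) zero    = cong suc (dist-refl xs)
dist-⊕ (false ∷ xs) zero    = cong suc (dist-refl xs)
dist-⊕ (true  ∷ xs) (suc i) = dist-⊕ xs i
dist-⊕ (false ∷ xs) (suc i) = dist-⊕ xs i

dist≤0⇒≡ : ∀ {n} (x y : Word n) → dist x y ≤ 0 → x ≡ y
dist≤0⇒≡ []           []           _ = refl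
dist≤0⇒≡ (true  ∷ xs) (true  ∷ ys) d = cong (true  ∷_) (dist≤0⇒≡ xs ys d)
dist≤0⇒≡ (false ∷ xs) (false ∷ ys) d = cong (false ∷_) (dist≤0⇒≡ xs ys d)

dist≤1⇒ : ∀ {n} (x y : Word n) → dist x y ≤ 1 → x ≡ y ⊎ ∃ λ i → x ≡ y ⊕ i
dist≤1⇒ []           []           _ = inj₁ refl
dist≤1⇒ (true  ∷ xs) (false ∷ ys) (s≤s d) = inj₂ (zero , cong (true  ∷_) (dist≤0⇒≡ xs ys d))
dist≤1⇒ (false ∷ xs) (true  ∷ ys) (s≤s d) = inj₂ (zero , cong (false ∷_) (dist≤0⇒≡ xs ys d))
dist≤1⇒ (true  ∷ xs) (true  ∷ ys) d with dist≤1⇒ xs ys d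
... | inj₁ e       = inj₁ (cong (true ∷_) e)
... | inj₂ (i , e) = inj₂ (suc i , cong (true ∷_) e)
dist≤1⇒ (false ∷ xs) (false ∷ ys) d with dist≤1⇒ xs ys d
... | inj₁ e       = inj₁ (cong (false ∷_) e)
... | inj₂ (i , e) = inj₂ (suc i , cong (false ∷_) e)

module _ {n : ℕ} where
  open DecMembership (≡-dec {n = n} Bool._≟_) using (_∈?_)

  member : List (Word n) → Word n → Bool
  member xs x = ⌊ x ∈? xs ⌋

  member⇒∈ : ∀ {xs x} → member xs x ≡ true → x ∈ xs
  member⇒∈ {xs} {x} e with x ∈? xs
  ... | yes x∈ = x∈

  ∈⇒member : ∀ {xs x} → x ∈ xs → member xs x ≡ true
  ∈⇒member {xs} {x} x∈ with x ∈? xs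
  ... | yes _ = refl
  ... | no x∉ = contradiction x∈ x∉

  ¬member⇒∉ : ∀ {xs x} → member xs x ≡ false → x ∉ xs
  ¬member⇒∉ e x∈ = true≢false (∈⇒member x∈) e

  sumW-member : ∀ xs → sumW (λ x → ⟦ member xs x ⟧) ≤ length xs
  sumW-member []       = ≤-reflexive (sumW-0 n)
  sumW-member (y ∷ xs) = ≤-trans (sumW-mono ptw) (≤-trans
    (≤-reflexive (sumW-+ (λ x → ⟦ ⌊ ≡-dec Bool._≟_ x y ⌋ ⟧) (λ x → ⟦ member xs x ⟧)))
    (+-mono-≤ (sumW-singleton y (λ x → ⟦ ⌊ ≡-dec Bool._≟_ x y ⌋ ⟧) ⟦ ⌊ ≡-dec Bool._≟_ y y ⌋ ⟧≤1 away) (sumW-member xs)))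
    where
    away : ∀ x → x ≢ y → ⟦ ⌊ ≡-dec Bool._≟_ x y ⌋ ⟧ ≡ 0
    away x x≢y with ≡-dec Bool._≟_ x y
    ... | yes x≡y = contradiction x≡y x≢y
    ... | no _    = refl
    ptw : ∀ x → ⟦ member (y ∷ xs) x ⟧ ≤ ⟦ ⌊ ≡-dec Bool._≟_ x y ⌋ ⟧ + ⟦ member xs x ⟧
    ptw x with ≡-dec Bool._≟_ x y | x ∈? xs
    ... | yes _ | _     = s≤s z≤n
    ... | no _  | yes _ = ≤-refl
    ... | no _  | no _  = z≤n

module CodeProperties {n : ℕ} (C : Code n) (LD : LocatingDominating C) where
  open LocatingDominating LD

  χ : Word n → Bool
  χ = member (words C)

  size : Word n → ℕ
  size = I-size χ

  dominated : ∀ x → 1 ≤ size x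
  dominated x with dominating x
  ... | c , c∈ , d with dist≤1⇒ c x d
  ...   | inj₁ refl = ≤-trans (≤-reflexive (cong ⟦_⟧ (sym (∈⇒member c∈)))) (m≤m+n _ _)
  ...   | inj₂ (i , refl) = ≤-trans (count-≥1 {b = λ i → χ (x ⊕ i)} {i} (∈⇒member c∈)) (m≤n+m _ _)

  private
    size≡ : ∀ {x} → χ x ≡ false → size x ≡ count (λ i → χ (x ⊕ i))
    size≡ {x} e = cong (λ b → ⟦ b ⟧ + count (λ i → χ (x ⊕ i))) e

    I⇒⊕ : ∀ {c x} → χ x ≡ false → c ∈I[ C ] x → ∃ λ i → c ≡ x ⊕ i × χ (x ⊕ i) ≡ true
    I⇒⊕ {c} {x} χx (c∈ , d) with dist≤1⇒ c x d
    ... | inj₁ refl       = ⊥-elim (true≢false (∈⇒member c∈) χx)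
    ... | inj₂ (i , refl) = i , refl , ∈⇒member c∈

    ⊕⇒I : ∀ {x} i → χ (x ⊕ i) ≡ true → (x ⊕ i) ∈I[ C ] x
    ⊕⇒I {x} i χi = member⇒∈ χi , ≤-reflexive (dist-⊕ x i)

    ⊕⇒I′ : ∀ {c x} i → c ≡ x ⊕ i → χ c ≡ true → c ∈I[ C ] x
    ⊕⇒I′ i refl = ⊕⇒I i

    I-one : ∀ {c x i} → χ x ≡ false → size x ≡ 1 → χ (x ⊕ i) ≡ true → c ∈I[ C ] x → c ≡ x ⊕ i
    I-one {c} {x} {i} χx size1 χi c∈ with I⇒⊕ χx c∈
    ... | j , refl , χj with j Fin.≟ i
    ...   | yes refl = refl
    ...   | no j≢i   = contradiction
      (subst (2 ≤_) (trans (sym (size≡ χx)) size1) (count-≥2 {b = λ i → χ (x ⊕ i)} j≢i χj χi)) (λ { (s≤s ()) })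

    I-two : ∀ {c x i j} → χ x ≡ false → size x ≡ 2 → i ≢ j → χ (x ⊕ i) ≡ true → χ (x ⊕ j) ≡ true →
            c ∈I[ C ] x → c ≡ x ⊕ i ⊎ c ≡ x ⊕ j
    I-two {c} {x} {i} {j} χx size2 i≢j χi χj c∈ with I⇒⊕ χx c∈
    ... | l , refl , χl with l Fin.≟ i | l Fin.≟ j
    ...   | yes refl | _        = inj₁ refl
    ...   | no _     | yes refl = inj₂ refl
    ...   | no l≢i   | no l≢j   = contradiction
      (subst (3 ≤_) (trans (sym (size≡ χx)) size2) (count-≥3 {b = λ i → χ (x ⊕ i)} l≢i l≢j i≢j χl χi χj)) (λ { (s≤s (s≤s ())) })

  -- Otherwise `c` would be the only element of both identifying sets.
  located₁ : ∀ c {i j} → χ c ≡ true → i ≢ j → χ (c ⊕ i) ≡ false → χ (c ⊕ j) ≡ false →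
             size (c ⊕ i) ≡ 1 → size (c ⊕ j) ≢ 1
  located₁ c {i} {j} χc i≢j χi χj si sj =
    locating (c ⊕ i) (c ⊕ j) (¬member⇒∉ χi) (¬member⇒∉ χj) (⊕-≢ c i≢j) λ x →
      mk⇔ (move χi si) (move χj sj)
    where
    move : ∀ {x i j} → χ (c ⊕ i) ≡ false → size (c ⊕ i) ≡ 1 → x ∈I[ C ] (c ⊕ i) → x ∈I[ C ] (c ⊕ j)
    move {x} {i} {j} χi si x∈ = ⊕⇒I′ j (trans x≡c (sym (⊕-involutive c j))) (trans (cong χ x≡c) χc)
      where
      x≡c : x ≡ c
      x≡c = trans (I-one {i = i} χi si (trans (cong χ (⊕-involutive c i)) χc) x∈) (⊕-involutive c i)

  -- Otherwise both identifying sets would consist of the two common neighbours `c` and `c ⊕ i ⊕ j`.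
  located₂ : ∀ c {i j} → χ c ≡ true → i ≢ j → χ (c ⊕ i) ≡ false → χ (c ⊕ j) ≡ false →
             χ (c ⊕ i ⊕ j) ≡ true → size (c ⊕ i) ≡ 2 → size (c ⊕ j) ≢ 2
  located₂ c {i} {j} χc i≢j χi χj χij si sj =
    locating (c ⊕ i) (c ⊕ j) (¬member⇒∉ χi) (¬member⇒∉ χj) (⊕-≢ c i≢j) λ x →
      mk⇔ (move i≢j χi χij si) (move (i≢j ∘ sym) χj (trans (cong χ (⊕-comm c j i)) χij) sj)
    where
    move : ∀ {x i j} → i ≢ j → χ (c ⊕ i) ≡ false → χ (c ⊕ i ⊕ j) ≡ true → size (c ⊕ i) ≡ 2 →
           x ∈I[ C ] (c ⊕ i) → x ∈I[ C ] (c ⊕ j)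
    move {x} {i} {j} i≢j χi χij si x∈
      with I-two {i = i} {j} χi si i≢j (trans (cong χ (⊕-involutive c i)) χc) χij x∈
    ... | inj₁ e = ⊕⇒I′ j (trans e (trans (⊕-involutive c i) (sym (⊕-involutive c j)))) (trans (cong χ (trans e (⊕-involutive c i))) χc)
    ... | inj₂ e = ⊕⇒I′ i (trans e (⊕-comm c i j)) (trans (cong χ e) χij)

-- Scaling and the numerical bounds.

reciprocals : ∀ n D → Weight n (D * (suc n) !)
reciprocals n D = record { w = w ; w-antitone = antitone ; w-exact = exact }
  where
  σ : ℕ
  σ = (suc n) !
  w : ℕ → ℕ
  -- The divisor is nonzero by its form and equals `k` for `k ≥ 1`. The default at 0 repeats the
  -- value at 1, so `w` is antitone there as well.
  w k = 6 * D * (σ / suc (pred k))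
  antitone : ∀ {k l} → k ≤ l → w l ≤ w k
  antitone k≤l = *-monoʳ-≤ (6 * D) (/-monoʳ-≤ σ (s≤s (pred-mono-≤ k≤l)))
  exact : ∀ {k} → 1 ≤ k → k ≤ suc n → k * w k ≡ 6 * (D * σ)
  exact {suc k} _ k≤n = trans (lemma (suc k) D (σ / suc k))
    (cong (λ v → 6 * (D * v)) (m*[n/m]≡n (∣-trans (m∣m*n (k !)) (m≤n⇒m!∣n! k≤n))))
    where
    lemma : ∀ k D v → k * (6 * D * v) ≡ 6 * (D * (k * v))
    lemma = solve-∀

-- With s = D σ and X = x σ for σ = (n + 1)!, the scale σ cancels from the final inequality.
code-bound : ∀ {n} m D x → n ≡ 11 + m → 4 * x ≤ D →
             x * (7 + m) + 6 * D ≤ D * (7 + m) → n * x * (6 + m) + 6 * D ≤ 4 * D * (6 + m) →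
             (C : Code n) → LocatingDominating C → 2 ^ n * (6 * D) ≤ ∣ C ∣ᶜ * (n * (3 * D) + 6 * D ∸ x)
code-bound {n} m D x n≡ h₁ h₂ h₃ C LD = *-cancelʳ-≤ _ _ σ {{(suc n) !≢0}} (begin
  2 ^ n * (6 * D) * σ                                  ≡⟨ lemma₁ (2 ^ n) D σ ⟩
  2 ^ n * (6 * (D * σ))                                ≤⟨ average-share ⟩
  sumW (λ c → ⟦ χ c ⟧) * T                             ≤⟨ *-monoˡ-≤ T (sumW-member (words C)) ⟩
  ∣ C ∣ᶜ * T                                           ≡⟨ cong (λ v → ∣ C ∣ᶜ * (v ∸ x * σ)) (lemma₂ n D σ) ⟩
  ∣ C ∣ᶜ * ((n * (3 * D) + 6 * D) * σ ∸ x * σ)         ≡⟨ cong (∣ C ∣ᶜ *_) (sym (*-distribʳ-∸ σ (n * (3 * D) + 6 * D) x)) ⟩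
  ∣ C ∣ᶜ * ((n * (3 * D) + 6 * D ∸ x) * σ)             ≡⟨ *-assoc ∣ C ∣ᶜ _ σ ⟨
  ∣ C ∣ᶜ * (n * (3 * D) + 6 * D ∸ x) * σ               ∎)
  where
  open ≤-Reasoning
  open CodeProperties C LD
  σ : ℕ
  σ = (suc n) !
  W : Weight n (D * σ)
  W = reciprocals n D
  11≤n : 11 ≤ n
  11≤n = subst (11 ≤_) (sym n≡) (m≤m+n 11 m)
  open Weight W
  lemma₁ : ∀ t D σ → t * (6 * D) * σ ≡ t * (6 * (D * σ))
  lemma₁ = solve-∀
  lemma₂ : ∀ n D σ → n * (3 * (D * σ)) + 6 * (D * σ) ≡ (n * (3 * D) + 6 * D) * σ
  lemma₂ = solve-∀
  exact : ∀ j k → k + suc j ≡ 12 → suc j + m ≤ suc n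
  exact j k e = subst (suc j + m ≤_) (trans (sym (+-assoc k (suc j) m)) (trans (cong (_+ m) e) (cong suc (sym n≡)))) (m≤n+m (suc j + m) k)
  disc : Discount W m (x * σ)
  disc = record
    { n≡   = n≡
    ; 4X≤s = subst (_≤ D * σ) (*-assoc 4 x σ) (*-monoˡ-≤ σ h₁)
    ; X≤   = *-cancelˡ-≤ (7 + m) (begin
        (7 + m) * (x * σ + w (7 + m))           ≡⟨ *-distribˡ-+ (7 + m) (x * σ) (w (7 + m)) ⟩
        (7 + m) * (x * σ) + (7 + m) * w (7 + m) ≡⟨ cong ((7 + m) * (x * σ) +_) (w-exact (s≤s z≤n) (exact 6 5 refl)) ⟩
        (7 + m) * (x * σ) + 6 * (D * σ)         ≡⟨ e₁ (7 + m) x D σ ⟩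
        (x * (7 + m) + 6 * D) * σ               ≤⟨ *-monoˡ-≤ σ h₂ ⟩
        D * (7 + m) * σ                         ≡⟨ e₂ (7 + m) D σ ⟩
        (7 + m) * (D * σ)                       ∎)
    ; nX≤  = *-cancelˡ-≤ (6 + m) (begin
        (6 + m) * (n * (x * σ) + w (6 + m))           ≡⟨ *-distribˡ-+ (6 + m) (n * (x * σ)) (w (6 + m)) ⟩
        (6 + m) * (n * (x * σ)) + (6 + m) * w (6 + m) ≡⟨ cong ((6 + m) * (n * (x * σ)) +_) (w-exact (s≤s z≤n) (exact 5 6 refl)) ⟩
        (6 + m) * (n * (x * σ)) + 6 * (D * σ)         ≡⟨ e₃ (6 + m) n x D σ ⟩
        (n * x * (6 + m) + 6 * D) * σ                 ≤⟨ *-monoˡ-≤ σ h₃ ⟩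
        4 * D * (6 + m) * σ                           ≡⟨ e₄ (6 + m) D σ ⟩
        (6 + m) * (4 * (D * σ))                       ∎)
    }
    where
    e₁ : ∀ k x D σ → k * (x * σ) + 6 * (D * σ) ≡ (x * k + 6 * D) * σ
    e₁ = solve-∀
    e₂ : ∀ k D σ → D * k * σ ≡ k * (D * σ)
    e₂ = solve-∀
    e₃ : ∀ k n x D σ → k * (n * (x * σ)) + 6 * (D * σ) ≡ (n * x * k + 6 * D) * σ
    e₃ = solve-∀
    e₄ : ∀ k D σ → 4 * D * k * σ ≡ k * (4 * (D * σ))
    e₄ = solve-∀
  open Discharging W disc 11≤n χ dominated located₁ located₂ using (average-share; T)

Bound₁ Bound₂ : ℕ → Set
Bound₁ n = γLD-≥-frac n (2 ^ (n + 1) * (3 * (n ∸ 4))) (3 * (n ∸ 4) * (n + 1) + 2 * (n ∸ 1))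
Bound₂ n = γLD-≥-frac n (2 ^ (n + 1) * (3 * n * (n * n ∸ 5 * n)))
                        (3 * n * (n * n ∸ 5 * n) * (n + 2) + 6 * n ∸ 4 * (n * n ∸ 5 * n))

-- `X / s` is 1/7 = 1 - 6/(n - 4), the largest value that `X≤` permits.
bound-11 : Bound₁ 11
bound-11 C LD = subst (2 ^ 12 * 21 ≤_) (*-comm ∣ C ∣ᶜ 272)
  (code-bound 0 7 1 refl (m≤m+n 4 3) ≤-refl (m≤m+n 108 60) C LD)

-- `X / s` is 1/4 = 1 - 6/(n - 4), where `4X≤s` is attained too. The stated fraction is not reduced,
-- hence the factor 2.
bound-12 : Bound₁ 12
bound-12 C LD = subst (2 ^ 13 * 24 ≤_) (lemma ∣ C ∣ᶜ)
  (*-monoʳ-≤ 2 (code-bound 1 4 1 refl ≤-refl ≤-refl (m≤m+n 108 4) C LD))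
  where
  lemma : ∀ c → 2 * (c * 167) ≡ 334 * c
  lemma = solve-∀

bound-≥13 : ∀ r → Bound₂ (13 + r)
bound-≥13 r C LD = subst (λ D → 2 ^ (n + 1) * (3 * n * D) ≤ (3 * n * D * (n + 2) + 6 * n ∸ 4 * D) * ∣ C ∣ᶜ) (sym D≡)
  (begin
    2 ^ (n + 1) * (3 * n * D)                        ≡⟨ cong (_* (3 * n * D)) (^-distribˡ-+-* 2 n 1) ⟩
    2 ^ n * 2 * (3 * n * D)                          ≡⟨ e₁ (2 ^ n) n D ⟩
    n * (2 ^ n * (6 * D))                            ≤⟨ *-monoʳ-≤ n (code-bound (2 + r) D x refl c₁ c₂ c₃ C LD) ⟩
    n * (∣ C ∣ᶜ * (n * (3 * D) + 6 * D ∸ x))         ≡⟨ e₂ n ∣ C ∣ᶜ (n * (3 * D) + 6 * D ∸ x) ⟩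
    (n * (n * (3 * D) + 6 * D ∸ x)) * ∣ C ∣ᶜ         ≡⟨ cong (_* ∣ C ∣ᶜ) denominator ⟩
    (3 * n * D * (n + 2) + 6 * n ∸ 4 * D) * ∣ C ∣ᶜ   ∎)
  where
  open ≤-Reasoning
  n D x : ℕ
  n = 13 + r
  D = n * (8 + r)
  -- This is 4n - 26, the solution of n`X` + `w` (n - 5) = `4 * s` when `X / s` is `x / D`; so `nX≤`
  -- holds with equality.
  x = 26 + 4 * r
  D≡ : n * n ∸ 5 * n ≡ D
  D≡ = trans (cong (_∸ 5 * n) (lemma r)) (m+n∸n≡m D (5 * n))
    where
    lemma : ∀ r → (13 + r) * (13 + r) ≡ (13 + r) * (8 + r) + 5 * (13 + r)
    lemma = solve-∀
  e₁ : ∀ t n D → t * 2 * (3 * n * D) ≡ n * (t * (6 * D))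
  e₁ = solve-∀
  e₂ : ∀ n c v → n * (c * v) ≡ n * v * c
  e₂ = solve-∀
  denominator : n * (n * (3 * D) + 6 * D ∸ x) ≡ 3 * n * D * (n + 2) + 6 * n ∸ 4 * D
  denominator = trans (*-distribˡ-∸ n (n * (3 * D) + 6 * D) x)
    -- `n * x` is `4 * D` less `6 * n`, so `6 * n` is added to both terms of the truncated
    -- difference.
    (trans (sym ([m+n]∸[m+o]≡n∸o (6 * n) (n * (n * (3 * D) + 6 * D)) (n * x)))
      (cong₂ _∸_ (lemma₁ n D) (lemma₂ r)))
    where
    lemma₁ : ∀ n D → 6 * n + n * (n * (3 * D) + 6 * D) ≡ 3 * n * D * (n + 2) + 6 * n
    lemma₁ = solve-∀
    lemma₂ : ∀ r → 6 * (13 + r) + (13 + r) * (26 + 4 * r) ≡ 4 * ((13 + r) * (8 + r))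
    lemma₂ = solve-∀
  c₁ : 4 * x ≤ D
  c₁ = subst (4 * x ≤_) (lemma r) (m≤m+n (4 * x) (r * r + 5 * r))
    where
    lemma : ∀ r → 4 * (26 + 4 * r) + (r * r + 5 * r) ≡ (13 + r) * (8 + r)
    lemma = solve-∀
  c₂ : x * (9 + r) + 6 * D ≤ D * (9 + r)
  c₂ = subst (x * (9 + r) + 6 * D ≤_) (lemma r) (m≤m+n (x * (9 + r) + 6 * D) (r * r * r + 20 * (r * r) + 105 * r + 78))
    where
    lemma : ∀ r → (26 + 4 * r) * (9 + r) + 6 * ((13 + r) * (8 + r)) + (r * r * r + 20 * (r * r) + 105 * r + 78) ≡ (13 + r) * (8 + r) * (9 + r)
    lemma = solve-∀
  c₃ : n * x * (8 + r) + 6 * D ≤ 4 * D * (8 + r)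
  c₃ = ≤-reflexive (lemma r)
    where
    lemma : ∀ r → (13 + r) * (26 + 4 * r) * (8 + r) + 6 * ((13 + r) * (8 + r)) ≡ 4 * ((13 + r) * (8 + r)) * (8 + r)
    lemma = solve-∀

theorem7 : (∀ n → 11 ≤ n → n ≤ 12 →
    γLD-≥-frac n (2 ^ (n + 1) * (3 * (n ∸ 4)))
    (3 * (n ∸ 4) * (n + 1) + 2 * (n ∸ 1)))
    × (∀ n → 13 ≤ n →
    γLD-≥-frac n (2 ^ (n + 1) * (3 * n * (n * n ∸ 5 * n)))
    (3 * n * (n * n ∸ 5 * n) * (n + 2) + 6 * n ∸ 4 * (n * n ∸ 5 * n)))
theorem7 = small , large
  where
  small : ∀ n → 11 ≤ n → n ≤ 12 → Bound₁ n
  small n 11≤n n≤12 = case (n ℕ.≟ 12)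
    where
    case : Dec (n ≡ 12) → Bound₁ n
    case (yes n≡12) = subst Bound₁ (sym n≡12) bound-12
    case (no  n≢12) = subst Bound₁ (≤-antisym 11≤n (≤-pred (≤∧≢⇒< n≤12 n≢12))) bound-11
  large : ∀ n → 13 ≤ n → Bound₂ n
  large n 13≤n = subst Bound₂ (proj₂ difference) (bound-≥13 (proj₁ difference))
    where
    difference : ∃ λ r → 13 + r ≡ n
    difference = m≤n⇒∃[o]m+o≡n 13≤n
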